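{- The following statements hold. (i) For any positive integer $k$, $r'_2(K_{2,3\cdot 4^{k-1}-1})=CR(K_{2,3\cdot 4^{k-1}-1},K_3)=4^{k}$. (ii) For any odd prime power $q$, $r'_2\big(K_{2,\frac{3q^2+1}{4}}\big)=CR\big(K_{2,\frac{3q^2+1}{4}},K_3\big)=q^2+2$.
   Context: An edge-colored graph $G$ on $p$ vertices with edge-coloring $\chi$ is called orderable if there exist an ordering $(v_1,\ldots,v_p)$ of $V(G)$ and a list $(c_1,\ldots,c_{p-1})$ of not necessarily distinct colors such that for every edge $v_iv_j\in E(G)$ with $i<j$ we have $\chi(v_iv_j)=c_i$. An edge-colored graph is rainbow if all its edges have pairwise different colors. For a graph $G$, $r'_2(G)$ is the minimum integer $n$ such that every 2-edge-coloring of $K_n$ (each edge gets one of two given colors) contains an orderable copy of $G$. For graphs $G,H$, $CR(G,H)$ is the minimum integer $n$ such that every edge-coloring of $K_n$ with any number of colors contains either an orderable copy of $G$ or a rainbow copy of $H$. Copies are (not necessarily induced) subgraphs with the inherited coloring. -}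

module Defs where

open import Data.Nat using (ℕ; pred; _+_; _≤_; _^_)
open import Data.Nat.Properties using (pred[n]≤n)
open import Data.Nat.Primality using (Prime)
open import Data.Fin using (Fin; inject≤) renaming (_<_ to _<ᶠ_; _≟_ to _≟ᶠ_)
open import Data.Fin.Properties using (+↔⊎)
open import Data.Product using (Σ-syntax; ∃-syntax; _×_)
open import Data.Sum using (_⊎_; inj₁; inj₂)
open import Data.Empty using (⊥)
open import Data.Unit using (⊤; tt)
open import Function using (_∘_)
open import Function.Bundles using (_↔_; Inverse)
open import Function.Definitions using (Injective)
open import Function.Construct.Identity using (↔-id)
open import Relation.Binary.Definitions using (Symmetric; Irreflexive; Decidable)
open import Relation.Binary.PropositionalEquality using (_≡_; _≢_; refl; sym)
open import Relation.Nullary using (¬_; yes; no)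
open import Relation.Nullary.Decidable using (¬?)

record Graph : Set₁ where
  field
    V          : Set
    order      : ℕ
    enumerate  : Fin order ↔ V
    Adj        : V → V → Set
    adj-sym    : Symmetric Adj
    adj-irrefl : Irreflexive _≡_ Adj
    adj?       : Decidable Adj

complete : ℕ → Graph
complete n = record
  { V          = Fin n
  ; order      = n
  ; enumerate  = ↔-id (Fin n)
  ; Adj        = _≢_
  ; adj-sym    = λ x≢y → x≢y ∘ sym
  ; adj-irrefl = λ x≡y x≢y → x≢y x≡y
  ; adj?       = λ x y → ¬? (x ≟ᶠ y)
  }

module _ {A B : Set} where

  OppositeSides : A ⊎ B → A ⊎ B → Set
  OppositeSides (inj₁ _) (inj₁ _) = ⊥
  OppositeSides (inj₁ _) (inj₂ _) = ⊤
  OppositeSides (inj₂ _) (inj₁ _) = ⊤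
  OppositeSides (inj₂ _) (inj₂ _) = ⊥

  oppositeSides-sym : Symmetric OppositeSides
  oppositeSides-sym {inj₁ _} {inj₂ _} _ = tt
  oppositeSides-sym {inj₂ _} {inj₁ _} _ = tt

  oppositeSides-irrefl : Irreflexive _≡_ OppositeSides
  oppositeSides-irrefl {inj₁ _} refl ()
  oppositeSides-irrefl {inj₂ _} refl ()

  oppositeSides? : Decidable OppositeSides
  oppositeSides? (inj₁ _) (inj₁ _) = no λ ()
  oppositeSides? (inj₁ _) (inj₂ _) = yes tt
  oppositeSides? (inj₂ _) (inj₁ _) = yes tt
  oppositeSides? (inj₂ _) (inj₂ _) = no λ ()

completeBipartite : ℕ → ℕ → Graph
completeBipartite m n = record
  { V          = Fin m ⊎ Fin n
  ; order      = m + n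
  ; enumerate  = +↔⊎
  ; Adj        = OppositeSides
  ; adj-sym    = λ {x} {y} → oppositeSides-sym {x = x} {y = y}
  ; adj-irrefl = oppositeSides-irrefl
  ; adj?       = oppositeSides?
  }

-- Colours are assigned to edges only.  Irrelevance of the adjacency proof
-- together with colour-sym makes the colour a function of the unordered pair.
record EdgeColouring (G : Graph) (C : Set) : Set where
  open Graph G
  field
    colour     : (x y : V) → .(Adj x y) → C
    colour-sym : (x y : V) .(e : Adj x y) →
                 colour x y e ≡ colour y x (adj-sym e)

module _ {G : Graph} {C : Set} (χ : EdgeColouring G C) where
  open Graph G
  open EdgeColouring χ

  -- The list of colours has pred order entries.  A vertex that precedes some
  -- other vertex is never the last one, so letting i range over
  -- Fin (pred order) covers every edge.
  Orderable : Set
  Orderable =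
    Σ[ v ∈ Fin order ↔ V ] Σ[ c ∈ (Fin (pred order) → C) ]
      let at = Inverse.to v
          ι  = λ (i : Fin (pred order)) → inject≤ i pred[n]≤n
      in ∀ (i : Fin (pred order)) (j : Fin order) → ι i <ᶠ j →
         (e : Adj (at (ι i)) (at j)) → colour (at (ι i)) (at j) e ≡ c i

  SameEdge : V → V → V → V → Set
  SameEdge x y z w = (x ≡ z × y ≡ w) ⊎ (x ≡ w × y ≡ z)

  Rainbow : Set
  Rainbow = ∀ {x y z w} (e : Adj x y) (f : Adj z w) →
            ¬ SameEdge x y z w → colour x y e ≢ colour z w f

record Copy (G H : Graph) : Set where
  private
    module G = Graph G
    module H = Graph H
  field
    embed     : G.V → H.V
    injective : Injective _≡_ _≡_ embed
    adj       : ∀ {x y} → G.Adj x y → H.Adj (embed x) (embed y)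

inherited : ∀ {G H C} → EdgeColouring H C → Copy G H → EdgeColouring G C
inherited χ f = record
  { colour     = λ x y e → colour (embed x) (embed y) (adj e)
  ; colour-sym = λ x y e → colour-sym (embed x) (embed y) (adj e)
  }
  where
  open EdgeColouring χ
  open Copy f

HasOrderableCopy : ∀ {H C} → Graph → EdgeColouring H C → Set
HasOrderableCopy {H} G χ = Σ[ f ∈ Copy G H ] Orderable (inherited χ f)

HasRainbowCopy : ∀ {H C} → Graph → EdgeColouring H C → Set
HasRainbowCopy {H} G χ = Σ[ f ∈ Copy G H ] Rainbow (inherited χ f)

IsMinimum : (ℕ → Set) → ℕ → Set
IsMinimum P n = P n × (∀ m → P m → n ≤ m)

-- r′₂ and CR are relations, since constructively a minimum is only known to exist
-- once a witness is found: r′₂[ G ]≔ n reads r′₂(G) = n, and likewise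
-- CR[ G , H ]≔ n reads CR(G, H) = n.
r′₂[_]≔_ : Graph → ℕ → Set
r′₂[ G ]≔ n =
  IsMinimum (λ N → (χ : EdgeColouring (complete N) (Fin 2)) →
                   HasOrderableCopy G χ) n

CR[_,_]≔_ : Graph → Graph → ℕ → Set
CR[ G , H ]≔ n =
  IsMinimum (λ N → (r : ℕ) (χ : EdgeColouring (complete N) (Fin r)) →
                   HasOrderableCopy G χ ⊎ HasRainbowCopy H χ) n

PrimePower : ℕ → Set
PrimePower q = ∃[ p ] ∃[ e ] Prime p × 1 ≤ e × q ≡ p ^ e

{-# OPTIONS --safe #-}
module Submission where

-- A copy of K_{2,t} on the pair a , b is orderable iff, for one of the two
-- vertices x ∈ {a , b} and one colour c, every other vertex u of the copy has
-- χ(au) = χ(bu) or χ(xu) = c; call the remaining vertices bad.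
--
-- Upper bound.  In a colouring without rainbow triangle that uses three colours,
-- Gallai's theorem yields a proper homogeneous set with at least two vertices.
-- All bad vertices of a pair inside such a set lie in the set, so one may descend
-- to a 2-coloured set.  There, counting the triples (a , b , u) with au and bu of
-- different colours by u gives at most n (n - 1)² / 4, so some pair has few bad
-- vertices.
--
-- Lower bound.  The colouring is the sign pattern of a symmetric matrix in which,
-- for any two rows, the column patterns (+ , -) and (- , +) occur equally often:
-- for 4ᵏ it is a tensor power of J - 2 I, switched so that one vertex can be
-- deleted; for odd q it is a regular symmetric conference matrix of order q² + 1,
-- obtained from a core of order q.  The core of prime order is Paley's, and
-- Turyn's construction passes from p to pᵉ, so no finite field other than ℤ/p
-- is needed.

-- The constants come from one average. If every ordered pair had at least K bad vertices, the count
-- would force 4 K ≤ n - 1. So with K the least integer such that n ≤ 4 K, some pair has at most K -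
-- 1 bad vertices and hence at least n - 1 - K usable leaves; in both parts of the theorem t = n - 1
-- - K.
--
-- For sharpness no pair may beat the average, whichever of its vertices comes first and whichever
-- colour is listed for it. Two colours leave only two bad patterns on a pair, (+ , -) and (- , +),
-- and each has to occur about n / 4 times. Orthogonality of two rows fixes the number of columns
-- where they disagree; equality of their sums splits these columns evenly. Equal row sums are the
-- obstacle: a symmetric matrix with orthogonal rows need not have them, and both matrices are
-- switched to acquire them, for 4ᵏ with the exception of one row, whose vertex is then deleted.
--
-- The order is q² + 1 and not q + 1 because the core of order q may be skew, while its tensor
-- square is always symmetric.

-- Counting decidable subsets of a finite set

module Counting where

  open import Data.Nat
  open import Data.Nat.Properties hiding (suc-injective)
  open import Data.Fin using (Fin; zero; suc)
  open import Data.Fin.Properties using (suc-injective; injective⇒≤)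
  open import Data.Product using (∃-syntax; _,_; proj₁; proj₂)
  open import Data.Empty using (⊥-elim)
  open import Function using (_∘_)
  open import Function.Definitions using (Injective)
  open import Relation.Nullary using (¬_; Dec; yes; no)
  open import Relation.Nullary.Decidable using (¬?)
  open import Relation.Unary using (Pred; Decidable)
  open import Relation.Binary.PropositionalEquality
  open import Level using (0ℓ)
  open import Algebra.Properties.Semiring.Sum +-*-semiring public

  ⟦_⟧ : {A : Set} → Dec A → ℕ
  ⟦ yes _ ⟧ = 1
  ⟦ no _ ⟧  = 0

  ⟦⟧-mono : {A B : Set} → (A → B) → (a? : Dec A) (b? : Dec B) → ⟦ a? ⟧ ≤ ⟦ b? ⟧
  ⟦⟧-mono f (yes a) (yes b) = ≤-refl
  ⟦⟧-mono f (yes a) (no ¬b) = ⊥-elim (¬b (f a))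
  ⟦⟧-mono f (no ¬a) b?      = z≤n

  count : ∀ {n} {P : Pred (Fin n) 0ℓ} → Decidable P → ℕ
  count P? = sum (λ i → ⟦ P? i ⟧)

  sum-mono : ∀ {n} (f g : Fin n → ℕ) → (∀ i → f i ≤ g i) → sum f ≤ sum g
  sum-mono {zero}  f g f≤g = z≤n
  sum-mono {suc n} f g f≤g = +-mono-≤ (f≤g zero) (sum-mono (f ∘ suc) (g ∘ suc) (f≤g ∘ suc))

  sum-const : ∀ n c → ∑[ i < n ] c ≡ n * c
  sum-const zero    c = refl
  sum-const (suc n) c = cong (c +_) (sum-const n c)

  count-mono-< : ∀ {n} {P Q : Pred (Fin n) 0ℓ} (P? : Decidable P) (Q? : Decidable Q) →
                 (∀ x → P x → Q x) → ∀ x → Q x → ¬ P x → count P? < count Q?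
  count-mono-< P? Q? P⊆Q zero    q ¬p with P? zero | Q? zero
  ... | yes p | _     = ⊥-elim (¬p p)
  ... | no _  | no ¬q = ⊥-elim (¬q q)
  ... | no _  | yes _ = s≤s (sum-mono _ _ (λ i → ⟦⟧-mono (P⊆Q (suc i)) (P? (suc i)) (Q? (suc i))))
  count-mono-< P? Q? P⊆Q (suc x) q ¬p =
    +-mono-≤-< (⟦⟧-mono (P⊆Q zero) (P? zero) (Q? zero))
               (count-mono-< (P? ∘ suc) (Q? ∘ suc) (P⊆Q ∘ suc) x q ¬p)

  count-¬ : ∀ {n} {P : Pred (Fin n) 0ℓ} (P? : Decidable P) → count P? + count (¬? ∘ P?) ≡ n
  count-¬ {zero}  P? = refl
  count-¬ {suc n} P? with P? zero
  ... | yes _ = cong suc (count-¬ (P? ∘ suc))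
  ... | no _  = trans (+-suc _ _) (cong suc (count-¬ (P? ∘ suc)))

  -- Listing a subset by an injection from `Fin s` turns it into a vertex set of its own: colourings
  -- are restricted along `at`, and leaves of a copy are chosen through it.
  record Enumeration {n} (P : Pred (Fin n) 0ℓ) (s : ℕ) : Set where
    field
      at        : Fin s → Fin n
      injective : Injective _≡_ _≡_ at
      sound     : ∀ i → P (at i)
      complete  : ∀ x → P x → ∃[ i ] at i ≡ x

  enumerate : ∀ {n} {P : Pred (Fin n) 0ℓ} (P? : Decidable P) → Enumeration P (count P?)
  enumerate {zero} P? = record
    { at = λ () ; injective = λ { {()} } ; sound = λ () ; complete = λ () }
  enumerate {suc n} {P} P? with P? zero | enumerate (P? ∘ suc)
  ... | yes p | e = record { at = at′ ; injective = inj ; sound = snd ; complete = cmp }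
    where
    open Enumeration e
    at′ : Fin (suc (count (P? ∘ suc))) → Fin (suc n)
    at′ zero    = zero
    at′ (suc i) = suc (at i)
    inj : Injective _≡_ _≡_ at′
    inj {zero}  {zero}  _  = refl
    inj {suc i} {suc j} eq = cong suc (injective (suc-injective eq))
    snd : ∀ i → P (at′ i)
    snd zero    = p
    snd (suc i) = sound i
    cmp : ∀ x → P x → ∃[ i ] at′ i ≡ x
    cmp zero    _ = zero , refl
    cmp (suc x) q with complete x q
    ... | i , eq = suc i , cong suc eq
  ... | no ¬p | e = record { at = suc ∘ at ; injective = injective ∘ suc-injective ; sound = sound ; complete = cmp }
    where
    open Enumeration e
    cmp : ∀ x → P x → ∃[ i ] suc (at i) ≡ x
    cmp zero    p = ⊥-elim (¬p p)
    cmp (suc x) q with complete x q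
    ... | i , eq = i , cong suc eq

  injection⇒≤count : ∀ {m n} {P : Pred (Fin n) 0ℓ} (P? : Decidable P) (u : Fin m → Fin n) →
                     Injective _≡_ _≡_ u → (∀ i → P (u i)) → m ≤ count P?
  injection⇒≤count P? u u-inj Pu = injective⇒≤ {f = λ i → proj₁ (index i)} λ {i} {j} eq →
    u-inj (trans (sym (proj₂ (index i))) (trans (cong at eq) (proj₂ (index j))))
    where
    open Enumeration (enumerate P?)
    index : ∀ i → ∃[ k ] at k ≡ u i
    index i = complete (u i) (Pu i)

-- Gallai's theorem: three colours without rainbow triangle yield a proper homogeneous set

module Gallai where

  open Counting
  open import Data.Nat using (ℕ; zero; suc; _+_; _<_)
  open import Data.Nat.Properties using (_≟_)
  open import Data.Nat.Induction using (<-wellFounded)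
  open import Induction.WellFounded using (Acc; acc)
  open import Data.Fin using (Fin; zero; suc) renaming (_≟_ to _≟ᶠ_)
  open import Data.Fin.Properties using (any?)
  open import Data.Bool using (Bool; true; false; not)
  import Data.Bool as Bool
  open import Data.Bool.Properties using (not-injective)
  open import Data.Product using (Σ-syntax; ∃-syntax; _×_; _,_; proj₁; proj₂)
  open import Data.Sum using (_⊎_; inj₁; inj₂)
  open import Data.Empty using (⊥-elim)
  open import Function using (_∘_)
  open import Relation.Nullary using (¬_; Dec; yes; no)
  open import Relation.Nullary.Decidable using (¬?; _×-dec_)
  open import Relation.Binary.PropositionalEquality

  -- The colour of a pair; only its values off the diagonal are meaningful.  The
  -- rainbow-free condition is phrased so that it also holds for degenerate triples.
  record GallaiColouring (n : ℕ) : Set where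
    field
      col    : Fin n → Fin n → ℕ
      symm   : ∀ x y → col x y ≡ col y x
      gallai : ∀ x y z → col x y ≢ col x z → col x y ≢ col y z → col x z ≡ col y z

  restrict : ∀ {m n} → (Fin m → Fin n) → GallaiColouring n → GallaiColouring m
  restrict f G = record
    { col    = λ x y → col (f x) (f y)
    ; symm   = λ x y → symm (f x) (f y)
    ; gallai = λ x y z → gallai (f x) (f y) (f z)
    }
    where open GallaiColouring G

  module _ {n} (G : GallaiColouring n) where
    open GallaiColouring G

    -- Since `col` is symmetric, these are the unions of connected components of the graph of colour
    -- `c`. Working with closed sets avoids paths and components altogether.
    Closed : ℕ → (Fin n → Bool) → Set
    Closed c S = ∀ a b → S a ≡ true → col a b ≡ c → S b ≡ true

    Homogeneous : (Fin n → Bool) → Set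
    Homogeneous M = ∀ a b w → M a ≡ true → M b ≡ true → M w ≡ false → col a w ≡ col b w

    -- A witness that the graph of colour `c` is disconnected.
    Cut : ℕ → Set
    Cut c = Σ[ S ∈ (Fin n → Bool) ] Closed c S × (∃[ x ] S x ≡ true) × (∃[ y ] S y ≡ false)

    true≢false : ∀ {b} → b ≡ true → b ≢ false
    true≢false refl ()

    closed-across : ∀ {c S} → Closed c S → ∀ {a b} → S a ≡ true → S b ≡ false → col a b ≢ c
    closed-across cl Sa Sb ab = true≢false (cl _ _ Sa ab) Sb

    complement-closed : ∀ {c S} → Closed c S → Closed c (not ∘ S)
    complement-closed {S = S} cl a b ¬Sa ab with S b in Sb
    ... | false = refl
    ... | true  = ⊥-elim (true≢false ¬Sa (cong not (cl b a Sb (trans (symm b a) ab))))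

    -- Keeping only the vertices of a closed set that see some outside vertex w in
    -- the same colour as x does preserves closedness, and can be repeated until
    -- the set is homogeneous.
    refine : ∀ {c} (S : Fin n → Bool) x → Closed c S → S x ≡ true →
             Σ[ M ∈ (Fin n → Bool) ] Closed c M × Homogeneous M × M x ≡ true ×
                                     (∀ a → M a ≡ true → S a ≡ true)
    refine {c} S x clS Sx = go S clS Sx (<-wellFounded _)
      where
      go : ∀ S → Closed c S → S x ≡ true → Acc _<_ (count (λ a → S a Bool.≟ true)) →
           Σ[ M ∈ (Fin n → Bool) ] Closed c M × Homogeneous M × M x ≡ true ×
                                   (∀ a → M a ≡ true → S a ≡ true)
      go S clS Sx (acc rs) with any? (λ a → any? (λ w →
        (S a Bool.≟ true) ×-dec (S w Bool.≟ false) ×-dec ¬? (col a w ≟ col x w)))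
      ... | no ∄ = S , clS , hom , Sx , λ _ p → p
        where
        same : ∀ a w → S a ≡ true → S w ≡ false → col a w ≡ col x w
        same a w Sa Sw with col a w ≟ col x w
        ... | yes e = e
        ... | no ¬e = ⊥-elim (∄ (a , w , Sa , Sw , ¬e))
        hom : Homogeneous S
        hom a b w Sa Sb Sw = trans (same a w Sa Sw) (sym (same b w Sb Sw))
      ... | yes (a , w , Sa , Sw , a≢) =
        let M , clM , homM , Mx , M⊆S′ = go S′ clS′ S′x (rs smaller)
        in M , clM , homM , Mx , λ b Mb → S′⊆S b (M⊆S′ b Mb)
        where
        S′ : Fin n → Bool
        S′ b with S b | col b w ≟ col x w
        ... | true | yes _ = true
        ... | _    | _     = false
        S′-intro : ∀ b → S b ≡ true → col b w ≡ col x w → S′ b ≡ true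
        S′-intro b Sb e with S b | col b w ≟ col x w
        ... | true | yes _ = refl
        ... | true | no ¬e = ⊥-elim (¬e e)
        S′⊆S : ∀ b → S′ b ≡ true → S b ≡ true
        S′⊆S b p with S b | col b w ≟ col x w
        ... | true | yes _ = refl
        S′-col : ∀ b → S′ b ≡ true → col b w ≡ col x w
        S′-col b p with S b | col b w ≟ col x w
        ... | true | yes e = e
        S′x : S′ x ≡ true
        S′x = S′-intro x Sx refl
        clS′ : Closed c S′
        clS′ b b′ S′b bb′ = S′-intro b′ Sb′ (trans (sym bw≡b′w) (S′-col b S′b))
          where
          Sb  = S′⊆S b S′b
          Sb′ = clS b b′ Sb bb′
          bw≡b′w : col b w ≡ col b′ w
          -- The edge `b b′` has colour `c`, and the edges from `b` and `b′` to `w` leave the closed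
          -- set `S`, so they do not; a triangle that is not rainbow gives them the same colour.
          bw≡b′w = gallai b b′ w
            (λ e → closed-across clS Sb Sw (trans (sym e) bb′))
            (λ e → closed-across clS Sb′ Sw (trans (sym e) bb′))
        smaller : count (λ b → S′ b Bool.≟ true) < count (λ b → S b Bool.≟ true)
        smaller = count-mono-< _ _ S′⊆S a Sa (λ S′a → a≢ (S′-col a S′a))

  module _ {m} (G : GallaiColouring (suc m)) where
    open GallaiColouring G
    private
      G′ = restrict suc G

      extend : Bool → (Fin m → Bool) → Fin (suc m) → Bool
      extend b S zero    = b
      extend b S (suc x) = S x

      Away : ℕ → (Fin m → Bool) → Set
      Away c S = ¬ (∃[ x ] S x ≡ true × col zero (suc x) ≡ c)

      extend-out : ∀ {c S} → Closed G′ c S → Away c S → Closed G c (extend false S)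
      extend-out cl aw (suc a) zero    Sa e = ⊥-elim (aw (a , Sa , trans (symm zero (suc a)) e))
      extend-out cl aw (suc a) (suc b) Sa e = cl a b Sa e

      extend-in : ∀ {c S} → Closed G′ c S → Away c (not ∘ S) → Closed G c (extend true S)
      extend-in cl aw a       zero    Sa e = refl
      extend-in {S = S} cl aw zero (suc b) Sa e with S b in Sb
      ... | true  = refl
      ... | false = ⊥-elim (aw (b , cong not Sb , e))
      extend-in cl aw (suc a) (suc b) Sa e = cl a b Sa e

      link? : ∀ c (S : Fin m → Bool) → Dec (∃[ x ] S x ≡ true × col zero (suc x) ≡ c)
      link? c S = any? λ x → (S x Bool.≟ true) ×-dec (col zero (suc x) ≟ c)

      -- If the vertex `zero` meets no edge of colour `d`, it is a component by itself; `x₀` only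
      -- makes the other side nonempty.
      isolated : ∀ {d} → Fin m → ¬ (∃[ x ] col zero (suc x) ≡ d) → Cut G d
      isolated x₀ ∄ = extend true (λ _ → false) , cl , (zero , refl) , (suc x₀ , refl)
        where
        cl : Closed G _ (extend true (λ _ → false))
        cl zero zero    _ _ = refl
        cl zero (suc b) _ e = ⊥-elim (∄ (b , e))

    -- Let v be the vertex `zero`. A colour absent at v is cut at once, so v may be assumed to have
    -- a neighbour `y` in colour `d` and `z` in colour `e`. A closed set of the remaining vertices
    -- still gives a cut unless v has `c`-neighbours on both sides of it. After refinement to
    -- homogeneous sets around `y` and `z`, that last possibility would identify `d` with `e`.
    cut-step : ∀ {c d e} → c ≢ d → c ≢ e → d ≢ e → Cut G′ c → Cut G c ⊎ Cut G d ⊎ Cut G e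
    cut-step {c} {d} {e} c≢d c≢e d≢e (S , clS , (x₁ , Sx₁) , (x₂ , Sx₂))
      with any? (λ y → col zero (suc y) ≟ d) | any? (λ z → col zero (suc z) ≟ e)
    ... | no ∄y        | _            = inj₂ (inj₁ (isolated x₁ ∄y))
    ... | yes _        | no ∄z        = inj₂ (inj₂ (isolated x₁ ∄z))
    ... | yes (y , vy) | yes (z , vz) = inj₁ (go (S y) refl)
      where
      _~_ = λ a b → col (suc a) (suc b)

      symm′ : ∀ a b → a ~ b ≡ b ~ a
      symm′ a b = symm (suc a) (suc b)

      -- A c-neighbour s of the removed vertex v sees w in the colour of vw, unless sw has colour c.
      transfer : ∀ {s w k} → col zero (suc s) ≡ c → col zero (suc w) ≡ k → c ≢ k → s ~ w ≢ c → s ~ w ≡ k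
      transfer {s} {w} vs vw c≢k sw = sym (trans (sym vw) (gallai zero (suc s) (suc w)
        (λ q → c≢k (trans (sym vs) (trans q vw))) (λ q → sw (trans (sym q) vs))))

      module _ (S : Fin m → Bool) (clS : Closed G′ c S) (Sy : S y ≡ true) (o : Fin m) (So : S o ≡ false) where
        component-case : Cut G c
        component-case with refine G′ S y clS Sy
        ... | M , clM , homM , My , M⊆S with M o in Mo
        ... | true = ⊥-elim (true≢false G′ (M⊆S o Mo) So)
        ... | false with link? c M | link? c (not ∘ M)
        ... | no aw | _ = extend false M , extend-out clM aw , (suc y , My) , (zero , refl)
        ... | yes _ | no aw = extend true M , extend-in clM aw , (zero , refl) , (suc o , Mo)
        ... | yes (s , Ms , vs) | yes (r , ¬Mr , vr) with not-injective {y = false} ¬Mr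
        ... | Mr with M z in Mz
        -- Here `y` and `z` both lie in `M`. The outside vertex `r` sees them in the colours `d` and
        -- `e`, which homogeneity forbids.
        ... | true = ⊥-elim (d≢e (trans (sym ry) (trans (symm′ r y) (trans (homM y z r My Mz Mr) (trans (symm′ z r) rz)))))
          where
          ry : r ~ y ≡ d
          ry = transfer vr vy c≢d (λ q → closed-across G′ clM My Mr (trans (symm′ y r) q))
          rz : r ~ z ≡ e
          rz = transfer vr vz c≢e (λ q → closed-across G′ clM Mz Mr (trans (symm′ z r) q))
        ... | false with refine G′ (not ∘ M) z (complement-closed G′ clM) (cong not Mz)
        ... | N , clN , homN , Nz , N⊆ with link? c N | N y in Ny
        ... | _ | true = ⊥-elim (true≢false G′ My (not-injective {y = false} (N⊆ y Ny)))
        ... | no aw | false = extend false N , extend-out clN aw , (suc z , Nz) , (zero , refl)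
        -- Homogeneity of `N` gives `ty` the colour of `zy`, and homogeneity of `M` gives `yz` the
        -- colour of `sz`. The first edge of this chain has colour `d` and the last has colour `e`.
        ... | yes (t , Nt , vt) | false = ⊥-elim (d≢e (trans (sym ty) (trans (homN t z y Nt Nz Ny) (trans (symm′ z y) (trans (homM y s z My Ms Mz) sz)))))
          where
          sz : s ~ z ≡ e
          sz = transfer vs vz c≢e (closed-across G′ clM Ms Mz)
          ty : t ~ y ≡ d
          ty = transfer vt vy c≢d (closed-across G′ clN Nt Ny)

      go : ∀ b → S y ≡ b → Cut G c
      go true  Sy = component-case S clS Sy x₂ Sx₂
      go false Sy = component-case (not ∘ S) (complement-closed G′ clS) (cong not Sy) x₁ (cong not Sx₁)

  singleton : (G : GallaiColouring 2) → ∀ {c} → GallaiColouring.col G zero (suc zero) ≢ c → Cut G c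
  singleton G {c} 01≢c = S , cl , (zero , refl) , (suc zero , refl)
    where
    S : Fin 2 → Bool
    S zero    = true
    S (suc _) = false
    cl : Closed G c S
    cl zero zero       _ _ = refl
    cl zero (suc zero) _ q = ⊥-elim (01≢c q)

  -- Induction on the number of vertices. A single edge cannot have both colours `c` and `d`; in the
  -- step, whichever colour is cut without the vertex `zero` takes the first place in `cut-step`.
  cut : ∀ n (G : GallaiColouring (2 + n)) {c d e} → c ≢ d → c ≢ e → d ≢ e → Cut G c ⊎ Cut G d ⊎ Cut G e
  cut zero G {c} {d} {e} c≢d c≢e d≢e with GallaiColouring.col G zero (suc zero) ≟ c
  ... | no 01≢c  = inj₁ (singleton G 01≢c)
  ... | yes 01≡c = inj₂ (inj₁ (singleton G λ q → c≢d (trans (sym 01≡c) q)))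
  cut (suc n) G c≢d c≢e d≢e with cut n (restrict suc G) c≢d c≢e d≢e
  ... | inj₁ C        = cut-step G c≢d c≢e d≢e C
  ... | inj₂ (inj₁ D) with cut-step G (c≢d ∘ sym) d≢e c≢e D
  ... | inj₁ D′        = inj₂ (inj₁ D′)
  ... | inj₂ (inj₁ C′) = inj₁ C′
  ... | inj₂ (inj₂ E′) = inj₂ (inj₂ E′)
  cut (suc n) G c≢d c≢e d≢e | inj₂ (inj₂ E) with cut-step G (c≢e ∘ sym) (d≢e ∘ sym) c≢d E
  ... | inj₁ E′        = inj₂ (inj₂ E′)
  ... | inj₂ (inj₁ C′) = inj₁ C′
  ... | inj₂ (inj₂ D′) = inj₂ (inj₁ D′)

  Edge : ∀ {n} → GallaiColouring n → ℕ → Set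
  Edge {n} G c = ∃[ x ] ∃[ z ] x ≢ z × col x z ≡ c
    where open GallaiColouring G

  record Module {n} (G : GallaiColouring n) : Set where
    field
      M           : Fin n → Bool
      homogeneous : Homogeneous G M
      x z         : Fin n
      x≢z         : x ≢ z
      Mx          : M x ≡ true
      Mz          : M z ≡ true
      y           : Fin n
      ¬My         : M y ≡ false

  -- The edge of colour `c` keeps the homogeneous set from being a single vertex: `M` stays closed
  -- under refinement, so it contains both ends or neither.
  cut⇒module : ∀ {n} (G : GallaiColouring n) {c} → Edge G c → Cut G c → Module G
  cut⇒module {n} G {c} (x , z , x≢z , xz) (S , clS , (x₁ , Sx₁) , (x₂ , Sx₂)) = go (S x) refl
    where
    side : ∀ S → Closed G c S → S x ≡ true → ∀ y → S y ≡ false → Module G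
    side S clS Sx y Sy with refine G S x clS Sx
    ... | M , clM , homM , Mx , M⊆S with M y in My
    ... | true  = ⊥-elim (true≢false G (M⊆S y My) Sy)
    ... | false = record
      { M = M ; homogeneous = homM ; x = x ; z = z ; x≢z = x≢z
      ; Mx = Mx ; Mz = clM x z Mx xz ; y = y ; ¬My = My }
    go : ∀ b → S x ≡ b → Module G
    go true  Sx = side S clS Sx x₂ Sx₂
    go false Sx = side (not ∘ S) (complement-closed G clS) (cong not Sx) x₁ (cong not Sx₁)

  three-colours⇒module : ∀ {n} (G : GallaiColouring (2 + n)) {c d e} → c ≢ d → c ≢ e → d ≢ e →
                         Edge G c → Edge G d → Edge G e → Module G
  three-colours⇒module {n} G c≢d c≢e d≢e ec ed ee with cut n G c≢d c≢e d≢e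
  ... | inj₁ C        = cut⇒module G ec C
  ... | inj₂ (inj₁ D) = cut⇒module G ed D
  ... | inj₂ (inj₂ E) = cut⇒module G ee E

-- Existence of a pair with few bad vertices

module BadVertices where

  open Counting
  open Gallai
  open import Data.Nat using (ℕ; zero; suc; _+_; _*_; _≤_; _<_; z≤n; s≤s; _<?_)
  open import Data.Nat.Properties as ℕ using (_≟_; ≤-refl; ≤-trans; ≤-reflexive; module ≤-Reasoning)
  open import Data.Nat.Induction using (<-wellFounded)
  open import Data.Nat.Tactic.RingSolver using (solve-∀)
  open import Induction.WellFounded using (Acc; acc)
  open import Data.Fin using (Fin; zero; suc) renaming (_≟_ to _≟ᶠ_)
  open import Data.Fin.Properties using (any?; suc-injective)
  open import Data.Bool using (Bool; true; false)
  import Data.Bool as Bool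
  open import Data.Product using (∃-syntax; _×_; _,_; proj₁; proj₂)
  open import Data.Sum using (_⊎_; inj₁; inj₂)
  open import Data.Empty using (⊥-elim)
  open import Function using (_∘_)
  open import Relation.Nullary using (¬_; Dec; yes; no)
  open import Relation.Nullary.Decidable using (¬?; _×-dec_)
  open import Relation.Unary using (Decidable)
  open import Relation.Binary.PropositionalEquality

  ⟦⟧-cong : {A B : Set} → (A → B) → (B → A) → (a? : Dec A) (b? : Dec B) → ⟦ a? ⟧ ≡ ⟦ b? ⟧
  ⟦⟧-cong f g a? b? = ℕ.≤-antisym (⟦⟧-mono f a? b?) (⟦⟧-mono g b? a?)

  count-≡ : ∀ {n} (u : Fin n) → count (_≟ᶠ u) ≡ 1
  count-≡ {suc n} zero    = cong suc (trans (sum-const n 0) (ℕ.*-zeroʳ n))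
  count-≡ {suc n} (suc u) = trans
    (sum-cong-≗ (λ i → ⟦⟧-cong suc-injective (cong suc) (suc i ≟ᶠ suc u) (i ≟ᶠ u)))
    (count-≡ u)

  count-≢ : ∀ {n} (u : Fin (suc n)) → count (¬? ∘ (_≟ᶠ u)) ≡ n
  count-≢ u = ℕ.+-cancelˡ-≡ 1 _ _ (trans (cong (_+ count (¬? ∘ (_≟ᶠ u))) (sym (count-≡ u))) (count-¬ (_≟ᶠ u)))

  4xy≤[x+y]² : ∀ x y → 4 * (x * y) ≤ (x + y) * (x + y)
  4xy≤[x+y]² x y with ℕ.≤-total x y
  ... | inj₁ x≤y with ℕ.m≤n⇒∃[o]m+o≡n x≤y
  ... | d , refl = ≤-trans (ℕ.m≤m+n _ (d * d)) (≤-reflexive (lemma x d))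
    where
    lemma : ∀ x d → 4 * (x * (x + d)) + d * d ≡ (x + (x + d)) * (x + (x + d))
    lemma = solve-∀
  4xy≤[x+y]² x y | inj₂ y≤x with ℕ.m≤n⇒∃[o]m+o≡n y≤x
  ... | d , refl = ≤-trans (ℕ.m≤m+n _ (d * d)) (≤-reflexive (lemma y d))
    where
    lemma : ∀ y d → 4 * ((y + d) * y) + d * d ≡ ((y + d) + y) * ((y + d) + y)
    lemma = solve-∀

  module _ {n} (G : GallaiColouring n) where
    open GallaiColouring G

    -- Here `b` is the vertex of the pair that comes first in the ordering and `c` is the colour
    -- listed for it. A bad vertex fits neither before `b`, where its two edges must agree, nor
    -- after `b`, where its edge to `b` must have colour `c`.
    Bad : Fin n → Fin n → ℕ → Fin n → Set
    Bad a b c u = u ≢ a × u ≢ b × col a u ≢ col b u × col b u ≢ c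

    bad? : ∀ a b c → Decidable (Bad a b c)
    bad? a b c u = ¬? (u ≟ᶠ a) ×-dec ¬? (u ≟ᶠ b) ×-dec ¬? (col a u ≟ col b u) ×-dec ¬? (col b u ≟ c)

    FewBad : ℕ → Set
    FewBad K = ∃[ a ] ∃[ b ] ∃[ c ] a ≢ b × count (bad? a b c) < K

  -- Double counting of the triples (a , b , u) with au of the first colour and bu of the second.
  module _ {m} (G : GallaiColouring (2 + m)) (c₁ c₂ : ℕ) where
    open GallaiColouring G
    private
      n = 2 + m

      first? : ∀ u a → Dec (a ≢ u × col a u ≡ c₁)
      first? u a = ¬? (a ≟ᶠ u) ×-dec (col a u ≟ c₁)

      second? : ∀ u b → Dec (b ≢ u × col b u ≢ c₁)
      second? u b = ¬? (b ≟ᶠ u) ×-dec ¬? (col b u ≟ c₁)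

      degree₁ degree₂ : Fin n → ℕ
      degree₁ u = count (first? u)
      degree₂ u = count (second? u)

      degrees : ∀ u → degree₁ u + degree₂ u ≡ suc m
      degrees u = begin
        degree₁ u + degree₂ u                          ≡⟨ ∑-distrib-+ (λ a → ⟦ first? u a ⟧) (λ a → ⟦ second? u a ⟧) ⟨
        ∑[ a < n ] (⟦ first? u a ⟧ + ⟦ second? u a ⟧)  ≡⟨ sum-cong-≗ split ⟩
        count (¬? ∘ (_≟ᶠ u))                           ≡⟨ count-≢ u ⟩
        suc m                                          ∎
        where
        open ≡-Reasoning
        split : ∀ a → ⟦ first? u a ⟧ + ⟦ second? u a ⟧ ≡ ⟦ ¬? (a ≟ᶠ u) ⟧
        split a with a ≟ᶠ u | col a u ≟ c₁
        ... | yes _ | yes _ = refl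
        ... | yes _ | no _  = refl
        ... | no _  | yes _ = refl
        ... | no _  | no _  = refl

      pairs : Fin n → Fin n → ℕ
      pairs a b = ∑[ u < n ] (⟦ first? u a ⟧ * ⟦ second? u b ⟧)

      sum-pairs : ∑[ a < n ] ∑[ b < n ] pairs a b ≡ ∑[ u < n ] (degree₁ u * degree₂ u)
      sum-pairs = begin
        ∑[ a < n ] ∑[ b < n ] ∑[ u < n ] (⟦ first? u a ⟧ * ⟦ second? u b ⟧)
          ≡⟨ sum-cong-≗ (λ a → ∑-comm (λ b u → ⟦ first? u a ⟧ * ⟦ second? u b ⟧)) ⟩
        ∑[ a < n ] ∑[ u < n ] ∑[ b < n ] (⟦ first? u a ⟧ * ⟦ second? u b ⟧)
          ≡⟨ ∑-comm (λ a u → ∑[ b < n ] (⟦ first? u a ⟧ * ⟦ second? u b ⟧)) ⟩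
        ∑[ u < n ] ∑[ a < n ] ∑[ b < n ] (⟦ first? u a ⟧ * ⟦ second? u b ⟧)
          ≡⟨ sum-cong-≗ (λ u → sum-cong-≗ λ a → *-distribˡ-sum ⟦ first? u a ⟧ (λ b → ⟦ second? u b ⟧)) ⟨
        ∑[ u < n ] ∑[ a < n ] (⟦ first? u a ⟧ * degree₂ u)
          ≡⟨ sum-cong-≗ (λ u → *-distribʳ-sum (degree₂ u) (λ a → ⟦ first? u a ⟧)) ⟨
        ∑[ u < n ] (degree₁ u * degree₂ u) ∎
        where open ≡-Reasoning

      4sum-pairs≤ : 4 * (∑[ a < n ] ∑[ b < n ] pairs a b) ≤ n * (suc m * suc m)
      4sum-pairs≤ = begin
        4 * (∑[ a < n ] ∑[ b < n ] pairs a b)         ≡⟨ cong (4 *_) sum-pairs ⟩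
        4 * (∑[ u < n ] (degree₁ u * degree₂ u))      ≡⟨ *-distribˡ-sum 4 (λ u → degree₁ u * degree₂ u) ⟩
        ∑[ u < n ] (4 * (degree₁ u * degree₂ u))      ≤⟨ sum-mono _ _ (λ u → ≤-trans (4xy≤[x+y]² (degree₁ u) (degree₂ u)) (≤-reflexive (cong₂ _*_ (degrees u) (degrees u)))) ⟩
        ∑[ u < n ] (suc m * suc m)                    ≡⟨ sum-const n (suc m * suc m) ⟩
        n * (suc m * suc m)                           ∎
        where open ≤-Reasoning

    -- Otherwise each of the n (n - 1) ordered pairs contributes at least `K` to a sum bounded by n
    -- (n - 1)² / 4, so 4 K ≤ n - 1, against `n≤4K`. The case `c₁` = `c₂` is allowed and covers
    -- colourings with a single colour.
    two-colours⇒few-bad : ∀ K → n ≤ 4 * K → (∀ x y → x ≢ y → col x y ≡ c₁ ⊎ col x y ≡ c₂) → FewBad G K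
    two-colours⇒few-bad K n≤4K two with any? (λ a → any? (λ b → ¬? (a ≟ᶠ b) ×-dec (count (bad? G a b c₁) <? K)))
    ... | yes (a , b , a≢b , few) = a , b , c₁ , a≢b , few
    ... | no ∄ = ⊥-elim (ℕ.<⇒≱ n≤4K (ℕ.*-cancelˡ-≤ (n * suc m) (begin
        n * suc m * (4 * K)                              ≡⟨ rearrange n (suc m) K ⟩
        4 * (n * (suc m * K))                            ≡⟨ cong (4 *_) (sum-const n (suc m * K)) ⟨
        4 * (∑[ a < n ] (suc m * K))                     ≤⟨ ℕ.*-monoʳ-≤ 4 (sum-mono _ _ row) ⟩
        4 * (∑[ a < n ] ∑[ b < n ] pairs a b)            ≤⟨ 4sum-pairs≤ ⟩
        n * (suc m * suc m)                              ≡⟨ ℕ.*-assoc n (suc m) (suc m) ⟨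
        n * suc m * suc m                                ∎)))
      where
      open ≤-Reasoning
      rearrange : ∀ n m K → n * m * (4 * K) ≡ 4 * (n * (m * K))
      rearrange = solve-∀
      bad≤ : ∀ a b → count (bad? G a b c₁) ≤ pairs a b
      bad≤ a b = sum-mono _ _ λ u → pointwise u
        where
        pointwise : ∀ u → ⟦ bad? G a b c₁ u ⟧ ≤ ⟦ first? u a ⟧ * ⟦ second? u b ⟧
        pointwise u with bad? G a b c₁ u | first? u a | second? u b
        ... | no _ | _ | _ = z≤n
        ... | yes _ | yes _ | yes _ = ≤-refl
        ... | yes (u≢a , u≢b , a≢b , b≢c) | _ | no ¬s = ⊥-elim (¬s (u≢b ∘ sym , b≢c))
        -- With only two colours available, `bu` differs from `c₁` and `au` differs from `bu`, which
        -- leaves `c₁` for `au`.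
        ... | yes (u≢a , u≢b , a≢b , b≢c) | no ¬f | _ with two a u (u≢a ∘ sym) | two b u (u≢b ∘ sym)
        ... | inj₁ p | _      = ⊥-elim (¬f (u≢a ∘ sym , p))
        ... | inj₂ p | inj₁ q = ⊥-elim (b≢c q)
        ... | inj₂ p | inj₂ q = ⊥-elim (a≢b (trans p (sym q)))
      entry : ∀ a b → ⟦ ¬? (b ≟ᶠ a) ⟧ * K ≤ pairs a b
      entry a b with b ≟ᶠ a
      ... | yes _ = z≤n
      ... | no b≢a = begin
        K + 0                     ≡⟨ ℕ.+-identityʳ K ⟩
        K                         ≤⟨ ℕ.≮⇒≥ (λ few → ∄ (a , b , b≢a ∘ sym , few)) ⟩
        count (bad? G a b c₁)     ≤⟨ bad≤ a b ⟩
        pairs a b                 ∎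
      row : ∀ a → suc m * K ≤ ∑[ b < n ] pairs a b
      row a = begin
        suc m * K                             ≡⟨ cong (_* K) (count-≢ a) ⟨
        count (¬? ∘ (_≟ᶠ a)) * K              ≡⟨ *-distribʳ-sum K (λ b → ⟦ ¬? (b ≟ᶠ a) ⟧) ⟩
        ∑[ b < n ] (⟦ ¬? (b ≟ᶠ a) ⟧ * K)      ≤⟨ sum-mono _ _ (entry a) ⟩
        ∑[ b < n ] pairs a b                  ∎

  module _ (K : ℕ) where

    module-step : ∀ {n} (G : GallaiColouring n) → Module G →
                  (∀ {s} (H : GallaiColouring s) → s < n → 2 ≤ s → FewBad H K) → FewBad G K
    module-step {n} G Mod ih = lift (ih H s<n 2≤s)
      where
      open GallaiColouring G
      open Module Mod
      in? : Decidable (λ u → M u ≡ true)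
      in? u = M u Bool.≟ true
      open Enumeration (enumerate in?)
      H = restrict at G
      s<n : count in? < n
      s<n = subst (count in? <_) (trans (sum-const n 1) (ℕ.*-identityʳ n))
        (count-mono-< in? (λ u → yes refl) (λ _ _ → refl {x = true}) y refl (λ My → true≢false G My ¬My))
      2≤s : 2 ≤ count in?
      2≤s = injection⇒≤count in? u u-inj Pu
        where
        u : Fin 2 → Fin n
        u zero    = x
        u (suc _) = z
        u-inj : ∀ {i j} → u i ≡ u j → i ≡ j
        u-inj {zero}     {zero}     _ = refl
        u-inj {zero}     {suc zero} e = ⊥-elim (x≢z e)
        u-inj {suc zero} {zero}     e = ⊥-elim (x≢z (sym e))
        u-inj {suc zero} {suc zero} _ = refl
        Pu : ∀ i → M (u i) ≡ true
        Pu zero    = Mx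
        Pu (suc _) = Mz
      lift : FewBad H K → FewBad G K
      lift (a , b , c , a≢b , few) = at a , at b , c , a≢b ∘ injective , ℕ.≤-<-trans fewer few
        where
        open Enumeration (enumerate (bad? G (at a) (at b) c))
          renaming (at to bad; injective to bad-injective; sound to bad-sound) hiding (complete)
        inside : ∀ i → M (bad i) ≡ true
        inside i with M (bad i) in eq
        ... | true  = refl
        ... | false with bad-sound i
        ... | _ , _ , a≁b , _ = ⊥-elim (a≁b (homogeneous (at a) (at b) (bad i) (sound a) (sound b) eq))
        index : ∀ i → ∃[ k ] at k ≡ bad i
        index i = complete (bad i) (inside i)
        fewer : count (bad? G (at a) (at b) c) ≤ count (bad? H a b c)
        fewer = injection⇒≤count (bad? H a b c) (proj₁ ∘ index)
          (λ {i} {j} e → bad-injective (trans (sym (proj₂ (index i))) (trans (cong at e) (proj₂ (index j)))))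
          λ i → pulled i (index i)
          where
          pulled : ∀ i (k : ∃[ k ] at k ≡ bad i) → Bad H a b c (proj₁ k)
          pulled i (k , eq) with subst (Bad G (at a) (at b) c) (sym eq) (bad-sound i)
          ... | ≢a , ≢b , rest = ≢a ∘ cong at , ≢b ∘ cong at , rest

    -- The hypothesis `n ≤ 4 * K` passes to every smaller set and `module-step` returns the same
    -- `K`, so the descent loses nothing and may stop at a set of any size from two on.
    few-bad : ∀ {n} (G : GallaiColouring n) → 2 ≤ n → n ≤ 4 * K → FewBad G K
    few-bad {n} G 2≤n n≤4K = go G 2≤n n≤4K (<-wellFounded n)
      where
      go : ∀ {n} (G : GallaiColouring n) → 2 ≤ n → n ≤ 4 * K → Acc _<_ n → FewBad G K
      go {suc (suc m)} G 2≤n n≤4K (acc rs) = by-colours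
        where
        open GallaiColouring G
        c₁ = col zero (suc zero)
        recurse : Module G → FewBad G K
        recurse Mod = module-step G Mod λ H s<n 2≤s → go H 2≤s (≤-trans (ℕ.<⇒≤ s<n) n≤4K) (rs s<n)
        by-colours : FewBad G K
        by-colours with any? (λ x → any? (λ y → ¬? (x ≟ᶠ y) ×-dec ¬? (col x y ≟ c₁)))
        ... | no ∄ = two-colours⇒few-bad G c₁ c₁ K n≤4K two
          where
          two : ∀ x y → x ≢ y → col x y ≡ c₁ ⊎ col x y ≡ c₁
          two x y x≢y with col x y ≟ c₁
          ... | yes e = inj₁ e
          ... | no ¬e = ⊥-elim (∄ (x , y , x≢y , ¬e))
        ... | yes (p , q , p≢q , c₂≢c₁)
          with any? (λ x → any? (λ y → ¬? (x ≟ᶠ y) ×-dec ¬? (col x y ≟ c₁) ×-dec ¬? (col x y ≟ col p q)))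
        ... | yes (r , s , r≢s , c₃≢c₁ , c₃≢c₂) =
          recurse (three-colours⇒module G (c₂≢c₁ ∘ sym) (c₃≢c₁ ∘ sym) (c₃≢c₂ ∘ sym)
            (zero , suc zero , (λ ()) , refl) (p , q , p≢q , refl) (r , s , r≢s , refl))
        ... | no ∄ = two-colours⇒few-bad G c₁ (col p q) K n≤4K two
          where
          two : ∀ x y → x ≢ y → col x y ≡ c₁ ⊎ col x y ≡ col p q
          two x y x≢y with col x y ≟ c₁ | col x y ≟ col p q
          ... | yes e | _     = inj₁ e
          ... | no _  | yes e = inj₂ e
          ... | no ¬e | no ¬f = ⊥-elim (∄ (x , y , x≢y , ¬e , ¬f))
      go {suc zero} G (s≤s ()) _ _

-- Upper bound: from few bad vertices to an orderable copy

module Upper where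

  open import Defs
  open Counting
  open Gallai using (GallaiColouring)
  open BadVertices
  open import Data.Nat using (ℕ; zero; suc; _+_; _*_; _≤_; _<_; z≤n; s≤s; _<?_)
  open import Data.Nat.Properties as ℕ using (≤-refl; ≤-trans; module ≤-Reasoning)
  open import Data.Nat.Tactic.RingSolver using (solve-∀)
  open import Data.Fin using (Fin; zero; suc; toℕ; fromℕ<; inject≤) renaming (_<_ to _<ᶠ_; _≟_ to _≟ᶠ_)
  open import Data.Fin.Properties using (any?; all?; toℕ-injective; toℕ<n; fromℕ<-toℕ; inject≤-injective; +↔⊎)
  open import Data.Fin.Permutation using (Permutation′; id; transpose; lift₀; _∘ₚ_; _⟨$⟩ʳ_)
  open import Data.Product using (Σ-syntax; ∃-syntax; _×_; _,_; proj₁; proj₂)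
  open import Data.Sum using (_⊎_; inj₁; inj₂)
  open import Data.Empty using (⊥; ⊥-elim)
  open import Function using (_∘_)
  open import Function.Bundles using (Inverse)
  open import Function.Construct.Composition using (_↔-∘_)
  open import Function.Definitions using (Injective)
  open import Relation.Nullary using (¬_; Dec; yes; no)
  open import Relation.Nullary.Decidable using (¬?; _×-dec_; _⊎-dec_; _→-dec_; toWitness)
  open import Relation.Binary.PropositionalEquality

  argmin : ∀ {n} (key : Fin (suc n) → ℕ) → ∃[ m ] ∀ i → key m ≤ key i
  argmin {zero}  key = zero , λ { zero → ≤-refl }
  argmin {suc n} key with argmin (key ∘ suc)
  ... | m , min with ℕ.≤-total (key zero) (key (suc m))
  ... | inj₁ 0≤m = zero  , λ { zero → ≤-refl ; (suc i) → ≤-trans 0≤m (min i) }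
  ... | inj₂ m≤0 = suc m , λ { zero → m≤0 ; (suc i) → min i }

  -- Selection sort: the minimum is swapped to the front and the other places are sorted. With it an
  -- ordering of a copy can be specified by giving each vertex a rank.
  sort : ∀ {n} (key : Fin n → ℕ) →
         Σ[ π ∈ Permutation′ n ] (∀ i j → i <ᶠ j → key (π ⟨$⟩ʳ i) ≤ key (π ⟨$⟩ʳ j))
  sort {zero}  key = id , λ ()
  sort {suc n} key with argmin key
  ... | m , min with sort (λ i → key (transpose zero m ⟨$⟩ʳ suc i))
  ... | ρ , sorted = lift₀ ρ ∘ₚ transpose zero m , sorted′
    where
    sorted′ : ∀ i j → i <ᶠ j →
              key (lift₀ ρ ∘ₚ transpose zero m ⟨$⟩ʳ i) ≤ key (lift₀ ρ ∘ₚ transpose zero m ⟨$⟩ʳ j)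
    sorted′ zero    (suc j) _         = min _
    sorted′ (suc i) (suc j) (s≤s i<j) = sorted i j i<j

  module _ {n r} (χ : EdgeColouring (complete n) (Fin r)) where
    open EdgeColouring χ

    -- Makes the colour a total function of two vertices, as `GallaiColouring` requires; 0 stands
    -- for the absence of an edge.
    code : Fin n → Fin n → ℕ
    code x y with x ≟ᶠ y
    ... | yes _  = 0
    ... | no x≢y = suc (toℕ (colour x y x≢y))

    code-≢ : ∀ x y (x≢y : x ≢ y) → code x y ≡ suc (toℕ (colour x y x≢y))
    code-≢ x y x≢y with x ≟ᶠ y
    ... | yes x≡y = ⊥-elim (x≢y x≡y)
    ... | no _    = refl

    code-sym : ∀ x y → code x y ≡ code y x
    code-sym x y with x ≟ᶠ y | y ≟ᶠ x
    ... | yes _   | yes _   = refl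
    ... | yes x≡y | no y≢x  = ⊥-elim (y≢x (sym x≡y))
    ... | no x≢y  | yes y≡x = ⊥-elim (x≢y (sym y≡x))
    ... | no x≢y  | no _    = cong (suc ∘ toℕ) (colour-sym x y x≢y)

    code-injective : ∀ x y z w (x≢y : x ≢ y) (z≢w : z ≢ w) →
                     code x y ≡ code z w → colour x y x≢y ≡ colour z w z≢w
    code-injective x y z w x≢y z≢w eq =
      toℕ-injective (ℕ.suc-injective (trans (sym (code-≢ x y x≢y)) (trans eq (code-≢ z w z≢w))))

    RainbowTriple : Fin n → Fin n → Fin n → Set
    RainbowTriple x y z = (x ≢ y × x ≢ z × y ≢ z) ×
                          (code x y ≢ code x z × code x y ≢ code y z × code x z ≢ code y z)

    no-rainbow⇒gallai : ¬ (∃[ x ] ∃[ y ] ∃[ z ] RainbowTriple x y z) → GallaiColouring n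
    no-rainbow⇒gallai ∄ = record { col = code ; symm = code-sym ; gallai = gallai }
      where
      gallai : ∀ x y z → code x y ≢ code x z → code x y ≢ code y z → code x z ≡ code y z
      gallai x y z p q with code x z ℕ.≟ code y z
      ... | yes e = e
      -- Equality of two of the vertices would make two of the three codes equal, so three distinct
      -- codes come from a genuine triangle.
      ... | no ¬e = ⊥-elim (∄ (x , y , z ,
        ( (λ x≡y → ¬e (cong (λ w → code w z) x≡y))
        , (λ x≡z → q (trans (code-sym x y) (cong (code y) x≡z)))
        , (λ y≡z → p (cong (code x) y≡z)))
        , (p , q , ¬e)))

    rainbow? : Dec (∃[ x ] ∃[ y ] ∃[ z ] RainbowTriple x y z)
    rainbow? = any? λ x → any? λ y → any? λ z →
      (¬? (x ≟ᶠ y) ×-dec ¬? (x ≟ᶠ z) ×-dec ¬? (y ≟ᶠ z)) ×-dec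
      (¬? (code x y ℕ.≟ code x z) ×-dec ¬? (code x y ℕ.≟ code y z) ×-dec ¬? (code x z ℕ.≟ code y z))

    rainbow-triple⇒copy : ∃[ x ] ∃[ y ] ∃[ z ] RainbowTriple x y z → HasRainbowCopy (complete 3) χ
    rainbow-triple⇒copy (x , y , z , (x≢y , x≢z , y≢z) , (xy≢xz , xy≢yz , xz≢yz)) =
      record { embed = f ; injective = f-injective _ _ ; adj = λ i≢j fi≡fj → i≢j (f-injective _ _ fi≡fj) } ,
      λ {i} {j} {k} {l} i≢j k≢l diff same → diff (opposite-same i j k l i≢j k≢l
        (edge-injective _ _ (trans (sym (edge-opposite i j i≢j))
          (trans (trans (code-≢ (f i) (f j) (λ e → i≢j (f-injective _ _ e))) (trans (cong (suc ∘ toℕ) same) (sym (code-≢ (f k) (f l) (λ e → k≢l (f-injective _ _ e))))))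
                 (edge-opposite k l k≢l)))))
      where
      f : Fin 3 → Fin n
      f zero             = x
      f (suc zero)       = y
      f (suc (suc zero)) = z
      f-injective : ∀ i j → f i ≡ f j → i ≡ j
      f-injective zero             zero             _ = refl
      f-injective zero             (suc zero)       e = ⊥-elim (x≢y e)
      f-injective zero             (suc (suc zero)) e = ⊥-elim (x≢z e)
      f-injective (suc zero)       zero             e = ⊥-elim (x≢y (sym e))
      f-injective (suc zero)       (suc zero)       _ = refl
      f-injective (suc zero)       (suc (suc zero)) e = ⊥-elim (y≢z e)
      f-injective (suc (suc zero)) zero             e = ⊥-elim (x≢z (sym e))
      f-injective (suc (suc zero)) (suc zero)       e = ⊥-elim (y≢z (sym e))
      f-injective (suc (suc zero)) (suc (suc zero)) _ = refl
      -- An edge of the triangle is named by the vertex it misses.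
      opposite : Fin 3 → Fin 3 → Fin 3
      opposite zero             (suc zero)       = suc (suc zero)
      opposite zero             (suc (suc zero)) = suc zero
      opposite (suc zero)       zero             = suc (suc zero)
      opposite (suc zero)       (suc (suc zero)) = zero
      opposite (suc (suc zero)) zero             = suc zero
      opposite (suc (suc zero)) (suc zero)       = zero
      opposite i                _                = i
      opposite-same : ∀ i j k l → i ≢ j → k ≢ l → opposite i j ≡ opposite k l → (i ≡ k × j ≡ l) ⊎ (i ≡ l × j ≡ k)
      opposite-same = toWitness {a? = all? λ i → all? λ j → all? λ k → all? λ l →
        ¬? (i ≟ᶠ j) →-dec (¬? (k ≟ᶠ l) →-dec ((opposite i j ≟ᶠ opposite k l) →-dec
          (((i ≟ᶠ k) ×-dec (j ≟ᶠ l)) ⊎-dec ((i ≟ᶠ l) ×-dec (j ≟ᶠ k)))))} _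
      edge : Fin 3 → ℕ
      edge zero             = code y z
      edge (suc zero)       = code x z
      edge (suc (suc zero)) = code x y
      edge-opposite : ∀ i j → i ≢ j → code (f i) (f j) ≡ edge (opposite i j)
      edge-opposite zero             zero             ≢ = ⊥-elim (≢ refl)
      edge-opposite zero             (suc zero)       _ = refl
      edge-opposite zero             (suc (suc zero)) _ = refl
      edge-opposite (suc zero)       zero             _ = code-sym y x
      edge-opposite (suc zero)       (suc zero)       ≢ = ⊥-elim (≢ refl)
      edge-opposite (suc zero)       (suc (suc zero)) _ = refl
      edge-opposite (suc (suc zero)) zero             _ = code-sym z x
      edge-opposite (suc (suc zero)) (suc zero)       _ = code-sym z y
      edge-opposite (suc (suc zero)) (suc (suc zero)) ≢ = ⊥-elim (≢ refl)
      edge-injective : ∀ i j → edge i ≡ edge j → i ≡ j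
      edge-injective zero             zero             _ = refl
      edge-injective zero             (suc zero)       e = ⊥-elim (xz≢yz (sym e))
      edge-injective zero             (suc (suc zero)) e = ⊥-elim (xy≢yz (sym e))
      edge-injective (suc zero)       zero             e = ⊥-elim (xz≢yz e)
      edge-injective (suc zero)       (suc zero)       _ = refl
      edge-injective (suc zero)       (suc (suc zero)) e = ⊥-elim (xy≢xz (sym e))
      edge-injective (suc (suc zero)) zero             e = ⊥-elim (xy≢yz e)
      edge-injective (suc (suc zero)) (suc zero)       e = ⊥-elim (xy≢xz e)
      edge-injective (suc (suc zero)) (suc (suc zero)) _ = refl

    -- The ordering puts first the vertices seen alike from a and b, then b, then
    -- the vertices joined to b in colour c, and a last.
    module _ {t} (a b : Fin n) (a≢b : a ≢ b) (c : ℕ)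
             (u : Fin t → Fin n) (u-injective : Injective _≡_ _≡_ u)
             (u≢a : ∀ i → u i ≢ a) (u≢b : ∀ i → u i ≢ b)
             (good : ∀ i → code a (u i) ≡ code b (u i) ⊎ code b (u i) ≡ c) where
      private
        V = Fin 2 ⊎ Fin t

        embed : V → Fin n
        embed (inj₁ zero)    = a
        embed (inj₁ (suc _)) = b
        embed (inj₂ i)       = u i

        copy : Copy (completeBipartite 2 t) (complete n)
        copy = record { embed = embed ; injective = inj _ _ ; adj = λ {x} {y} → adj x y }
          where
          inj : ∀ x y → embed x ≡ embed y → x ≡ y
          inj (inj₁ zero)       (inj₁ zero)       _ = refl
          inj (inj₁ zero)       (inj₁ (suc zero)) e = ⊥-elim (a≢b e)
          inj (inj₁ (suc zero)) (inj₁ zero)       e = ⊥-elim (a≢b (sym e))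
          inj (inj₁ (suc zero)) (inj₁ (suc zero)) _ = refl
          inj (inj₁ zero)       (inj₂ j)          e = ⊥-elim (u≢a j (sym e))
          inj (inj₁ (suc zero)) (inj₂ j)          e = ⊥-elim (u≢b j (sym e))
          inj (inj₂ i)          (inj₁ zero)       e = ⊥-elim (u≢a i e)
          inj (inj₂ i)          (inj₁ (suc zero)) e = ⊥-elim (u≢b i e)
          inj (inj₂ i)          (inj₂ j)          e = cong inj₂ (u-injective e)
          adj : ∀ x y → OppositeSides x y → embed x ≢ embed y
          adj (inj₁ zero)       (inj₂ j)          _ e = u≢a j (sym e)
          adj (inj₁ (suc zero)) (inj₂ j)          _ e = u≢b j (sym e)
          adj (inj₂ i)          (inj₁ zero)       _ e = u≢a i e
          adj (inj₂ i)          (inj₁ (suc zero)) _ e = u≢b i e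

        -- The number `c` need not be the code of any edge. In that case no leaf is placed after
        -- `b`, and the default colour is never compared with anything.
        decode : ℕ → Fin r
        decode zero    = colour a b a≢b
        decode (suc k) with k <? r
        ... | yes k<r = fromℕ< k<r
        ... | no _    = colour a b a≢b

        decode-code : ∀ x y (x≢y : x ≢ y) → code x y ≡ c → colour x y x≢y ≡ decode c
        decode-code x y x≢y eq with trans (sym eq) (code-≢ x y x≢y)
        ... | refl with toℕ (colour x y x≢y) <? r
        ... | yes k<r = sym (fromℕ<-toℕ _ k<r)
        ... | no k≮r  = ⊥-elim (k≮r (toℕ<n _))

        rank : ∀ {A : Set} → Dec A → ℕ
        rank (yes _) = 0
        rank (no _)  = 2

        alike? : ∀ i → Dec (code a (u i) ≡ code b (u i))
        alike? i = code a (u i) ℕ.≟ code b (u i)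

        key : V → ℕ
        key (inj₁ zero)    = 3
        key (inj₁ (suc _)) = 1
        key (inj₂ i)       = rank (alike? i)

        -- `a` is preceded by all its neighbours, so its label is arbitrary. The edge of a leaf to
        -- `a` determines its label; its edge to `b` matters only for a leaf placed before `b`, and
        -- then has the same colour.
        label : V → Fin r
        label (inj₁ zero)    = colour a b a≢b
        label (inj₁ (suc _)) = decode c
        label (inj₂ i)       = colour (u i) a (u≢a i)

        -- A weak inequality of keys is enough, because ties occur only between leaves, which are
        -- not adjacent.
        labelled : ∀ x y → key x ≤ key y → (e : OppositeSides x y) →
                   EdgeColouring.colour (inherited χ copy) x y e ≡ label x
        labelled (inj₁ zero) (inj₂ j) le _ with alike? j
        labelled (inj₁ zero) (inj₂ j) (s≤s (s≤s ())) _ | no _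
        labelled (inj₁ (suc zero)) (inj₂ j) le _ with alike? j | good j
        ... | no ¬e | inj₁ e = ⊥-elim (¬e e)
        ... | no _  | inj₂ e = decode-code b (u j) (u≢b j ∘ sym) e
        labelled (inj₂ i) (inj₁ zero) _ _ = refl
        labelled (inj₂ i) (inj₁ (suc zero)) le _ with alike? i
        labelled (inj₂ i) (inj₁ (suc zero)) le _ | yes e =
          code-injective (u i) b (u i) a (u≢b i) (u≢a i)
            (trans (code-sym (u i) b) (trans (sym e) (code-sym a (u i))))
        labelled (inj₂ i) (inj₁ (suc zero)) (s≤s ()) _ | no _

      good⇒orderable : HasOrderableCopy (completeBipartite 2 t) χ
      good⇒orderable = copy , order , (λ i → label (Inverse.to order (inject≤ i _))) ,
        λ i j i<j e → labelled (Inverse.to order (inject≤ i _)) (Inverse.to order j) (sorted (inject≤ i _) j i<j) e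
        where
        sorting = sort (key ∘ Inverse.to (+↔⊎ {2} {t}))
        order = +↔⊎ {2} {t} ↔-∘ proj₁ sorting
        sorted = proj₂ sorting

    -- Removing `a`, `b` and at most K - 1 bad vertices leaves n - 1 - K candidates for leaves,
    -- which is at least `t` by the last inequality assumed.
    gallai⇒orderable : (G : GallaiColouring n) → GallaiColouring.col G ≡ code →
                       ∀ K t → 2 ≤ n → n ≤ 4 * K → t + 1 + K ≤ n →
                       HasOrderableCopy (completeBipartite 2 t) χ
    gallai⇒orderable G refl K t 2≤n n≤4K t+1+K≤n with few-bad K G 2≤n n≤4K
    ... | a , b , c , a≢b , few =
      good⇒orderable a b a≢b c (λ i → at (inject≤ i t≤good)) (λ {i} {j} e → inject≤-injective _ _ i j (injective e))
        (λ i → proj₁ (sound (inject≤ i t≤good))) (λ i → proj₁ (proj₂ (sound (inject≤ i t≤good))))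
        (λ i → not-bad _ (sound (inject≤ i t≤good)))
      where
      Good : Fin n → Set
      Good u = u ≢ a × u ≢ b × ¬ Bad G a b c u
      good? : ∀ u → Dec (Good u)
      good? u = ¬? (u ≟ᶠ a) ×-dec ¬? (u ≟ᶠ b) ×-dec ¬? (bad? G a b c u)
      open Enumeration (enumerate good?) using (at; injective; sound)
      not-bad : ∀ u → Good u → code a u ≡ code b u ⊎ code b u ≡ c
      not-bad u (≢a , ≢b , ¬bad) with code a u ℕ.≟ code b u | code b u ℕ.≟ c
      ... | yes e | _     = inj₁ e
      ... | no _  | yes e = inj₂ e
      ... | no ¬e | no ¬f = ⊥-elim (¬bad (≢a , ≢b , ¬e , ¬f))
      n≤ : n ≤ 1 + (1 + (count (bad? G a b c) + count good?))
      n≤ = begin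
        n ≡⟨ trans (sum-const n 1) (ℕ.*-identityʳ n) ⟨
        ∑[ u < n ] 1
          ≤⟨ sum-mono _ _ covered ⟩
        ∑[ u < n ] (⟦ u ≟ᶠ a ⟧ + (⟦ u ≟ᶠ b ⟧ + (⟦ bad? G a b c u ⟧ + ⟦ good? u ⟧)))
          ≡⟨ ∑-distrib-+ (λ u → ⟦ u ≟ᶠ a ⟧) (λ u → ⟦ u ≟ᶠ b ⟧ + (⟦ bad? G a b c u ⟧ + ⟦ good? u ⟧)) ⟩
        count (_≟ᶠ a) + ∑[ u < n ] (⟦ u ≟ᶠ b ⟧ + (⟦ bad? G a b c u ⟧ + ⟦ good? u ⟧))
          ≡⟨ cong₂ _+_ (count-≡ a) (∑-distrib-+ (λ u → ⟦ u ≟ᶠ b ⟧) (λ u → ⟦ bad? G a b c u ⟧ + ⟦ good? u ⟧)) ⟩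
        1 + (count (_≟ᶠ b) + ∑[ u < n ] (⟦ bad? G a b c u ⟧ + ⟦ good? u ⟧))
          ≡⟨ cong (1 +_) (cong₂ _+_ (count-≡ b) (∑-distrib-+ (λ u → ⟦ bad? G a b c u ⟧) (λ u → ⟦ good? u ⟧))) ⟩
        1 + (1 + (count (bad? G a b c) + count good?)) ∎
        where
        open ≤-Reasoning
        covered : ∀ u → 1 ≤ ⟦ u ≟ᶠ a ⟧ + (⟦ u ≟ᶠ b ⟧ + (⟦ bad? G a b c u ⟧ + ⟦ good? u ⟧))
        covered u with u ≟ᶠ a | u ≟ᶠ b | bad? G a b c u | good? u
        ... | yes _ | _ | _ | _ = s≤s z≤n
        ... | no _ | yes _ | _ | _ = s≤s z≤n
        ... | no _ | no _ | yes _ | _ = s≤s z≤n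
        ... | no _ | no _ | no _ | yes _ = s≤s z≤n
        ... | no ≢a | no ≢b | no ¬bad | no ¬good = ⊥-elim (¬good (≢a , ≢b , ¬bad))
      t≤good : t ≤ count good?
      t≤good = ℕ.+-cancelˡ-≤ (2 + count (bad? G a b c)) t (count good?) (begin
        2 + count (bad? G a b c) + t        ≡⟨ rearrange (count (bad? G a b c)) t ⟩
        t + 1 + suc (count (bad? G a b c))  ≤⟨ ℕ.+-monoʳ-≤ (t + 1) few ⟩
        t + 1 + K                           ≤⟨ t+1+K≤n ⟩
        n                                   ≤⟨ n≤ ⟩
        2 + (count (bad? G a b c) + count good?) ≡⟨ ℕ.+-assoc 2 (count (bad? G a b c)) (count good?) ⟨
        2 + count (bad? G a b c) + count good?   ∎)
        where
        open ≤-Reasoning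
        rearrange : ∀ x t → 2 + x + t ≡ t + 1 + suc x
        rearrange = solve-∀

    orderable-or-rainbow : ∀ K t → 2 ≤ n → n ≤ 4 * K → t + 1 + K ≤ n →
                           HasOrderableCopy (completeBipartite 2 t) χ ⊎ HasRainbowCopy (complete 3) χ
    orderable-or-rainbow K t 2≤n n≤4K t+1+K≤n with rainbow?
    ... | yes triple = inj₂ (rainbow-triple⇒copy triple)
    ... | no ∄       = inj₁ (gallai⇒orderable (no-rainbow⇒gallai ∄) refl K t 2≤n n≤4K t+1+K≤n)

  ¬rainbow-K₃ : ∀ {n} (χ : EdgeColouring (complete n) (Fin 2)) → ¬ HasRainbowCopy (complete 3) χ
  ¬rainbow-K₃ χ (f , rainbow) = pigeonhole _ _ _
    (rainbow {zero} {suc zero} {zero} {suc (suc zero)} (λ ()) (λ ()) (λ { (inj₁ (_ , ())) ; (inj₂ (() , _)) }))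
    (rainbow {zero} {suc zero} {suc zero} {suc (suc zero)} (λ ()) (λ ()) (λ { (inj₁ (() , _)) ; (inj₂ (() , _)) }))
    (rainbow {zero} {suc (suc zero)} {suc zero} {suc (suc zero)} (λ ()) (λ ()) (λ { (inj₁ (() , _)) ; (inj₂ (() , _)) }))
    where
    pigeonhole : (x y z : Fin 2) → x ≢ y → x ≢ z → y ≢ z → ⊥
    pigeonhole zero       zero       _          p _ _ = p refl
    pigeonhole zero       (suc zero) zero       _ q _ = q refl
    pigeonhole zero       (suc zero) (suc zero) _ _ r = r refl
    pigeonhole (suc zero) zero       zero       _ _ r = r refl
    pigeonhole (suc zero) zero       (suc zero) _ q _ = q refl
    pigeonhole (suc zero) (suc zero) _          p _ _ = p refl

-- Inner products and Kronecker products of integer rows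

module Sums where

  import Data.Nat as ℕ
  open import Data.Nat using (ℕ; zero; suc)
  import Data.Nat.Properties as ℕ
  open import Data.Integer hiding (suc; pred; _⊔_; _≟_; _⊖_)
  open import Data.Integer.Properties hiding (suc-+; _≟_)
  open import Data.Integer.Tactic.RingSolver using (solve-∀)
  open import Data.Fin as Fin using (Fin; zero; suc; combine; remQuot; _↑ˡ_; _↑ʳ_)
  open import Data.Fin.Properties using (remQuot-combine; combine-remQuot)
  open import Data.Product using (_,_; proj₁; proj₂)
  open import Data.Sum using (_⊎_; inj₁; inj₂)
  open import Data.Empty using (⊥-elim)
  open import Function using (_∘_)
  open import Relation.Nullary using (yes; no)
  open import Relation.Binary.PropositionalEquality
  open import Algebra.Properties.Semiring.Sum +-*-semiring public

  zeroˡ-* : ∀ {x} y → x ≡ 0ℤ → x * y ≡ 0ℤ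
  zeroˡ-* y refl = *-zeroˡ y

  zeroʳ-* : ∀ x {y} → y ≡ 0ℤ → x * y ≡ 0ℤ
  zeroʳ-* x refl = *-zeroʳ x

  Row : ℕ → Set
  Row n = Fin n → ℤ

  infix  8 _∙_
  infixl 6 _⊕_
  infixl 7 _⊗_
  infixr 7 _⊙_

  _∙_ : ∀ {n} → Row n → Row n → ℤ
  f ∙ g = sum (λ i → f i * g i)

  _⊕_ : ∀ {n} → Row n → Row n → Row n
  (f ⊕ g) i = f i + g i

  _⊙_ : ∀ {n} → ℤ → Row n → Row n
  (c ⊙ f) i = c * f i

  one : ∀ {n} → Row n
  one _ = 1ℤ

  -- Rows of the identity matrix. Recursion instead of a decision lets entries such as
  -- `δ (suc x) zero` compute.
  δ : ∀ {n} → Fin n → Row n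
  δ zero    zero    = 1ℤ
  δ zero    (suc j) = 0ℤ
  δ (suc i) zero    = 0ℤ
  δ (suc i) (suc j) = δ i j

  δ-refl : ∀ {n} (i : Fin n) → δ i i ≡ 1ℤ
  δ-refl zero    = refl
  δ-refl (suc i) = δ-refl i

  δ-≢ : ∀ {n} {i j : Fin n} → i ≢ j → δ i j ≡ 0ℤ
  δ-≢ {i = zero}  {zero}  i≢j = ⊥-elim (i≢j refl)
  δ-≢ {i = zero}  {suc j} i≢j = refl
  δ-≢ {i = suc i} {zero}  i≢j = refl
  δ-≢ {i = suc i} {suc j} i≢j = δ-≢ (i≢j ∘ cong suc)

  δ-sym : ∀ {n} (i j : Fin n) → δ i j ≡ δ j i
  δ-sym zero    zero    = refl
  δ-sym zero    (suc j) = refl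
  δ-sym (suc i) zero    = refl
  δ-sym (suc i) (suc j) = δ-sym i j

  δ-subst : ∀ {n} (i j : Fin n) (f : Fin n → ℤ) → δ i j * f i ≡ δ i j * f j
  δ-subst i j f with i Fin.≟ j
  ... | yes refl = refl
  ... | no i≢j   = trans (cong (_* f i) (δ-≢ i≢j)) (cong (_* f j) (sym (δ-≢ i≢j)))

  sum-zero : ∀ n → ∑[ i < n ] 0ℤ ≡ 0ℤ
  sum-zero n = sum-replicate-zero n

  sum-const : ∀ n c → ∑[ i < n ] c ≡ + n * c
  sum-const zero    c = sym (*-zeroˡ c)
  sum-const (suc n) c = begin
    c + ∑[ i < n ] c        ≡⟨ cong (λ s → c + s) (sum-const n c) ⟩
    c + + n * c             ≡⟨ lemma c (+ n) ⟩
    + suc n * c             ∎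
    where
    open ≡-Reasoning
    lemma : ∀ c n → c + n * c ≡ (1ℤ + n) * c
    lemma = solve-∀

  sum-+ : ∀ {n} (f g : Row n) → sum (f ⊕ g) ≡ sum f + sum g
  sum-+ = ∑-distrib-+

  sum-⊙ : ∀ {n} c (f : Row n) → sum (c ⊙ f) ≡ c * sum f
  sum-⊙ c f = sym (*-distribˡ-sum c f)

  δ-∙ : ∀ {n} i (f : Row n) → δ i ∙ f ≡ f i
  δ-∙ {suc n} zero f = begin
    1ℤ * f zero + ∑[ j < n ] (0ℤ * f (suc j)) ≡⟨ cong₂ _+_ (*-identityˡ (f zero)) (sum-cong-≗ (λ j → *-zeroˡ (f (suc j)))) ⟩
    f zero + ∑[ j < n ] 0ℤ                    ≡⟨ cong (λ s → f zero + s) (sum-zero n) ⟩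
    f zero + 0ℤ                               ≡⟨ +-identityʳ (f zero) ⟩
    f zero                                    ∎
    where open ≡-Reasoning
  δ-∙ {suc n} (suc i) f = begin
    0ℤ * f zero + δ i ∙ (f ∘ suc)  ≡⟨ cong₂ _+_ (*-zeroˡ (f zero)) (δ-∙ i (f ∘ suc)) ⟩
    0ℤ + f (suc i)                 ≡⟨ +-identityˡ (f (suc i)) ⟩
    f (suc i)                      ∎
    where open ≡-Reasoning

  ∙-cong : ∀ {n} {f f′ g g′ : Row n} → f ≗ f′ → g ≗ g′ → f ∙ g ≡ f′ ∙ g′
  ∙-cong f≗f′ g≗g′ = sum-cong-≗ (λ i → cong₂ _*_ (f≗f′ i) (g≗g′ i))

  ∙-comm : ∀ {n} (f g : Row n) → f ∙ g ≡ g ∙ f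
  ∙-comm f g = sum-cong-≗ (λ i → *-comm (f i) (g i))

  ∙-⊕ˡ : ∀ {n} (f g h : Row n) → (f ⊕ g) ∙ h ≡ f ∙ h + g ∙ h
  ∙-⊕ˡ f g h = trans (sum-cong-≗ (λ i → *-distribʳ-+ (h i) (f i) (g i))) (sum-+ (λ i → f i * h i) (λ i → g i * h i))

  ∙-⊕ʳ : ∀ {n} (h f g : Row n) → h ∙ (f ⊕ g) ≡ h ∙ f + h ∙ g
  ∙-⊕ʳ h f g = trans (sum-cong-≗ (λ i → *-distribˡ-+ (h i) (f i) (g i))) (sum-+ (λ i → h i * f i) (λ i → h i * g i))

  ∙-⊙ˡ : ∀ {n} c (f g : Row n) → (c ⊙ f) ∙ g ≡ c * f ∙ g
  ∙-⊙ˡ c f g = trans (sum-cong-≗ (λ i → *-assoc c (f i) (g i))) (sum-⊙ c (λ i → f i * g i))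

  ∙-⊙ʳ : ∀ {n} c (f g : Row n) → f ∙ (c ⊙ g) ≡ c * f ∙ g
  ∙-⊙ʳ c f g = trans (∙-comm f (c ⊙ g)) (trans (∙-⊙ˡ c g f) (cong (c *_) (∙-comm g f)))

  ∙-one : ∀ {n} (f : Row n) → f ∙ one ≡ sum f
  ∙-one f = sum-cong-≗ (λ i → *-identityʳ (f i))

  sum-one : ∀ n → sum (one {n}) ≡ + n
  sum-one n = trans (sum-const n 1ℤ) (*-identityʳ (+ n))

  sum-δ : ∀ {n} (i : Fin n) → sum (δ i) ≡ 1ℤ
  sum-δ i = trans (sym (∙-one (δ i))) (δ-∙ i one)

  _⊗_ : ∀ {m n} → Row m → Row n → Row (m ℕ.* n)
  _⊗_ {m} {n} f g x = f (proj₁ (remQuot {m} n x)) * g (proj₂ (remQuot {m} n x))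

  ⊗-combine : ∀ {m n} (f : Row m) (g : Row n) i j → (f ⊗ g) (combine i j) ≡ f i * g j
  ⊗-combine {m} {n} f g i j = cong (λ p → f (proj₁ p) * g (proj₂ p)) (remQuot-combine {m} {n} i j)

  sum-++ : ∀ m n (f : Row (m ℕ.+ n)) → sum f ≡ sum (f ∘ (_↑ˡ n)) + sum (f ∘ (m ↑ʳ_))
  sum-++ zero    n f = sym (+-identityˡ _)
  sum-++ (suc m) n f = trans (cong (λ s → f zero + s) (sum-++ m n (f ∘ suc)))
    (sym (+-assoc (f zero) (sum (f ∘ suc ∘ (_↑ˡ n))) (sum (f ∘ (suc m ↑ʳ_)))))

  sum-combine : ∀ m n (f : Row (m ℕ.* n)) → sum f ≡ ∑[ i < m ] ∑[ j < n ] f (combine i j)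
  sum-combine zero    n f = refl
  sum-combine (suc m) n f = trans (sum-++ n (m ℕ.* n) f)
    (cong (λ s → sum (f ∘ (_↑ˡ (m ℕ.* n))) + s) (sum-combine m n (f ∘ (n ↑ʳ_))))

  sum-⊗ : ∀ {m n} (f : Row m) (g : Row n) → sum (f ⊗ g) ≡ sum f * sum g
  sum-⊗ {m} {n} f g = begin
    sum (f ⊗ g)                                  ≡⟨ sum-combine m n (f ⊗ g) ⟩
    ∑[ i < m ] ∑[ j < n ] (f ⊗ g) (combine i j)  ≡⟨ sum-cong-≗ (λ i → sum-cong-≗ (⊗-combine f g i)) ⟩
    ∑[ i < m ] ∑[ j < n ] (f i * g j)            ≡⟨ sum-cong-≗ (λ i → *-distribˡ-sum (f i) g) ⟨
    ∑[ i < m ] (f i * sum g)                     ≡⟨ *-distribʳ-sum (sum g) f ⟨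
    sum f * sum g                                ∎
    where open ≡-Reasoning

  -- The mixed-product rule. Every Gram matrix of a Kronecker construction below is reduced by it to
  -- Gram matrices of the factors.
  ⊗-∙-⊗ : ∀ {m n} (f f′ : Row m) (g g′ : Row n) → (f ⊗ g) ∙ (f′ ⊗ g′) ≡ f ∙ f′ * g ∙ g′
  ⊗-∙-⊗ {m} {n} f f′ g g′ = trans
    (sum-cong-≗ (λ x → lemma (f (π₁ x)) (g (π₂ x)) (f′ (π₁ x)) (g′ (π₂ x))))
    (sum-⊗ (λ i → f i * f′ i) (λ j → g j * g′ j))
    where
    π₁ = λ (x : Fin (m ℕ.* n)) → proj₁ (remQuot {m} n x)
    π₂ = λ (x : Fin (m ℕ.* n)) → proj₂ (remQuot {m} n x)
    lemma : ∀ a b c d → (a * b) * (c * d) ≡ (a * c) * (b * d)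
    lemma = solve-∀

  δ-⊗ : ∀ {m n} (x : Fin (m ℕ.* n)) → δ x ≗ δ (proj₁ (remQuot {m} n x)) ⊗ δ (proj₂ (remQuot {m} n x))
  δ-⊗ {m} {n} x y with x Fin.≟ y
  ... | yes refl = trans (δ-refl x) (sym (cong₂ _*_ (δ-refl (proj₁ (remQuot {m} n x))) (δ-refl (proj₂ (remQuot {m} n x)))))
  ... | no x≢y with proj₁ (remQuot {m} n x) Fin.≟ proj₁ (remQuot {m} n y)
  ... | no ≢ = trans (δ-≢ x≢y) (sym (zeroˡ-* _ (δ-≢ ≢)))
  ... | yes ≡₁ = trans (δ-≢ x≢y) (sym (zeroʳ-* (δ (proj₁ (remQuot {m} n x)) (proj₁ (remQuot {m} n y))) (δ-≢ ≢₂)))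
    where
    ≢₂ : proj₂ (remQuot {m} n x) ≢ proj₂ (remQuot {m} n y)
    ≢₂ ≡₂ = x≢y (trans (sym (combine-remQuot {m} n x)) (trans (cong₂ combine ≡₁ ≡₂) (combine-remQuot {m} n y)))

  IsSign : ℤ → Set
  IsSign s = s ≡ 1ℤ ⊎ s ≡ -1ℤ

  IsSign-* : ∀ {s t} → IsSign s → IsSign t → IsSign (s * t)
  IsSign-* (inj₁ refl) (inj₁ refl) = inj₁ refl
  IsSign-* (inj₁ refl) (inj₂ refl) = inj₂ refl
  IsSign-* (inj₂ refl) (inj₁ refl) = inj₂ refl
  IsSign-* (inj₂ refl) (inj₂ refl) = inj₁ refl

  IsSign-neg : ∀ {s} → IsSign s → IsSign (- s)
  IsSign-neg (inj₁ refl) = inj₂ refl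
  IsSign-neg (inj₂ refl) = inj₁ refl

  IsSign-square : ∀ {s} → IsSign s → s * s ≡ 1ℤ
  IsSign-square (inj₁ refl) = refl
  IsSign-square (inj₂ refl) = refl

-- Turyn's construction: cores of prime power order from a core of prime order

module Turyn where

  open Sums
  import Data.Nat as ℕ
  open import Data.Nat using (ℕ; zero; suc)
  open import Data.Integer hiding (suc; pred; _⊔_; _≟_; _⊖_; NonZero)
  open import Data.Integer.Properties using (pos-*; +-identityʳ; *-identityˡ; *-zeroʳ)
  open import Data.Integer.Tactic.RingSolver using (solve-∀)
  open import Data.Fin as Fin using (Fin; zero; suc; combine; remQuot)
  open import Data.Fin.Properties using (combine-remQuot)
  open import Data.Product using (_×_; _,_; proj₁; proj₂)
  open import Data.Sum using (_⊎_; inj₁; inj₂)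
  open import Data.Empty using (⊥-elim)
  open import Relation.Nullary using (Dec; yes; no)
  open import Relation.Binary.PropositionalEquality

  -- The core of a conference matrix of order n + 1.
  record Core (n : ℕ) : Set where
    field
      T          : Fin n → Row n
      diagonal   : ∀ i → T i i ≡ 0ℤ
      off        : ∀ {i j} → i ≢ j → IsSign (T i j)
      orthogonal : ∀ i j → T i ∙ T j ≡ + n * δ i j - 1ℤ
      balanced   : ∀ i → sum (T i) ≡ 0ℤ
      ε          : ℤ
      ε-sign     : IsSign ε
      symmetric  : ∀ i j → T j i ≡ ε * T i j

  ∙-two : ∀ {m n} (f h f′ : Row m) (g k g′ : Row n) →
          (f ⊗ g ⊕ h ⊗ k) ∙ (f′ ⊗ g′) ≡ f ∙ f′ * g ∙ g′ + h ∙ f′ * k ∙ g′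
  ∙-two f h f′ g k g′ = trans (∙-⊕ˡ (f ⊗ g) (h ⊗ k) (f′ ⊗ g′)) (cong₂ _+_ (⊗-∙-⊗ f f′ g g′) (⊗-∙-⊗ h f′ k g′))

  ∙-four : ∀ {m n} (f h f′ h′ : Row m) (g k g′ k′ : Row n) →
           (f ⊗ g ⊕ h ⊗ k) ∙ (f′ ⊗ g′ ⊕ h′ ⊗ k′) ≡
           (f ∙ f′ * g ∙ g′ + h ∙ f′ * k ∙ g′) + (f ∙ h′ * g ∙ k′ + h ∙ h′ * k ∙ k′)
  ∙-four f h f′ h′ g k g′ k′ = trans (∙-⊕ʳ (f ⊗ g ⊕ h ⊗ k) (f′ ⊗ g′) (h′ ⊗ k′))
    (cong₂ _+_ (∙-two f h f′ g k g′) (∙-two f h h′ g k k′))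

  -- The arguments are the entries (α β ; γ η) of the transfer matrix below.
  DiagonalBlock OffBlock : ℤ → ℤ → ℤ → ℤ → Set
  DiagonalBlock α β γ η = (α ≡ 1ℤ × β ≡ 0ℤ × γ ≡ 0ℤ × η ≡ 1ℤ) ⊎ (α ≡ 0ℤ × β ≡ 1ℤ × γ ≡ 1ℤ × η ≡ 0ℤ)
  OffBlock α β γ η = (IsSign α × β ≡ 0ℤ × IsSign γ × η ≡ 0ℤ) ⊎ (α ≡ 0ℤ × IsSign β × γ ≡ 0ℤ × IsSign η)

  diagonal-swap : ∀ {α β γ η} → DiagonalBlock α β γ η → DiagonalBlock γ η α β
  diagonal-swap (inj₁ (α , β , γ , η)) = inj₂ (γ , η , α , β)
  diagonal-swap (inj₂ (α , β , γ , η)) = inj₁ (γ , η , α , β)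

  off-swap : ∀ {α β γ η} → OffBlock α β γ η → OffBlock γ η α β
  off-swap (inj₁ (α , β , γ , η)) = inj₁ (γ , η , α , β)
  off-swap (inj₂ (α , β , γ , η)) = inj₂ (γ , η , α , β)

  diagonal-scale : ∀ {w α β γ η} → IsSign w → DiagonalBlock α β γ η → OffBlock (w * α) (w * β) α β
  diagonal-scale {w} s (inj₁ (refl , refl , _ , _)) = inj₁ (IsSign-* s (inj₁ refl) , *-zeroʳ w , inj₁ refl , refl)
  diagonal-scale {w} s (inj₂ (refl , refl , _ , _)) = inj₂ (*-zeroʳ w , IsSign-* s (inj₁ refl) , refl , inj₁ refl)

  off-scale : ∀ {w α β γ η} → IsSign w → OffBlock α β γ η → OffBlock (w * α) (w * β) α β
  off-scale {w} s (inj₁ (α , refl , _ , _)) = inj₁ (IsSign-* s α , *-zeroʳ w , α , refl)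
  off-scale {w} s (inj₂ (refl , β , _ , _)) = inj₂ (*-zeroʳ w , IsSign-* s β , refl , β)

  block-resp : ∀ (P : ℤ → ℤ → ℤ → ℤ → Set) {α β γ η α′ β′ γ′ η′} →
               α ≡ α′ → β ≡ β′ → γ ≡ γ′ → η ≡ η′ → P α′ β′ γ′ η′ → P α β γ η
  block-resp P refl refl refl refl p = p

  -- Turyn's core of order v ʳ is the trace, twisted by a sign, of the r-fold tensor
  -- power of the transfer matrix (W I ; J 0).  The four blocks A B C D of that
  -- power satisfy the identities below, in which 2 a - 1 = (-1) ʳ.
  module _ {v} (W : Core v) where
    private
      module W = Core W

    record Transfer (n : ℕ) : Set where
      field
        A B C D : Fin n → Row n
        A∙C : ∀ x y → A x ∙ C y ≡ 0ℤ
        B∙D : ∀ x y → B x ∙ D y ≡ 0ℤ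
        vA+C : ∀ x y → + v * A x ∙ A y + C x ∙ C y ≡ + v * (+ n * δ x y)
        vB+D : ∀ x y → + v * B x ∙ B y + D x ∙ D y ≡ + n * δ x y
        a : ℤ
        A-vB : ∀ x y → A x ∙ A y ≡ + v * B x ∙ B y + (+ 2 * a - 1ℤ)
        A∙D : ∀ x y → A x ∙ D y ≡ a
        C∙B : ∀ x y → C x ∙ B y ≡ 1ℤ - a
        sum-A : ∀ x → sum (A x) ≡ sum (D x)
        sum-C : ∀ x → sum (C x) ≡ + v * sum (B x)
        -- This is the r-th power of ε. The entries of the block power are sums of words in W and
        -- adjacent pairs I J; in `B` and `C` one I or J lacks its partner, so the number of letters
        -- W changes parity and transposition brings one more ε.
        e : ℤ
        e-sign : IsSign e
        sym-A : ∀ x y → A y x ≡ e * A x y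
        sym-B : ∀ x y → B y x ≡ W.ε * e * B x y
        sym-C : ∀ x y → C y x ≡ W.ε * e * C x y
        sym-D : ∀ x y → D y x ≡ e * D x y
        diag : ∀ x → DiagonalBlock (A x x) (B x x) (C x x) (D x x)
        off : ∀ x y → x ≢ y → OffBlock (A x y) (B x y) (C x y) (D x y)

    -- The empty product, which is the identity matrix with blocks of order one.
    transfer-zero : Transfer 1
    transfer-zero = record
      { A = λ _ _ → 1ℤ ; B = λ _ _ → 0ℤ ; C = λ _ _ → 0ℤ ; D = λ _ _ → 1ℤ
      ; A∙C = λ _ _ → refl ; B∙D = λ _ _ → refl
      ; vA+C = λ { zero zero → +-identityʳ (+ v * 1ℤ) }
      ; vB+D = λ { zero zero → cong (_+ 1ℤ) (*-zeroʳ (+ v)) }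
      ; a = 1ℤ
      ; A-vB = λ { zero zero → sym (cong (_+ 1ℤ) (*-zeroʳ (+ v))) }
      ; A∙D = λ _ _ → refl ; C∙B = λ _ _ → refl
      ; sum-A = λ _ → refl ; sum-C = λ _ → sym (*-zeroʳ (+ v))
      ; e = 1ℤ ; e-sign = inj₁ refl
      ; sym-A = λ _ _ → refl ; sym-B = λ _ _ → sym (*-zeroʳ (W.ε * 1ℤ))
      ; sym-C = λ _ _ → sym (*-zeroʳ (W.ε * 1ℤ)) ; sym-D = λ _ _ → refl
      ; diag = λ _ → inj₁ (refl , refl , refl , refl)
      ; off = λ { zero zero 0≢0 → ⊥-elim (0≢0 refl) }
      }

    module _ {n} (𝒯 : Transfer n) where
      open Transfer 𝒯
      private
        N = v ℕ.* n

        π₁ : Fin N → Fin v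
        π₁ x = proj₁ (remQuot {v} n x)

        π₂ : Fin N → Fin n
        π₂ x = proj₂ (remQuot {v} n x)

        -- The block product of (W I ; J 0) with (A B ; C D), in which blocks are multiplied by the
        -- Kronecker product.
        A′ B′ C′ D′ : Fin N → Row N
        A′ x = W.T (π₁ x) ⊗ A (π₂ x) ⊕ δ (π₁ x) ⊗ C (π₂ x)
        B′ x = W.T (π₁ x) ⊗ B (π₂ x) ⊕ δ (π₁ x) ⊗ D (π₂ x)
        C′ x = one {v} ⊗ A (π₂ x)
        D′ x = one {v} ⊗ B (π₂ x)

        W∙one : ∀ i → W.T i ∙ one ≡ 0ℤ
        W∙one i = trans (∙-one (W.T i)) (W.balanced i)

        δ∙one : ∀ i → δ {v} i ∙ one ≡ 1ℤ
        δ∙one i = δ-∙ i one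

        one∙one : one {v} ∙ one ≡ + v
        one∙one = trans (∙-one (one {v})) (sum-one v)

        -- Used for products with a row of J: the W term vanishes because rows of W sum to zero, and
        -- the I term enters with coefficient one.
        first-only : ∀ {p q} r s → p ≡ 0ℤ → q ≡ 1ℤ → p * r + q * s ≡ s
        first-only r s refl refl = lemma r s
          where
          lemma : ∀ r s → 0ℤ * r + 1ℤ * s ≡ s
          lemma = solve-∀

        square : ∀ (X Y : Fin n → Row n) → (∀ x y → X x ∙ Y y ≡ 0ℤ) → ∀ i j x y →
                 (W.T i ⊗ X x ⊕ δ i ⊗ Y x) ∙ (W.T j ⊗ X y ⊕ δ j ⊗ Y y) ≡
                 (+ v * δ i j - 1ℤ) * X x ∙ X y + δ i j * Y x ∙ Y y
        square X Y X∙Y i j x y = begin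
          (W.T i ⊗ X x ⊕ δ i ⊗ Y x) ∙ (W.T j ⊗ X y ⊕ δ j ⊗ Y y)
            ≡⟨ ∙-four (W.T i) (δ i) (W.T j) (δ j) (X x) (Y x) (X y) (Y y) ⟩
          (W.T i ∙ W.T j * X x ∙ X y + δ i ∙ W.T j * Y x ∙ X y) + (W.T i ∙ δ j * X x ∙ Y y + δ i ∙ δ j * Y x ∙ Y y)
            ≡⟨ cong₂ _+_
                 (cong₂ _+_ (cong (_* X x ∙ X y) (W.orthogonal i j)) (zeroʳ-* (δ i ∙ W.T j) (trans (∙-comm (Y x) (X y)) (X∙Y y x))))
                 (cong₂ _+_ (zeroʳ-* (W.T i ∙ δ j) (X∙Y x y)) (cong (_* Y x ∙ Y y) (trans (δ-∙ i (δ j)) (δ-sym j i)))) ⟩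
          ((+ v * δ i j - 1ℤ) * X x ∙ X y + 0ℤ) + (0ℤ + δ i j * Y x ∙ Y y)
            ≡⟨ lemma ((+ v * δ i j - 1ℤ) * X x ∙ X y) (δ i j * Y x ∙ Y y) ⟩
          (+ v * δ i j - 1ℤ) * X x ∙ X y + δ i j * Y x ∙ Y y ∎
          where
          open ≡-Reasoning
          lemma : ∀ p q → (p + 0ℤ) + (0ℤ + q) ≡ p + q
          lemma = solve-∀

        A′∙A′ : ∀ x y → A′ x ∙ A′ y ≡ (+ v * δ (π₁ x) (π₁ y) - 1ℤ) * A (π₂ x) ∙ A (π₂ y) + δ (π₁ x) (π₁ y) * C (π₂ x) ∙ C (π₂ y)
        A′∙A′ x y = square A C A∙C (π₁ x) (π₁ y) (π₂ x) (π₂ y)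

        B′∙B′ : ∀ x y → B′ x ∙ B′ y ≡ (+ v * δ (π₁ x) (π₁ y) - 1ℤ) * B (π₂ x) ∙ B (π₂ y) + δ (π₁ x) (π₁ y) * D (π₂ x) ∙ D (π₂ y)
        B′∙B′ x y = square B D B∙D (π₁ x) (π₁ y) (π₂ x) (π₂ y)

        C′∙C′ : ∀ x y → C′ x ∙ C′ y ≡ + v * A (π₂ x) ∙ A (π₂ y)
        C′∙C′ x y = trans (⊗-∙-⊗ (one {v}) (one {v}) (A (π₂ x)) (A (π₂ y))) (cong (_* A (π₂ x) ∙ A (π₂ y)) one∙one)

        D′∙D′ : ∀ x y → D′ x ∙ D′ y ≡ + v * B (π₂ x) ∙ B (π₂ y)
        D′∙D′ x y = trans (⊗-∙-⊗ (one {v}) (one {v}) (B (π₂ x)) (B (π₂ y))) (cong (_* B (π₂ x) ∙ B (π₂ y)) one∙one)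

        -- W Wᵀ is v I - J, and the contribution of its - J is exactly compensated by the lower
        -- block, where J Jᵀ is v J.
        weighted : ∀ {d P R z} → + v * P + R ≡ z → + v * ((+ v * d - 1ℤ) * P + d * R) + + v * P ≡ + v * (d * z)
        weighted {d} {P} {R} refl = lemma (+ v) d P R
          where
          lemma : ∀ v d P R → v * ((v * d - 1ℤ) * P + d * R) + v * P ≡ v * (d * (v * P + R))
          lemma = solve-∀

        vn : + N ≡ + v * + n
        vn = pos-* v n

        vA+C′ : ∀ x y → + v * A′ x ∙ A′ y + C′ x ∙ C′ y ≡ + v * (+ N * δ x y)
        vA+C′ x y = begin
          + v * A′ x ∙ A′ y + C′ x ∙ C′ y ≡⟨ cong₂ _+_ (cong (+ v *_) (A′∙A′ x y)) (C′∙C′ x y) ⟩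
          _                               ≡⟨ weighted (vA+C (π₂ x) (π₂ y)) ⟩
          + v * (δ (π₁ x) (π₁ y) * (+ v * (+ n * δ (π₂ x) (π₂ y)))) ≡⟨ lemma (+ v) (+ n) (δ (π₁ x) (π₁ y)) (δ (π₂ x) (π₂ y)) ⟩
          + v * (+ v * + n * (δ (π₁ x) (π₁ y) * δ (π₂ x) (π₂ y))) ≡⟨ cong (+ v *_) (cong₂ _*_ vn (δ-⊗ {v} {n} x y)) ⟨
          + v * (+ N * δ x y)             ∎
          where
          open ≡-Reasoning
          lemma : ∀ v n d d′ → v * (d * (v * (n * d′))) ≡ v * (v * n * (d * d′))
          lemma = solve-∀

        vB+D′ : ∀ x y → + v * B′ x ∙ B′ y + D′ x ∙ D′ y ≡ + N * δ x y
        vB+D′ x y = begin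
          + v * B′ x ∙ B′ y + D′ x ∙ D′ y ≡⟨ cong₂ _+_ (cong (+ v *_) (B′∙B′ x y)) (D′∙D′ x y) ⟩
          _                               ≡⟨ weighted (vB+D (π₂ x) (π₂ y)) ⟩
          + v * (δ (π₁ x) (π₁ y) * (+ n * δ (π₂ x) (π₂ y))) ≡⟨ lemma (+ v) (+ n) (δ (π₁ x) (π₁ y)) (δ (π₂ x) (π₂ y)) ⟩
          + v * + n * (δ (π₁ x) (π₁ y) * δ (π₂ x) (π₂ y)) ≡⟨ cong₂ _*_ vn (δ-⊗ {v} {n} x y) ⟨
          + N * δ x y             ∎
          where
          open ≡-Reasoning
          lemma : ∀ v n d d′ → v * (d * (n * d′)) ≡ v * n * (d * d′)
          lemma = solve-∀

        -- The two weighted identities eliminate `R` and `S`, and their right sides share the value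
        -- `Y`. The old constant 2 a - 1 then appears with coefficient (v d - 1) - v d = -1, so it
        -- changes sign, which means that `a` becomes 1 - a.
        A-vB′ : ∀ x y → A′ x ∙ A′ y ≡ + v * B′ x ∙ B′ y + (+ 2 * (1ℤ - a) - 1ℤ)
        A-vB′ x y = begin
          A′ x ∙ A′ y                     ≡⟨ A′∙A′ x y ⟩
          (+ v * d - 1ℤ) * P + d * R      ≡⟨ combination d P Q R S (A-vB (π₂ x) (π₂ y)) (vA+C (π₂ x) (π₂ y)) (vB+D (π₂ x) (π₂ y)) ⟩
          + v * ((+ v * d - 1ℤ) * Q + d * S) + (+ 2 * (1ℤ - a) - 1ℤ) ≡⟨ cong (λ s → + v * s + (+ 2 * (1ℤ - a) - 1ℤ)) (B′∙B′ x y) ⟨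
          + v * B′ x ∙ B′ y + (+ 2 * (1ℤ - a) - 1ℤ) ∎
          where
          open ≡-Reasoning
          d = δ (π₁ x) (π₁ y)
          P = A (π₂ x) ∙ A (π₂ y)
          Q = B (π₂ x) ∙ B (π₂ y)
          R = C (π₂ x) ∙ C (π₂ y)
          S = D (π₂ x) ∙ D (π₂ y)
          isolate : ∀ v P R → R ≡ (v * P + R) - v * P
          isolate = solve-∀
          lemma : ∀ v d Q Y a → (v * d - 1ℤ) * (v * Q + (+ 2 * a - 1ℤ)) + d * (v * Y - v * (v * Q + (+ 2 * a - 1ℤ))) ≡
                                v * ((v * d - 1ℤ) * Q + d * (Y - v * Q)) + (+ 2 * (1ℤ - a) - 1ℤ)
          lemma = solve-∀
          combination : ∀ d P Q R S {Y} → P ≡ + v * Q + (+ 2 * a - 1ℤ) → + v * P + R ≡ + v * Y → + v * Q + S ≡ Y →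
                        (+ v * d - 1ℤ) * P + d * R ≡ + v * ((+ v * d - 1ℤ) * Q + d * S) + (+ 2 * (1ℤ - a) - 1ℤ)
          combination d _ Q R S {Y} refl hR hS
            rewrite trans (isolate (+ v) (+ v * Q + (+ 2 * a - 1ℤ)) R) (cong (_- + v * (+ v * Q + (+ 2 * a - 1ℤ))) hR)
                  | trans (isolate (+ v) Q S) (cong (_- + v * Q) hS) = lemma (+ v) d Q Y a

        equal-coordinates : ∀ {x y} → π₁ x ≡ π₁ y → π₂ x ≡ π₂ y → x ≡ y
        equal-coordinates {x} {y} p q = trans (sym (combine-remQuot {v} n x)) (trans (cong₂ combine p q) (combine-remQuot {v} n y))

        scale : ∀ {d} w p q → d ≡ 0ℤ → w * p + d * q ≡ w * p
        scale w p q refl = lemma w p q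
          where
          lemma : ∀ w p q → w * p + 0ℤ * q ≡ w * p
          lemma = solve-∀

        ε² : W.ε * W.ε ≡ 1ℤ
        ε² = IsSign-square W.ε-sign

        ε²e : ∀ y → e * y ≡ W.ε * (W.ε * e) * y
        ε²e y = trans (sym (*-identityˡ (e * y))) (trans (cong (_* (e * y)) (sym ε²)) (lemma W.ε e y))
          where
          lemma : ∀ ε e y → (ε * ε) * (e * y) ≡ ε * (ε * e) * y
          lemma = solve-∀

        module Same {x y} (p : π₁ x ≡ π₁ y) where
          W≡0 : W.T (π₁ x) (π₁ y) ≡ 0ℤ
          W≡0 = subst (λ i → W.T (π₁ x) i ≡ 0ℤ) p (W.diagonal (π₁ x))
          δ≡1 : δ (π₁ x) (π₁ y) ≡ 1ℤ
          δ≡1 = subst (λ i → δ (π₁ x) i ≡ 1ℤ) p (δ-refl (π₁ x))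
          A′≡ : A′ x y ≡ C (π₂ x) (π₂ y)
          A′≡ = first-only _ _ W≡0 δ≡1
          B′≡ : B′ x y ≡ D (π₂ x) (π₂ y)
          B′≡ = first-only _ _ W≡0 δ≡1

        C′≡ : ∀ x y → C′ x y ≡ A (π₂ x) (π₂ y)
        C′≡ x y = *-identityˡ _

        D′≡ : ∀ x y → D′ x y ≡ B (π₂ x) (π₂ y)
        D′≡ x y = *-identityˡ _

        diag′ : ∀ x → DiagonalBlock (A′ x x) (B′ x x) (C′ x x) (D′ x x)
        diag′ x = block-resp DiagonalBlock A′≡ B′≡ (C′≡ x x) (D′≡ x x) (diagonal-swap (diag (π₂ x)))
          where open Same {x} {x} refl

        -- Where the new coordinates agree, W is 0 and I is 1, and the block becomes (C D ; A B),
        -- the old one with its rows exchanged. Where they differ, W is a sign w and the block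
        -- becomes (w A w B ; A B), of the right shape whether the old block was diagonal or not.
        off′ : ∀ x y → x ≢ y → OffBlock (A′ x y) (B′ x y) (C′ x y) (D′ x y)
        off′ x y x≢y with π₁ x Fin.≟ π₁ y | π₂ x Fin.≟ π₂ y
        ... | yes p | yes q = ⊥-elim (x≢y (equal-coordinates p q))
        ... | yes p | no q = block-resp OffBlock A′≡ B′≡ (C′≡ x y) (D′≡ x y) (off-swap (off (π₂ x) (π₂ y) q))
          where open Same {x} {y} p
        ... | no p | r = block-resp OffBlock (scale w (A (π₂ x) (π₂ y)) (C (π₂ x) (π₂ y)) (δ-≢ p))
          (scale w (B (π₂ x) (π₂ y)) (D (π₂ x) (π₂ y)) (δ-≢ p)) (C′≡ x y) (D′≡ x y) (scaled r)
          where
          w = W.T (π₁ x) (π₁ y)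
          scaled : Dec (π₂ x ≡ π₂ y) → OffBlock (w * A (π₂ x) (π₂ y)) (w * B (π₂ x) (π₂ y)) (A (π₂ x) (π₂ y)) (B (π₂ x) (π₂ y))
          scaled (yes q) = diagonal-scale (W.off p)
            (subst (λ z → DiagonalBlock (A (π₂ x) z) (B (π₂ x) z) (C (π₂ x) z) (D (π₂ x) z)) q (diag (π₂ x)))
          scaled (no q)  = off-scale (W.off p) (off (π₂ x) (π₂ y) q)

        sum-step : ∀ (X Y : Fin n → Row n) x → sum (W.T (π₁ x) ⊗ X (π₂ x) ⊕ δ (π₁ x) ⊗ Y (π₂ x)) ≡ sum (Y (π₂ x))
        sum-step X Y x = trans (sum-+ (W.T (π₁ x) ⊗ X (π₂ x)) (δ (π₁ x) ⊗ Y (π₂ x)))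
          (trans (cong₂ _+_ (sum-⊗ (W.T (π₁ x)) (X (π₂ x))) (sum-⊗ (δ (π₁ x)) (Y (π₂ x))))
                 (first-only _ _ (W.balanced (π₁ x)) (sum-δ (π₁ x))))

        sum-one-⊗ : ∀ (X : Row n) → sum (one {v} ⊗ X) ≡ + v * sum X
        sum-one-⊗ X = trans (sum-⊗ (one {v}) X) (cong (_* sum X) (sum-one v))

        product-symmetric : ∀ {w w′ d d′ s s′ t t′} f g → w′ ≡ W.ε * w → d′ ≡ d → s′ ≡ f * s → t′ ≡ W.ε * f * t →
                            g ≡ W.ε * f → w′ * s′ + d′ * t′ ≡ g * (w * s + d * t)
        product-symmetric {w} {_} {d} {_} {s} {_} {t} f _ refl refl refl refl refl = lemma W.ε f w d s t
          where
          lemma : ∀ ε f w d s t → ε * w * (f * s) + d * (ε * f * t) ≡ ε * f * (w * s + d * t)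
          lemma = solve-∀

      transfer-suc : Transfer N
      transfer-suc = record
        { A = A′ ; B = B′ ; C = C′ ; D = D′
        ; A∙C = λ x y → trans (∙-two (W.T (π₁ x)) (δ (π₁ x)) one (A (π₂ x)) (C (π₂ x)) (A (π₂ y)))
            (trans (first-only _ _ (W∙one (π₁ x)) (δ∙one (π₁ x))) (trans (∙-comm (C (π₂ x)) (A (π₂ y))) (A∙C (π₂ y) (π₂ x))))
        ; B∙D = λ x y → trans (∙-two (W.T (π₁ x)) (δ (π₁ x)) one (B (π₂ x)) (D (π₂ x)) (B (π₂ y)))
            (trans (first-only _ _ (W∙one (π₁ x)) (δ∙one (π₁ x))) (trans (∙-comm (D (π₂ x)) (B (π₂ y))) (B∙D (π₂ y) (π₂ x))))
        ; vA+C = vA+C′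
        ; vB+D = vB+D′
        ; a = 1ℤ - a
        ; A-vB = A-vB′
        ; A∙D = λ x y → trans (∙-two (W.T (π₁ x)) (δ (π₁ x)) one (A (π₂ x)) (C (π₂ x)) (B (π₂ y)))
            (trans (first-only _ _ (W∙one (π₁ x)) (δ∙one (π₁ x))) (C∙B (π₂ x) (π₂ y)))
        ; C∙B = λ x y → trans (∙-comm (C′ x) (B′ y))
            (trans (∙-two (W.T (π₁ y)) (δ (π₁ y)) one (B (π₂ y)) (D (π₂ y)) (A (π₂ x)))
            (trans (first-only _ _ (W∙one (π₁ y)) (δ∙one (π₁ y)))
            (trans (∙-comm (D (π₂ y)) (A (π₂ x))) (trans (A∙D (π₂ x) (π₂ y)) (double-complement a)))))
        ; sum-A = λ x → trans (sum-step A C x) (trans (sum-C (π₂ x)) (sym (sum-one-⊗ (B (π₂ x)))))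
        ; sum-C = λ x → trans (sum-one-⊗ (A (π₂ x)))
            (cong (+ v *_) (trans (sum-A (π₂ x)) (sym (sum-step B D x))))
        ; e = W.ε * e
        ; e-sign = IsSign-* W.ε-sign e-sign
        ; sym-A = λ x y → product-symmetric e (W.ε * e) (W.symmetric (π₁ x) (π₁ y)) (δ-sym (π₁ y) (π₁ x))
            (sym-A (π₂ x) (π₂ y)) (sym-C (π₂ x) (π₂ y)) refl
        ; sym-B = λ x y → product-symmetric (W.ε * e) _ (W.symmetric (π₁ x) (π₁ y)) (δ-sym (π₁ y) (π₁ x))
            (sym-B (π₂ x) (π₂ y)) (trans (sym-D (π₂ x) (π₂ y)) (ε²e _)) refl
        ; sym-C = λ x y → trans (C′≡ y x) (trans (sym-A (π₂ x) (π₂ y))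
            (trans (ε²e _) (cong (W.ε * (W.ε * e) *_) (sym (C′≡ x y)))))
        ; sym-D = λ x y → trans (D′≡ y x) (trans (sym-B (π₂ x) (π₂ y)) (cong (W.ε * e *_) (sym (D′≡ x y))))
        ; diag = diag′
        ; off = off′
        }
        where
        double-complement : ∀ a → a ≡ 1ℤ - (1ℤ - a)
        double-complement = solve-∀

    transfer-power : ∀ r → Transfer (v ℕ.^ r)
    transfer-power zero    = transfer-zero
    transfer-power (suc r) = transfer-suc (transfer-power r)

    -- On the diagonal A and D agree; off it exactly one of them is nonzero, so A - D has zero
    -- diagonal and signs elsewhere. In its Gram matrix the constant 2 a - 1 from `A-vB` meets - 2 a
    -- from the two cross products, which leaves the required - 1 for either value of `a`.
    transfer⇒core : ∀ {n} → Transfer n → Core n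
    transfer⇒core {n} 𝒯 = record
      { T = T
      ; diagonal = λ i → zero-diagonal (diag i)
      ; off = λ {i} {j} i≢j → sign-off (off i j i≢j)
      ; orthogonal = orthogonal
      ; balanced = λ i → trans (sum-+ (A i) (-1ℤ ⊙ D i)) (trans (cong₂ _+_ (sum-A i) (sum-⊙ -1ℤ (D i))) (cancel (sum (D i))))
      ; ε = e
      ; ε-sign = e-sign
      ; symmetric = λ i j → trans (cong₂ (λ s t → s + -1ℤ * t) (sym-A i j) (sym-D i j)) (factor e (A i j) (D i j))
      }
      where
      open Transfer 𝒯
      T : Fin n → Row n
      T i = A i ⊕ -1ℤ ⊙ D i
      zero-diagonal : ∀ {α β γ η} → DiagonalBlock α β γ η → α + -1ℤ * η ≡ 0ℤ
      zero-diagonal (inj₁ (refl , _ , _ , refl)) = refl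
      zero-diagonal (inj₂ (refl , _ , _ , refl)) = refl
      sign-off : ∀ {α β γ η} → OffBlock α β γ η → IsSign (α + -1ℤ * η)
      sign-off (inj₁ (inj₁ refl , _ , _ , refl)) = inj₁ refl
      sign-off (inj₁ (inj₂ refl , _ , _ , refl)) = inj₂ refl
      sign-off (inj₂ (refl , _ , _ , inj₁ refl)) = inj₂ refl
      sign-off (inj₂ (refl , _ , _ , inj₂ refl)) = inj₁ refl
      cancel : ∀ s → s + -1ℤ * s ≡ 0ℤ
      cancel = solve-∀
      factor : ∀ e s t → e * s + -1ℤ * (e * t) ≡ e * (s + -1ℤ * t)
      factor = solve-∀
      expand : ∀ (f g f′ g′ : Row n) → (f ⊕ -1ℤ ⊙ g) ∙ (f′ ⊕ -1ℤ ⊙ g′) ≡ f ∙ f′ + g ∙ g′ - (f ∙ g′ + g ∙ f′)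
      expand f g f′ g′ = trans (∙-⊕ˡ f (-1ℤ ⊙ g) _)
        (trans (cong₂ _+_ (trans (∙-⊕ʳ f f′ (-1ℤ ⊙ g′)) (cong (λ s → f ∙ f′ + s) (∙-⊙ʳ -1ℤ f g′)))
          (trans (∙-⊙ˡ -1ℤ g _) (cong (-1ℤ *_) (trans (∙-⊕ʳ g f′ (-1ℤ ⊙ g′)) (cong (λ s → g ∙ f′ + s) (∙-⊙ʳ -1ℤ g g′))))))
          (lemma (f ∙ f′) (f ∙ g′) (g ∙ f′) (g ∙ g′)))
        where
        lemma : ∀ p q r s → p + -1ℤ * q + -1ℤ * (r + -1ℤ * s) ≡ p + s - (q + r)
        lemma = solve-∀
      orthogonal : ∀ i j → T i ∙ T j ≡ + n * δ i j - 1ℤ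
      orthogonal i j = begin
        T i ∙ T j                                            ≡⟨ expand (A i) (D i) (A j) (D j) ⟩
        A i ∙ A j + D i ∙ D j - (A i ∙ D j + D i ∙ A j)      ≡⟨ cong₂ (λ s t → s + D i ∙ D j - t) (A-vB i j) (cong₂ _+_ (A∙D i j) (trans (∙-comm (D i) (A j)) (A∙D j i))) ⟩
        + v * B i ∙ B j + (+ 2 * a - 1ℤ) + D i ∙ D j - (a + a) ≡⟨ lemma (+ v * B i ∙ B j) (D i ∙ D j) a ⟩
        + v * B i ∙ B j + D i ∙ D j - 1ℤ                     ≡⟨ cong (_- 1ℤ) (vB+D i j) ⟩
        + n * δ i j - 1ℤ                                     ∎
        where
        open ≡-Reasoning
        lemma : ∀ p s a → p + (+ 2 * a - 1ℤ) + s - (a + a) ≡ p + s - 1ℤ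
        lemma = solve-∀

    core-power : ∀ r → Core (v ℕ.^ r)
    core-power r = transfer⇒core (transfer-power r)

-- Regular symmetric conference matrices of order q² + 1

module Conference where

  open Sums
  open Turyn using (Core; ∙-two; ∙-four)
  import Data.Nat as ℕ
  import Data.Nat.Properties as ℕ
  open import Data.Nat using (ℕ; zero; suc)
  open import Data.Integer hiding (suc; pred; _⊔_; _≟_; _⊖_; NonZero)
  open import Data.Integer.Properties using (*-identityˡ; *-identityʳ)
  open import Data.Integer.Tactic.RingSolver using (solve-∀)
  open import Data.Fin as Fin using (Fin; zero; suc; combine; remQuot)
  open import Data.Fin.Properties using (combine-remQuot)
  open import Data.Product using (_,_; proj₁; proj₂)
  open import Data.Sum using (inj₁; inj₂)
  open import Data.Empty using (⊥-elim)
  open import Relation.Nullary using (yes; no)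
  open import Relation.Binary.PropositionalEquality

  record RegularConference (q N : ℕ) : Set where
    field
      M          : Fin N → Row N
      symmetric  : ∀ i j → M i j ≡ M j i
      diagonal   : ∀ i → M i i ≡ 0ℤ
      off        : ∀ {i j} → i ≢ j → IsSign (M i j)
      orthogonal : ∀ i j → M i ∙ M j ≡ + q * + q * δ i j
      regular    : ∀ i → sum (M i) ≡ + q

  -- Supplies the switching vector. A vector of signs with sum 1 exists only in odd length, so this
  -- is one place where `q` has to be odd.
  alternating : ∀ n → Row n
  alternating (suc n) zero    = 1ℤ
  alternating (suc n) (suc i) = - alternating n i

  alternating-sign : ∀ n i → IsSign (alternating n i)
  alternating-sign (suc n) zero    = inj₁ refl
  alternating-sign (suc n) (suc i) = IsSign-neg (alternating-sign n i)

  sum-alternating-suc : ∀ n → sum (alternating (suc n)) ≡ 1ℤ - sum (alternating n)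
  sum-alternating-suc n = cong (λ s → 1ℤ + s) (trans (sum-cong-≗ (λ i → lemma (alternating n i)))
    (trans (sum-⊙ -1ℤ (alternating n)) (sym (lemma (sum (alternating n))))))
    where
    lemma : ∀ x → - x ≡ -1ℤ * x
    lemma = solve-∀

  sum-alternating : ∀ h → sum (alternating (suc (h ℕ.+ h))) ≡ 1ℤ
  sum-alternating zero    = refl
  sum-alternating (suc h) rewrite ℕ.+-suc h h = begin
    sum (alternating (3 ℕ.+ (h ℕ.+ h)))            ≡⟨ sum-alternating-suc (2 ℕ.+ (h ℕ.+ h)) ⟩
    1ℤ - sum (alternating (2 ℕ.+ (h ℕ.+ h)))       ≡⟨ cong (λ s → 1ℤ - s) (sum-alternating-suc (1 ℕ.+ (h ℕ.+ h))) ⟩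
    1ℤ - (1ℤ - sum (alternating (1 ℕ.+ (h ℕ.+ h)))) ≡⟨ cong (λ s → 1ℤ - (1ℤ - s)) (sum-alternating h) ⟩
    1ℤ                                             ∎
    where
    open ≡-Reasoning

  sum-alternating-odd : ∀ {n} h → n ≡ suc (h ℕ.+ h) → sum (alternating n) ≡ 1ℤ
  sum-alternating-odd h refl = sum-alternating h

  _▹_ : ∀ {n} → ℤ → Row n → Row (suc n)
  (c ▹ f) zero    = c
  (c ▹ f) (suc i) = f i

  -- Bordering the core T ⊗ T + I ⊗ J - J ⊗ I of order q² by ones and then
  -- negating rows and columns according to (1 , z ⊗ 1), where z is a sign vector
  -- with sum 1, makes all row sums equal to q.
  module _ {q} (𝒯 : Core q) (z : Row q) (z-sign : ∀ i → IsSign (z i)) (sum-z : sum z ≡ 1ℤ) where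
    open Core 𝒯
    private
      N = q ℕ.* q

      𝟙 : Row q
      𝟙 = one

      π₁ π₂ : Fin N → Fin q
      π₁ x = proj₁ (remQuot {q} q x)
      π₂ x = proj₂ (remQuot {q} q x)

      z² : ∀ i → z i * z i ≡ 1ℤ
      z² i = IsSign-square (z-sign i)

      -- Switching by z ⊗ 1 acts on the first tensor factor only: T ⊗ T becomes U ⊗ T, I ⊗ J is
      -- unchanged, and J ⊗ I becomes z zᵀ ⊗ I. The first two make up `X`, the negative of the third
      -- is `Y`.
      U : Fin q → Row q
      U i j = z i * T i j * z j

      X Y : Fin q → Fin q → Row N
      X i k = U i ⊗ T k ⊕ δ i ⊗ 𝟙
      Y i k = ((- z i) ⊙ z) ⊗ δ k

      S : Fin N → Row N
      S x = X (π₁ x) (π₂ x) ⊕ Y (π₁ x) (π₂ x)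

      M : Fin (suc N) → Row (suc N)
      M zero    = 0ℤ ▹ (z ⊗ 𝟙)
      M (suc x) = z (π₁ x) ▹ S x

      U∙U : ∀ i j → U i ∙ U j ≡ z i * z j * (+ q * δ i j - 1ℤ)
      U∙U i j = trans (sum-cong-≗ λ m → trans (lemma (z i) (z j) (z m) (T i m) (T j m))
          (trans (cong (λ s → z i * z j * (s * (T i m * T j m))) (z² m))
                 (cong (λ s → z i * z j * s) (*-identityˡ (T i m * T j m)))))
        (trans (sum-⊙ (z i * z j) (λ m → T i m * T j m)) (cong (z i * z j *_) (orthogonal i j)))
        where
        lemma : ∀ zi zj zm s t → zi * s * zm * (zj * t * zm) ≡ zi * zj * ((zm * zm) * (s * t))
        lemma = solve-∀

      U∙z : ∀ i → U i ∙ z ≡ 0ℤ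
      U∙z i = trans (sum-cong-≗ λ m → trans (lemma (z i) (T i m) (z m))
          (cong (z i *_) (trans (cong (T i m *_) (z² m)) (*-identityʳ (T i m)))))
        (trans (sum-⊙ (z i) (T i)) (zeroʳ-* (z i) (balanced i)))
        where
        lemma : ∀ zi s zm → zi * s * zm * zm ≡ zi * (s * (zm * zm))
        lemma = solve-∀

      z∙z : z ∙ z ≡ + q
      z∙z = trans (sum-cong-≗ z²) (sum-one q)

      T∙𝟙 : ∀ i → T i ∙ 𝟙 ≡ 0ℤ
      T∙𝟙 i = trans (∙-one (T i)) (balanced i)

      𝟙∙𝟙 : 𝟙 ∙ 𝟙 ≡ + q
      𝟙∙𝟙 = trans (∙-one (𝟙)) (sum-one q)

      δ∙𝟙 : ∀ i → δ {q} i ∙ 𝟙 ≡ 1ℤ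
      δ∙𝟙 i = δ-∙ i 𝟙

      X∙X : ∀ i k j l → X i k ∙ X j l ≡ z i * z j * (+ q * δ i j - 1ℤ) * (+ q * δ k l - 1ℤ) + δ i j * + q
      X∙X i k j l = trans (∙-four (U i) (δ i) (U j) (δ j) (T k) 𝟙 (T l) 𝟙)
        (trans (cong₂ _+_
          (cong₂ _+_ (cong₂ _*_ (U∙U i j) (orthogonal k l)) (zeroʳ-* (δ i ∙ U j) (trans (∙-comm 𝟙 (T l)) (T∙𝟙 l))))
          (cong₂ _+_ (zeroʳ-* (U i ∙ δ j) (T∙𝟙 k)) (cong₂ _*_ (trans (δ-∙ i (δ j)) (δ-sym j i)) 𝟙∙𝟙)))
          (lemma (z i * z j * (+ q * δ i j - 1ℤ) * (+ q * δ k l - 1ℤ)) (δ i j * + q)))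
        where
        lemma : ∀ p r → p + 0ℤ + (0ℤ + r) ≡ p + r
        lemma = solve-∀

      X∙Y : ∀ i k j l → X i k ∙ Y j l ≡ - (z i * z j)
      X∙Y i k j l = trans (∙-two (U i) (δ i) ((- z j) ⊙ z) (T k) 𝟙 (δ l))
        (trans (cong₂ _+_
          (zeroˡ-* (T k ∙ δ l) (trans (∙-⊙ʳ (- z j) (U i) z) (zeroʳ-* (- z j) (U∙z i))))
          (cong₂ _*_ (δ-∙ i ((- z j) ⊙ z)) (trans (∙-comm 𝟙 (δ l)) (δ∙𝟙 l))))
          (lemma (z i) (z j)))
        where
        lemma : ∀ s t → 0ℤ + - t * s * 1ℤ ≡ - (s * t)
        lemma = solve-∀

      Y∙Y : ∀ i k j l → Y i k ∙ Y j l ≡ z i * z j * + q * δ k l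
      Y∙Y i k j l = trans (⊗-∙-⊗ ((- z i) ⊙ z) ((- z j) ⊙ z) (δ k) (δ l))
        (cong₂ _*_
          (trans (∙-⊙ˡ (- z i) z ((- z j) ⊙ z)) (trans (cong (- z i *_) (trans (∙-⊙ʳ (- z j) z z) (cong (- z j *_) z∙z))) (lemma (z i) (z j) (+ q))))
          (trans (δ-∙ k (δ l)) (δ-sym l k)))
        where
        lemma : ∀ s t q → - s * (- t * q) ≡ s * t * q
        lemma = solve-∀

      -- The terms linear in q cancel, because z i * z j is 1 wherever `δ i j` is nonzero. What
      -- remains beside q² δ is - z i * z j, which the border entries restore.
      S∙S : ∀ x y → S x ∙ S y ≡ + q * + q * δ x y - z (π₁ x) * z (π₁ y)
      S∙S x y = begin
        S x ∙ S y
          ≡⟨ trans (∙-⊕ˡ (X i k) (Y i k) (S y)) (cong₂ _+_ (∙-⊕ʳ (X i k) (X j l) (Y j l)) (∙-⊕ʳ (Y i k) (X j l) (Y j l))) ⟩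
        (X i k ∙ X j l + X i k ∙ Y j l) + (Y i k ∙ X j l + Y i k ∙ Y j l)
          ≡⟨ cong₂ _+_ (cong₂ _+_ (X∙X i k j l) (X∙Y i k j l))
               (cong₂ _+_ (trans (∙-comm (Y i k) (X j l)) (X∙Y j l i k)) (Y∙Y i k j l)) ⟩
        (z i * z j * (+ q * δ i j - 1ℤ) * (+ q * δ k l - 1ℤ) + δ i j * + q + - (z i * z j)) +
          (- (z j * z i) + z i * z j * + q * δ k l)
          ≡⟨ lemma (z i) (z j) (+ q) (δ i j) (δ k l) ⟩
        δ i j * (z i * z j) * (+ q * + q * δ k l - + q) + δ i j * + q - z i * z j
          ≡⟨ cong (λ s → s * (+ q * + q * δ k l - + q) + δ i j * + q - z i * z j) δzz ⟩
        δ i j * (+ q * + q * δ k l - + q) + δ i j * + q - z i * z j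
          ≡⟨ lemma′ (+ q) (δ i j) (δ k l) (z i * z j) ⟩
        + q * + q * (δ i j * δ k l) - z i * z j
          ≡⟨ cong (λ s → + q * + q * s - z i * z j) (δ-⊗ {q} {q} x y) ⟨
        + q * + q * δ x y - z i * z j ∎
        where
        open ≡-Reasoning
        i = π₁ x
        j = π₁ y
        k = π₂ x
        l = π₂ y
        δzz : δ i j * (z i * z j) ≡ δ i j
        δzz = trans (sym (δ-subst i j (λ m → z i * z m))) (trans (cong (δ i j *_) (z² i)) (*-identityʳ (δ i j)))
        lemma : ∀ s t q d d′ → (s * t * (q * d - 1ℤ) * (q * d′ - 1ℤ) + d * q + - (s * t)) + (- (t * s) + s * t * q * d′) ≡
                               d * (s * t) * (q * q * d′ - q) + d * q - s * t
        lemma = solve-∀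
        lemma′ : ∀ q d d′ r → d * (q * q * d′ - q) + d * q - r ≡ q * q * (d * d′) - r
        lemma′ = solve-∀

      z⊗𝟙∙S : ∀ x → (z ⊗ 𝟙) ∙ S x ≡ 0ℤ
      z⊗𝟙∙S x = begin
        (z ⊗ 𝟙) ∙ S x ≡⟨ ∙-comm (z ⊗ 𝟙) (S x) ⟩
        S x ∙ (z ⊗ 𝟙) ≡⟨ ∙-⊕ˡ (X i k) (Y i k) (z ⊗ 𝟙) ⟩
        X i k ∙ (z ⊗ 𝟙) + Y i k ∙ (z ⊗ 𝟙)
          ≡⟨ cong₂ _+_ (∙-two (U i) (δ i) z (T k) 𝟙 𝟙) (⊗-∙-⊗ ((- z i) ⊙ z) z (δ k) 𝟙) ⟩
        (U i ∙ z * T k ∙ 𝟙 + δ i ∙ z * 𝟙 ∙ 𝟙) + ((- z i) ⊙ z) ∙ z * δ k ∙ 𝟙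
          ≡⟨ cong₂ _+_ (cong₂ _+_ (zeroˡ-* (T k ∙ 𝟙) (U∙z i)) (cong₂ _*_ (δ-∙ i z) 𝟙∙𝟙))
               (cong₂ _*_ (trans (∙-⊙ˡ (- z i) z z) (cong (- z i *_) z∙z)) (δ∙𝟙 k)) ⟩
        (0ℤ + z i * + q) + - z i * + q * 1ℤ ≡⟨ lemma (z i) (+ q) ⟩
        0ℤ ∎
        where
        open ≡-Reasoning
        i = π₁ x
        k = π₂ x
        lemma : ∀ s q → (0ℤ + s * q) + - s * q * 1ℤ ≡ 0ℤ
        lemma = solve-∀

      -- U ⊗ T contributes nothing as rows of T sum to zero, I ⊗ J contributes q, and `Y`
      -- contributes - z i because z sums to 1. The border entry z i then brings the full row to q.
      sum-S : ∀ x → sum (S x) ≡ + q - z (π₁ x)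
      sum-S x = begin
        sum (S x) ≡⟨ trans (sum-+ (X i k) (Y i k)) (cong (_+ sum (Y i k)) (sum-+ (U i ⊗ T k) (δ i ⊗ 𝟙))) ⟩
        (sum (U i ⊗ T k) + sum (δ i ⊗ 𝟙)) + sum (Y i k)
          ≡⟨ cong₂ _+_ (cong₂ _+_ (sum-⊗ (U i) (T k)) (sum-⊗ (δ i) (𝟙))) (sum-⊗ ((- z i) ⊙ z) (δ k)) ⟩
        (sum (U i) * sum (T k) + sum (δ i) * sum (𝟙)) + sum ((- z i) ⊙ z) * sum (δ k)
          ≡⟨ cong₂ _+_ (cong₂ _+_ (zeroʳ-* (sum (U i)) (balanced k)) (cong₂ _*_ (sum-δ i) (sum-one q)))
               (cong₂ _*_ (trans (sum-⊙ (- z i) z) (cong (- z i *_) sum-z)) (sum-δ k)) ⟩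
        (0ℤ + 1ℤ * + q) + - z i * 1ℤ * 1ℤ ≡⟨ lemma (z i) (+ q) ⟩
        + q - z i ∎
        where
        open ≡-Reasoning
        i = π₁ x
        k = π₂ x
        lemma : ∀ s q → (0ℤ + 1ℤ * q) + - s * 1ℤ * 1ℤ ≡ q - s
        lemma = solve-∀

      -- Transposition brings one factor ε from each copy of T, and ε² = 1. Thus the result is
      -- symmetric even if the core is skew.
      symm : ∀ x y → M x y ≡ M y x
      symm zero    zero    = refl
      symm zero    (suc y) = *-identityʳ (z (π₁ y))
      symm (suc x) zero    = sym (*-identityʳ (z (π₁ x)))
      symm (suc x) (suc y) = entry (z (π₁ x)) (z (π₁ y)) (symmetric (π₁ x) (π₁ y)) (symmetric (π₂ x) (π₂ y)) (δ-sym (π₁ x) (π₁ y)) (δ-sym (π₂ x) (π₂ y))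
        where
        lemma : ∀ ε s t a b d d′ → s * a * t * b + d * 1ℤ + - s * t * d′ ≡ (ε * ε) * (s * a * t * b) + d * 1ℤ + - s * t * d′ →
                s * a * t * b + d * 1ℤ + - s * t * d′ ≡ t * (ε * a) * s * (ε * b) + d * 1ℤ + - t * s * d′
        lemma ε s t a b d d′ eq = trans eq (rearrange ε s t a b d d′)
          where
          rearrange : ∀ ε s t a b d d′ → (ε * ε) * (s * a * t * b) + d * 1ℤ + - s * t * d′ ≡
                      t * (ε * a) * s * (ε * b) + d * 1ℤ + - t * s * d′
          rearrange = solve-∀
        entry : ∀ s t {a a′ b b′ d d′ e e′} → a′ ≡ ε * a → b′ ≡ ε * b → d ≡ d′ → e ≡ e′ →
                s * a * t * b + d * 1ℤ + - s * t * e ≡ t * a′ * s * b′ + d′ * 1ℤ + - t * s * e′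
        entry s t {a} {_} {b} {_} {d} {_} {e} refl refl refl refl = lemma ε s t a b d e
          (cong (λ u → u + d * 1ℤ + - s * t * e) (sym (trans (cong (_* (s * a * t * b)) (IsSign-square ε-sign)) (*-identityˡ _))))

      diag : ∀ x → M x x ≡ 0ℤ
      diag zero    = refl
      diag (suc x) = entry (T (π₂ x) (π₂ x)) (z-sign (π₁ x)) (diagonal (π₁ x)) (δ-refl (π₁ x)) (δ-refl (π₂ x))
        where
        entry : ∀ {s a} b {d e} → IsSign s → a ≡ 0ℤ → d ≡ 1ℤ → e ≡ 1ℤ → s * a * s * b + d * 1ℤ + - s * s * e ≡ 0ℤ
        entry b (inj₁ refl) refl refl refl = lemma b
          where
          lemma : ∀ b → 1ℤ * 0ℤ * 1ℤ * b + 1ℤ * 1ℤ + - 1ℤ * 1ℤ * 1ℤ ≡ 0ℤ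
          lemma = solve-∀
        entry b (inj₂ refl) refl refl refl = lemma b
          where
          lemma : ∀ b → -1ℤ * 0ℤ * -1ℤ * b + 1ℤ * 1ℤ + - -1ℤ * -1ℤ * 1ℤ ≡ 0ℤ
          lemma = solve-∀

      -- Off the diagonal exactly one of the three terms is nonzero: I ⊗ J if the first coordinates
      -- agree, J ⊗ I if the second agree, T ⊗ T if neither does.
      off-diag : ∀ x y → x ≢ y → IsSign (M x y)
      off-diag zero    zero    0≢0 = ⊥-elim (0≢0 refl)
      off-diag zero    (suc y) _   = subst IsSign (sym (*-identityʳ (z (π₁ y)))) (z-sign (π₁ y))
      off-diag (suc x) zero    _   = z-sign (π₁ x)
      off-diag (suc x) (suc y) x≢y with π₁ x Fin.≟ π₁ y | π₂ x Fin.≟ π₂ y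
      ... | yes p | yes r = ⊥-elim (x≢y (cong suc (trans (sym (combine-remQuot {q} q x)) (trans (cong₂ combine p r) (combine-remQuot {q} q y)))))
      ... | yes p | no r  = same (z (π₁ x)) (z (π₁ y)) (T (π₂ x) (π₂ y)) (subst (λ j → T (π₁ x) j ≡ 0ℤ) p (diagonal (π₁ x))) (subst (λ j → δ (π₁ x) j ≡ 1ℤ) p (δ-refl (π₁ x))) (δ-≢ r)
        where
        same : ∀ s t {a} b {d e} → a ≡ 0ℤ → d ≡ 1ℤ → e ≡ 0ℤ → IsSign (s * a * t * b + d * 1ℤ + - s * t * e)
        same s t b refl refl refl = inj₁ (lemma s t b)
          where
          lemma : ∀ s t b → s * 0ℤ * t * b + 1ℤ * 1ℤ + - s * t * 0ℤ ≡ 1ℤ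
          lemma = solve-∀
      ... | no p  | yes r = same (T (π₁ x) (π₁ y)) (z-sign (π₁ x)) (z-sign (π₁ y)) (subst (λ j → T (π₂ x) j ≡ 0ℤ) r (diagonal (π₂ x))) (subst (λ j → δ (π₂ x) j ≡ 1ℤ) r (δ-refl (π₂ x))) (δ-≢ p)
        where
        same : ∀ {s t} a {b d e} → IsSign s → IsSign t → b ≡ 0ℤ → e ≡ 1ℤ → d ≡ 0ℤ → IsSign (s * a * t * b + d * 1ℤ + - s * t * e)
        same {s} {t} a sg tg refl refl refl = subst IsSign (lemma s t a) (IsSign-neg (IsSign-* sg tg))
          where
          lemma : ∀ s t a → - (s * t) ≡ s * a * t * 0ℤ + 0ℤ * 1ℤ + - s * t * 1ℤ
          lemma = solve-∀
      ... | no p  | no r  = generic (z-sign (π₁ x)) (z-sign (π₁ y)) (off p) (off r) (δ-≢ p) (δ-≢ r)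
        where
        generic : ∀ {s t a b d e} → IsSign s → IsSign t → IsSign a → IsSign b → d ≡ 0ℤ → e ≡ 0ℤ → IsSign (s * a * t * b + d * 1ℤ + - s * t * e)
        generic {s} {t} {a} {b} sg tg ag bg refl refl = subst IsSign (lemma s t a b) (IsSign-* (IsSign-* (IsSign-* sg ag) tg) bg)
          where
          lemma : ∀ s t a b → s * a * t * b ≡ s * a * t * b + 0ℤ * 1ℤ + - s * t * 0ℤ
          lemma = solve-∀

      orth : ∀ x y → M x ∙ M y ≡ + q * + q * δ x y
      orth zero zero = trans (cong (λ s → 0ℤ + s) (trans (⊗-∙-⊗ z z 𝟙 𝟙) (cong₂ _*_ z∙z 𝟙∙𝟙))) (lemma (+ q * + q))
        where
        lemma : ∀ p → 0ℤ + p ≡ p * 1ℤ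
        lemma = solve-∀
      orth zero (suc y) = trans (cong (λ s → 0ℤ * z (π₁ y) + s) (z⊗𝟙∙S y)) (lemma (z (π₁ y)) (+ q * + q))
        where
        lemma : ∀ s p → 0ℤ * s + 0ℤ ≡ p * 0ℤ
        lemma = solve-∀
      orth (suc x) zero = trans (∙-comm (M (suc x)) (M zero)) (orth zero (suc x))
      orth (suc x) (suc y) = trans (cong (λ s → z (π₁ x) * z (π₁ y) + s) (S∙S x y)) (lemma (z (π₁ x) * z (π₁ y)) (+ q * + q * δ x y))
        where
        lemma : ∀ s p → s + (p - s) ≡ p
        lemma = solve-∀

      reg : ∀ x → sum (M x) ≡ + q
      reg zero    = trans (cong (λ s → 0ℤ + s) (trans (sum-⊗ z (𝟙)) (cong₂ _*_ sum-z (sum-one q)))) (lemma (+ q))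
        where
        lemma : ∀ p → 0ℤ + 1ℤ * p ≡ p
        lemma = solve-∀
      reg (suc x) = trans (cong (λ s → z (π₁ x) + s) (sum-S x)) (lemma (z (π₁ x)) (+ q))
        where
        lemma : ∀ s p → s + (p - s) ≡ p
        lemma = solve-∀

    core⇒conference : RegularConference q (suc N)
    core⇒conference = record
      { M = M ; symmetric = symm ; diagonal = diag ; off = λ {i} {j} → off-diag i j ; orthogonal = orth ; regular = reg }

-- Paley's core of odd prime order, by counting square roots

module Paley where

  open Sums
  open Turyn using (Core)
  import Data.Nat as ℕ
  import Data.Nat.Properties as ℕ
  import Data.Nat.Divisibility as ℕ
  open import Data.Nat using (ℕ; zero; suc)
  open import Data.Nat.Primality using (Prime; euclidsLemma; prime⇒nonZero; prime⇒nonTrivial)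
  open import Data.Nat.Coprimality using (prime⇒coprime; coprime-Bézout)
  open import Data.Nat.GCD using (module Bézout)
  open import Data.Integer hiding (suc; pred; _⊔_; _≟_; _⊖_; NonZero) renaming (∣_∣ to abs)
  open import Data.Integer.Properties using (*-identityˡ; *-identityʳ; *-zeroʳ; *-comm; +-identityˡ; +-identityʳ; +-mono-≤; +-monoʳ-≤; abs-*; pos-*; ≤-refl; ≤-antisym; ≤-trans; ≤-reflexive; m-n≡m⊖n; ⊖-≥)
  open import Data.Integer.DivMod using (_%ℕ_; _/ℕ_; n%ℕd<d; a≡a%ℕn+[a/ℕn]*n)
  open import Data.Integer.Divisibility.Signed using (_∣_; divides; _∣?_; ∣⇒∣ᵤ; ∣ᵤ⇒∣; ∣m∣n⇒∣m+n; ∣n⇒∣m*n; ∣-refl)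
  open import Data.Integer.Tactic.RingSolver using (solve-∀)
  open import Data.Fin as Fin using (Fin; zero; suc; toℕ; fromℕ<)
  open import Data.Fin.Properties using (any?; toℕ<n; toℕ-fromℕ<; toℕ-injective)
  open import Data.Product using (Σ-syntax; ∃-syntax; _×_; _,_; proj₁; proj₂)
  open import Data.Sum using (_⊎_; inj₁; inj₂)
  open import Data.Empty using (⊥; ⊥-elim)
  open import Function using (_∘_)
  open import Relation.Nullary using (¬_; Dec; yes; no)
  open import Relation.Binary.Definitions using (tri<; tri≈; tri>)
  open import Relation.Binary.PropositionalEquality hiding ([_])

  ⟨_⟩ : ∀ {n} → Fin n → ℤ
  ⟨ i ⟩ = + toℕ i

  sum-shift-one : ∀ n (f : ℤ → ℤ) → ∑[ i < n ] f (⟨ i ⟩ + 1ℤ) + f 0ℤ ≡ ∑[ i < n ] f ⟨ i ⟩ + f (+ n)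
  sum-shift-one zero    f = refl
  sum-shift-one (suc n) f = begin
    f 1ℤ + ∑[ i < n ] f (1ℤ + (⟨ i ⟩ + 1ℤ)) + f 0ℤ   ≡⟨ lemma (f 1ℤ) _ (f 0ℤ) ⟩
    ∑[ i < n ] f (1ℤ + (⟨ i ⟩ + 1ℤ)) + f 1ℤ + f 0ℤ   ≡⟨ cong (_+ f 0ℤ) (sum-shift-one n (λ x → f (1ℤ + x))) ⟩
    ∑[ i < n ] f (1ℤ + ⟨ i ⟩) + f (1ℤ + + n) + f 0ℤ  ≡⟨ lemma′ _ (f (1ℤ + + n)) (f 0ℤ) ⟩
    f 0ℤ + ∑[ i < n ] f (1ℤ + ⟨ i ⟩) + f (+ suc n)   ∎
    where
    open ≡-Reasoning
    lemma : ∀ a b c → a + b + c ≡ b + a + c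
    lemma = solve-∀
    lemma′ : ∀ a b c → a + b + c ≡ c + a + b
    lemma′ = solve-∀

  sum-nonneg : ∀ {n} (f : Row n) → (∀ i → 0ℤ ≤ f i) → 0ℤ ≤ sum f
  sum-nonneg {zero}  f f≥0 = ≤-refl
  sum-nonneg {suc n} f f≥0 = +-mono-≤ (f≥0 zero) (sum-nonneg (f ∘ suc) (f≥0 ∘ suc))

  nonneg-sum≡0 : ∀ {n} (f : Row n) → (∀ i → 0ℤ ≤ f i) → sum f ≡ 0ℤ → ∀ i → f i ≡ 0ℤ
  nonneg-sum≡0 {suc n} f f≥0 Σ≡0 = λ { zero → head≡0 ; (suc i) → nonneg-sum≡0 (f ∘ suc) (f≥0 ∘ suc) tail≡0 i }
    where
    head≡0 : f zero ≡ 0ℤ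
    head≡0 = ≤-antisym
      (≤-trans (≤-reflexive (sym (+-identityʳ (f zero)))) (≤-trans (+-monoʳ-≤ (f zero) (sum-nonneg (f ∘ suc) (f≥0 ∘ suc))) (≤-reflexive Σ≡0)))
      (f≥0 zero)
    tail≡0 : sum (f ∘ suc) ≡ 0ℤ
    tail≡0 = trans (sym (+-identityˡ (sum (f ∘ suc)))) (trans (cong (_+ sum (f ∘ suc)) (sym head≡0)) Σ≡0)

  module _ {p : ℕ} (p-prime : Prime p) (p-odd : ¬ 2 ℕ.∣ p) where
    private
      instance
        p-nonZero : ℕ.NonZero p
        p-nonZero = prime⇒nonZero p-prime

      P : ℤ
      P = + p

      -- The form in which congruences are proved throughout: an integer combination of known
      -- multiples of p, with the identity left to the ring solver.
      combine : ∀ {a b c} u v → P ∣ a → P ∣ b → c ≡ u * a + v * b → P ∣ c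
      combine u v p∣a p∣b refl = ∣m∣n⇒∣m+n (∣n⇒∣m*n u p∣a) (∣n⇒∣m*n v p∣b)

      multiple : ∀ {a c} u → P ∣ a → c ≡ u * a → P ∣ c
      multiple u p∣a refl = ∣n⇒∣m*n u p∣a

      euclid : ∀ x y → P ∣ x * y → P ∣ x ⊎ P ∣ y
      euclid x y p∣xy with euclidsLemma (abs x) (abs y) p-prime (subst (p ℕ.∣_) (abs-* x y) (∣⇒∣ᵤ p∣xy))
      ... | inj₁ d = inj₁ (∣ᵤ⇒∣ d)
      ... | inj₂ d = inj₂ (∣ᵤ⇒∣ d)

      small-∤ : ∀ {n} → 0 ℕ.< n → n ℕ.< p → ¬ P ∣ + n
      small-∤ {suc n} _ n<p p∣n = ℕ.<⇒≱ n<p (ℕ.∣⇒≤ (∣⇒∣ᵤ p∣n))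

      p∤1 : ¬ P ∣ 1ℤ
      p∤1 = small-∤ (ℕ.s≤s ℕ.z≤n) (ℕ.nonTrivial⇒n>1 p {{prime⇒nonTrivial p-prime}})

      p∤2 : ¬ P ∣ + 2
      p∤2 p∣2 with ℕ.m≤n⇒m<n∨m≡n (ℕ.∣⇒≤ (∣⇒∣ᵤ p∣2))
      ... | inj₂ refl = p-odd ℕ.∣-refl
      ... | inj₁ p<2  = ℕ.<⇒≱ (ℕ.nonTrivial⇒n>1 p {{prime⇒nonTrivial p-prime}}) (ℕ.≤-pred p<2)

      representative : ∀ x → Σ[ i ∈ Fin p ] P ∣ x - ⟨ i ⟩
      representative x = fromℕ< (n%ℕd<d x p) , divides (x /ℕ p) (begin
        x - ⟨ fromℕ< (n%ℕd<d x p) ⟩                    ≡⟨ cong (λ k → x - + k) (toℕ-fromℕ< (n%ℕd<d x p)) ⟩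
        x - + (x %ℕ p)                                 ≡⟨ cong (_- + (x %ℕ p)) (a≡a%ℕn+[a/ℕn]*n x p) ⟩
        + (x %ℕ p) + (x /ℕ p) * P - + (x %ℕ p)         ≡⟨ lemma (+ (x %ℕ p)) ((x /ℕ p) * P) ⟩
        (x /ℕ p) * P                                   ∎)
        where
        open ≡-Reasoning
        lemma : ∀ a b → a + b - a ≡ b
        lemma = solve-∀

      inverse : ∀ x → ¬ P ∣ x → ∃[ y ] P ∣ x * y - 1ℤ
      inverse x p∤x with representative x
      ... | i , p∣x-i = lift (toℕ i) refl (bézout (toℕ i) refl)
        where
        bézout : ∀ n → n ≡ toℕ i → ∃[ y ] P ∣ + n * y - 1ℤ
        bézout zero    eq = ⊥-elim (p∤x (multiple 1ℤ p∣x-i (trans (lemma x) (cong (λ k → 1ℤ * (x - + k)) eq))))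
          where
          lemma : ∀ x → x ≡ 1ℤ * (x - 0ℤ)
          lemma = solve-∀
        bézout (suc n) eq with coprime-Bézout (prime⇒coprime p-prime (subst (ℕ._< p) (sym eq) (toℕ<n i)))
        ... | Bézout.+- a b e = - + b , divides (- + a) (trans (lemma (+ suc n) (+ b))
                (trans (cong -_ (trans (cong (λ s → 1ℤ + s) (sym (pos-* b (suc n)))) (trans (cong +_ e) (pos-* a p)))) (lemma′ (+ a) P)))
          where
          lemma : ∀ n b → n * - b - 1ℤ ≡ - (1ℤ + b * n)
          lemma = solve-∀
          lemma′ : ∀ a p → - (a * p) ≡ - a * p
          lemma′ = solve-∀
        ... | Bézout.-+ a b e = + b , divides (+ a) (trans (cong (_- 1ℤ) (trans (*-comm (+ suc n) (+ b))
                (trans (sym (pos-* b (suc n))) (trans (cong +_ (sym e)) (cong (λ s → 1ℤ + s) (pos-* a p)))))) (lemma (+ a * P)))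
          where
          lemma : ∀ q → 1ℤ + q - 1ℤ ≡ q
          lemma = solve-∀
        lift : ∀ n → n ≡ toℕ i → ∃[ y ] P ∣ + n * y - 1ℤ → ∃[ y ] P ∣ x * y - 1ℤ
        lift n refl (y , p∣ny-1) = y , combine 1ℤ y p∣ny-1 p∣x-i (lemma x (+ n) y)
          where
          lemma : ∀ x n y → x * y - 1ℤ ≡ 1ℤ * (n * y - 1ℤ) + y * (x - n)
          lemma = solve-∀

      -- Functions on ℤ/p are kept as periodic functions on ℤ, so that all arithmetic takes place in
      -- ℤ.
      Periodic : (ℤ → ℤ) → Set
      Periodic f = ∀ {x y} → P ∣ x - y → f x ≡ f y

      -- Abstract, so that the summand can be recovered by unification.
      abstract
        Σₚ : (ℤ → ℤ) → ℤ
        Σₚ f = ∑[ i < p ] f ⟨ i ⟩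

        Σₚ-def : ∀ f → ∑[ i < p ] f ⟨ i ⟩ ≡ Σₚ f
        Σₚ-def f = refl

        Σₚ-cong : ∀ {f g} → (∀ x → f x ≡ g x) → Σₚ f ≡ Σₚ g
        Σₚ-cong f≗g = sum-cong-≗ {p} (λ i → f≗g ⟨ i ⟩)

        Σₚ-+ : ∀ f g → Σₚ (λ x → f x + g x) ≡ Σₚ f + Σₚ g
        Σₚ-+ f g = sum-+ {p} (λ i → f ⟨ i ⟩) (λ i → g ⟨ i ⟩)

        Σₚ-*ˡ : ∀ c f → Σₚ (λ x → c * f x) ≡ c * Σₚ f
        Σₚ-*ˡ c f = sum-⊙ {p} c (λ i → f ⟨ i ⟩)

        Σₚ-*ʳ : ∀ f c → Σₚ (λ x → f x * c) ≡ Σₚ f * c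
        Σₚ-*ʳ f c = sym (*-distribʳ-sum {p} c (λ i → f ⟨ i ⟩))

        Σₚ-const : ∀ c → Σₚ (λ _ → c) ≡ P * c
        Σₚ-const c = sum-const p c

        Σₚ-comm : ∀ (f : ℤ → ℤ → ℤ) → Σₚ (λ x → Σₚ (λ y → f x y)) ≡ Σₚ (λ y → Σₚ (λ x → f x y))
        Σₚ-comm f = ∑-comm {p} {p} (λ i j → f ⟨ i ⟩ ⟨ j ⟩)

        Σₚ-shift-one : ∀ f → Σₚ (λ x → f (x + 1ℤ)) + f 0ℤ ≡ Σₚ f + f P
        Σₚ-shift-one f = sum-shift-one p f

        Σₚ-nonneg≡0 : ∀ f → (∀ x → 0ℤ ≤ f x) → Σₚ f ≡ 0ℤ → ∀ (i : Fin p) → f ⟨ i ⟩ ≡ 0ℤ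
        Σₚ-nonneg≡0 f f≥0 = nonneg-sum≡0 (λ i → f ⟨ i ⟩) (λ i → f≥0 ⟨ i ⟩)

      Σₚ-0 : Σₚ (λ _ → 0ℤ) ≡ 0ℤ
      Σₚ-0 = trans (Σₚ-const 0ℤ) (*-zeroʳ P)

      Σₚ-1 : Σₚ (λ _ → 1ℤ) ≡ P
      Σₚ-1 = trans (Σₚ-const 1ℤ) (*-identityʳ P)

      shift-one : ∀ f → Periodic f → Σₚ (λ x → f (x + 1ℤ)) ≡ Σₚ f
      shift-one f per = cancel (f 0ℤ) (trans (Σₚ-shift-one f) (cong (λ s → Σₚ f + s) (per (divides 1ℤ (lemma P)))))
        where
        lemma : ∀ P → P - 0ℤ ≡ 1ℤ * P
        lemma = solve-∀
        cancelled : ∀ a c → a ≡ a + c - c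
        cancelled = solve-∀
        cancel : ∀ {a b} c → a + c ≡ b + c → a ≡ b
        cancel {a} {b} c e = trans (cancelled a c) (trans (cong (_- c) e) (sym (cancelled b c)))

      shiftℕ : ∀ f → Periodic f → ∀ k → Σₚ (λ x → f (x + + k)) ≡ Σₚ f
      shiftℕ f per zero    = Σₚ-cong (λ x → cong f (+-identityʳ x))
      shiftℕ f per (suc k) = trans (Σₚ-cong (λ x → cong f (lemma x (+ k))))
        (trans (shift-one (λ x → f (x + + k)) (λ {x} {y} d → per (subst (P ∣_) (lemma′ x y (+ k)) d))) (shiftℕ f per k))
        where
        lemma : ∀ x k → x + (1ℤ + k) ≡ x + 1ℤ + k
        lemma = solve-∀
        lemma′ : ∀ x y k → x - y ≡ (x + k) - (y + k)
        lemma′ = solve-∀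

      -- A shift by one trades the term at 0 for the term at p, which periodicity makes equal; an
      -- arbitrary shift is congruent to a repeated shift by one.
      shift : ∀ f → Periodic f → ∀ c → Σₚ (λ x → f (x + c)) ≡ Σₚ f
      shift f per c with representative c
      ... | i , d = trans (Σₚ-cong (λ x → per (subst (P ∣_) (lemma x c ⟨ i ⟩) d))) (shiftℕ f per (toℕ i))
        where
        lemma : ∀ x c k → c - k ≡ (x + c) - (x + k)
        lemma = solve-∀

      indicator : ∀ {A : Set} → Dec A → ℤ
      indicator (yes _) = 1ℤ
      indicator (no _)  = 0ℤ

      abstract
        [_] : ℤ → ℤ
        [ x ] = indicator (P ∣? x)

        []-yes : ∀ {x} → P ∣ x → [ x ] ≡ 1ℤ
        []-yes {x} d with P ∣? x
        ... | yes _ = refl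
        ... | no ¬d = ⊥-elim (¬d d)

        []-no : ∀ {x} → ¬ P ∣ x → [ x ] ≡ 0ℤ
        []-no {x} ¬d with P ∣? x
        ... | yes d = ⊥-elim (¬d d)
        ... | no _  = refl

      []-cong : ∀ {x y} → (P ∣ x → P ∣ y) → (P ∣ y → P ∣ x) → [ x ] ≡ [ y ]
      []-cong {x} {y} f g with P ∣? x
      ... | yes d = trans ([]-yes d) (sym ([]-yes (f d)))
      ... | no ¬d = trans ([]-no ¬d) (sym ([]-no (¬d ∘ g)))

      []-periodic : Periodic [_]
      []-periodic {x} {y} d = []-cong (λ e → combine 1ℤ -1ℤ e d (lemma x y)) (λ e → combine 1ℤ 1ℤ e d (lemma′ x y))
        where
        lemma : ∀ x y → y ≡ 1ℤ * x + -1ℤ * (x - y)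
        lemma = solve-∀
        lemma′ : ∀ x y → x ≡ 1ℤ * y + 1ℤ * (x - y)
        lemma′ = solve-∀

      []-neg : ∀ x → [ - x ] ≡ [ x ]
      []-neg x = []-cong (λ d → multiple -1ℤ d (lemma x)) (λ d → multiple -1ℤ d (lemma′ x))
        where
        lemma : ∀ x → x ≡ -1ℤ * - x
        lemma = solve-∀
        lemma′ : ∀ x → - x ≡ -1ℤ * x
        lemma′ = solve-∀

      Σ[] : Σₚ [_] ≡ 1ℤ
      Σ[] = trans (sym (Σₚ-def [_])) (go p refl)
        where
        go : ∀ n → n ≡ p → ∑[ i < n ] [ ⟨ i ⟩ ] ≡ 1ℤ
        go zero    eq = ⊥-elim (ℕ.<⇒≢ (ℕ.<-trans (ℕ.s≤s ℕ.z≤n) (ℕ.nonTrivial⇒n>1 p {{prime⇒nonTrivial p-prime}})) eq)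
        go (suc n) eq = cong₂ _+_ ([]-yes (divides 0ℤ refl))
          (trans (sum-cong-≗ {n} (λ i → []-no (small-∤ (ℕ.s≤s ℕ.z≤n) (subst (suc (toℕ i) ℕ.<_) eq (ℕ.s≤s (toℕ<n i))))))
                 (sum-zero n))

      Σ[+] : ∀ c → Σₚ (λ x → [ x + c ]) ≡ 1ℤ
      Σ[+] c = trans (shift [_] []-periodic c) Σ[]

      Σ-complement : Σₚ (λ u → 1ℤ + -1ℤ * [ u ]) ≡ P - 1ℤ
      Σ-complement = trans (Σₚ-+ (λ _ → 1ℤ) (λ u → -1ℤ * [ u ]))
        (cong₂ _+_ Σₚ-1 (trans (Σₚ-*ˡ -1ℤ [_]) (cong (-1ℤ *_) Σ[])))

      divisor-affine : ∀ {α α′} β x → P ∣ α * α′ - 1ℤ → P ∣ α * x + β → P ∣ x + α′ * β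
      divisor-affine {α} {α′} β x d e = combine α′ (- x) e d (lemma α α′ β x)
        where
        lemma : ∀ α α′ β x → x + α′ * β ≡ α′ * (α * x + β) + - x * (α * α′ - 1ℤ)
        lemma = solve-∀

      affine-divisor : ∀ {α α′} β x → P ∣ α * α′ - 1ℤ → P ∣ x + α′ * β → P ∣ α * x + β
      affine-divisor {α} {α′} β x d e = combine α (- β) e d (lemma α α′ β x)
        where
        lemma : ∀ α α′ β x → α * x + β ≡ α * (x + α′ * β) + - β * (α * α′ - 1ℤ)
        lemma = solve-∀

      Σ-affine : ∀ α β → ¬ P ∣ α → Σₚ (λ x → [ α * x + β ]) ≡ 1ℤ
      Σ-affine α β p∤α = by-inverse (inverse α p∤α)
        where
        by-inverse : ∃[ α′ ] P ∣ α * α′ - 1ℤ → Σₚ (λ x → [ α * x + β ]) ≡ 1ℤ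
        by-inverse (α′ , d) = trans
          (Σₚ-cong (λ x → []-cong {α * x + β} {x + α′ * β} (divisor-affine {α} {α′} β x d) (affine-divisor {α} {α′} β x d)))
          (Σ[+] (α′ * β))

      Σ-select : ∀ g → Periodic g → ∀ c → Σₚ (λ x → [ x - c ] * g x) ≡ g c
      Σ-select g per c = trans (Σₚ-cong pointwise)
        (trans (Σₚ-*ʳ (λ x → [ x - c ]) (g c))
               (trans (cong (_* g c) (Σ[+] (- c))) (*-identityˡ (g c))))
        where
        pointwise : ∀ x → [ x - c ] * g x ≡ [ x - c ] * g c
        pointwise x with P ∣? (x - c)
        ... | yes d = cong ([ x - c ] *_) (per d)
        ... | no ¬d = trans (zeroˡ-* (g x) ([]-no ¬d)) (sym (zeroˡ-* (g c) ([]-no ¬d)))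

      roots : ℤ → ℤ
      roots x = Σₚ (λ y → [ y * y - x ])

      -- The Legendre symbol. Defined through the number of square roots, it can be summed by
      -- counting solutions, without recourse to its multiplicativity.
      η : ℤ → ℤ
      η x = roots x - 1ℤ

      roots-periodic : Periodic roots
      roots-periodic {x} {x′} d = Σₚ-cong (λ y → []-periodic (multiple -1ℤ d (lemma y x x′)))
        where
        lemma : ∀ y x x′ → (y * y - x) - (y * y - x′) ≡ -1ℤ * (x - x′)
        lemma = solve-∀

      η-periodic : Periodic η
      η-periodic d = cong (_- 1ℤ) (roots-periodic d)

      square-∣ : ∀ {y} → P ∣ y * y → P ∣ y
      square-∣ {y} d with euclid y y d
      ... | inj₁ e = e
      ... | inj₂ e = e

      roots-zero : ∀ {x} → P ∣ x → roots x ≡ 1ℤ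
      roots-zero {x} p∣x = trans (Σₚ-cong (λ y → []-cong
          (λ d → square-∣ (combine 1ℤ 1ℤ d p∣x (lemma y x)))
          (λ d → combine y -1ℤ d p∣x (lemma′ y x)))) Σ[]
        where
        lemma : ∀ y x → y * y ≡ 1ℤ * (y * y - x) + 1ℤ * x
        lemma = solve-∀
        lemma′ : ∀ y x → y * y - x ≡ y * y + -1ℤ * x
        lemma′ = solve-∀

      divides-root : ∀ {x} r → ¬ P ∣ x → P ∣ r * r - x → ¬ P ∣ r
      divides-root {x} r p∤x d e = p∤x (combine r -1ℤ e d (lemma r x))
        where
        lemma : ∀ r x → x ≡ r * r + -1ℤ * (r * r - x)
        lemma = solve-∀

      -- Modulo p, y² - x factors as (y - r) (y + r). No y is a zero of both factors, since p
      -- divides neither 2 nor r.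
      roots-square : ∀ {x} r → ¬ P ∣ x → P ∣ r * r - x → roots x ≡ + 2
      roots-square {x} r p∤x d = trans (Σₚ-cong split)
        (trans (Σₚ-+ (λ y → [ y - r ]) (λ y → [ y + r ])) (cong₂ _+_ (Σ[+] (- r)) (Σ[+] r)))
        where
        p∤r : ¬ P ∣ r
        p∤r = divides-root r p∤x d
        both : ∀ y → P ∣ y - r → P ∣ y + r → ⊥
        both y e f with euclid (+ 2) r (combine 1ℤ -1ℤ f e (lemma y r))
          where
          lemma : ∀ y r → + 2 * r ≡ 1ℤ * (y + r) + -1ℤ * (y - r)
          lemma = solve-∀
        ... | inj₁ g = p∤2 g
        ... | inj₂ g = p∤r g
        split : ∀ y → [ y * y - x ] ≡ [ y - r ] + [ y + r ]
        split y with P ∣? (y - r) | P ∣? (y + r)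
        ... | yes e | yes f = ⊥-elim (both y e f)
        ... | yes e | no ¬f = trans ([]-yes (combine (y + r) 1ℤ e d (lemma y r x))) (sym (cong₂ _+_ ([]-yes e) ([]-no ¬f)))
          where
          lemma : ∀ y r x → y * y - x ≡ (y + r) * (y - r) + 1ℤ * (r * r - x)
          lemma = solve-∀
        ... | no ¬e | yes f = trans ([]-yes (combine (y - r) 1ℤ f d (lemma y r x))) (sym (cong₂ _+_ ([]-no ¬e) ([]-yes f)))
          where
          lemma : ∀ y r x → y * y - x ≡ (y - r) * (y + r) + 1ℤ * (r * r - x)
          lemma = solve-∀
        ... | no ¬e | no ¬f = trans ([]-no λ g → neither (euclid (y - r) (y + r) (combine 1ℤ -1ℤ g d (lemma y r x))))
            (sym (cong₂ _+_ ([]-no ¬e) ([]-no ¬f)))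
          where
          lemma : ∀ y r x → (y - r) * (y + r) ≡ 1ℤ * (y * y - x) + -1ℤ * (r * r - x)
          lemma = solve-∀
          neither : P ∣ y - r ⊎ P ∣ y + r → ⊥
          neither (inj₁ e) = ¬e e
          neither (inj₂ f) = ¬f f

      data Class (x : ℤ) : Set where
        zero-class    : P ∣ x → roots x ≡ 1ℤ → Class x
        square-class  : ¬ P ∣ x → ∀ r → P ∣ r * r - x → roots x ≡ + 2 → Class x
        nonsquare     : ¬ P ∣ x → roots x ≡ 0ℤ → Class x

      classify : ∀ x → Class x
      classify x with P ∣? x
      ... | yes d = zero-class d (roots-zero d)
      ... | no p∤x with any? (λ (i : Fin p) → P ∣? (⟨ i ⟩ * ⟨ i ⟩ - x))
      ... | yes (i , d) = square-class p∤x ⟨ i ⟩ d (roots-square ⟨ i ⟩ p∤x d)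
      ... | no ∄ = nonsquare p∤x (trans (sym (Σₚ-def (λ y → [ y * y - x ]))) (trans (sum-cong-≗ {p} (λ i → []-no (λ d → ∄ (i , d)))) (sum-zero p)))

      -- After exchanging the sums: every y is a square root of exactly one residue.
      Σ-roots : Σₚ roots ≡ P
      Σ-roots = trans (Σₚ-comm (λ x y → [ y * y - x ]))
        (trans (Σₚ-cong (λ y → trans (Σₚ-cong (λ x → trans (sym ([]-neg (y * y - x))) (cong [_] (lemma y x)))) (Σ[+] (- (y * y)))))
               Σₚ-1)
        where
        lemma : ∀ y x → - (y * y - x) ≡ x + - (y * y)
        lemma = solve-∀

      Ση : Σₚ η ≡ 0ℤ
      Ση = trans (Σₚ-+ roots (λ _ → -1ℤ)) (trans (cong₂ _+_ Σ-roots (Σₚ-const -1ℤ)) (lemma P))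
        where
        lemma : ∀ P → P + P * -1ℤ ≡ 0ℤ
        lemma = solve-∀

      -- Both sides count the solutions of z² - y² = c; with z = y + u the equation
      -- is linear in y.
      Σ-roots-roots : ∀ c → ¬ P ∣ c → Σₚ (λ x → roots x * roots (x + c)) ≡ P - 1ℤ
      Σ-roots-roots c p∤c = begin
        Σₚ (λ x → roots x * roots (x + c))
          ≡⟨ Σₚ-cong (λ x → sym (Σₚ-*ʳ (λ y → [ y * y - x ]) (roots (x + c)))) ⟩
        Σₚ (λ x → Σₚ (λ y → [ y * y - x ] * roots (x + c)))
          ≡⟨ Σₚ-comm (λ x y → [ y * y - x ] * roots (x + c)) ⟩
        Σₚ (λ y → Σₚ (λ x → [ y * y - x ] * roots (x + c)))
          ≡⟨ Σₚ-cong (λ y → trans (Σₚ-cong (λ x → cong (_* roots (x + c)) (trans (sym ([]-neg (y * y - x))) (cong [_] (lemma₁ y x)))))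
               (Σ-select (λ x → roots (x + c)) (λ {x} {x′} d → roots-periodic (subst (P ∣_) (lemma₂ x x′ c) d)) (y * y))) ⟩
        Σₚ (λ y → roots (y * y + c))
          ≡⟨ Σₚ-cong (λ y → sym (shift (λ z → [ z * z - (y * y + c) ]) (λ {z} {z′} d → []-periodic (multiple (z + z′) d (lemma₃ z z′ (y * y + c)))) y)) ⟩
        Σₚ (λ y → Σₚ (λ u → [ (u + y) * (u + y) - (y * y + c) ]))
          ≡⟨ Σₚ-comm (λ y u → [ (u + y) * (u + y) - (y * y + c) ]) ⟩
        Σₚ (λ u → Σₚ (λ y → [ (u + y) * (u + y) - (y * y + c) ]))
          ≡⟨ Σₚ-cong (λ u → trans (Σₚ-cong (λ y → cong [_] (lemma₄ u y c))) (linear u)) ⟩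
        Σₚ (λ u → 1ℤ + -1ℤ * [ u ])
          ≡⟨ Σ-complement ⟩
        P - 1ℤ ∎
        where
        open ≡-Reasoning
        lemma₁ : ∀ y x → - (y * y - x) ≡ x - y * y
        lemma₁ = solve-∀
        lemma₂ : ∀ x x′ c → x - x′ ≡ (x + c) - (x′ + c)
        lemma₂ = solve-∀
        lemma₃ : ∀ z z′ k → (z * z - k) - (z′ * z′ - k) ≡ (z + z′) * (z - z′)
        lemma₃ = solve-∀
        lemma₄ : ∀ u y c → (u + y) * (u + y) - (y * y + c) ≡ + 2 * u * y + (u * u - c)
        lemma₄ = solve-∀
        -- The slope 2 u is invertible unless p divides u, and then only the nonzero constant - c is
        -- left.
        linear : ∀ u → Σₚ (λ y → [ + 2 * u * y + (u * u - c) ]) ≡ 1ℤ + -1ℤ * [ u ]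
        linear u with P ∣? u
        ... | yes d = trans (Σₚ-cong (λ y → []-no (λ e → p∤c (combine (+ 2 * y + u) -1ℤ d e (lemma u y c))))) (trans Σₚ-0 (sym (cong (λ s → 1ℤ + -1ℤ * s) ([]-yes d))))
          where
          lemma : ∀ u y c → c ≡ (+ 2 * y + u) * u + -1ℤ * (+ 2 * u * y + (u * u - c))
          lemma = solve-∀
        ... | no p∤u = trans (Σ-affine (+ 2 * u) (u * u - c) p∤2u) (sym (cong (λ s → 1ℤ + -1ℤ * s) ([]-no p∤u)))
          where
          p∤2u : ¬ P ∣ + 2 * u
          p∤2u d with euclid (+ 2) u d
          ... | inj₁ e = p∤2 e
          ... | inj₂ e = p∤u e

      -- Expanding roots - 1 in the product, the three sums are p - 1, - p and 0.
      Σ-ηη : ∀ c → ¬ P ∣ c → Σₚ (λ x → η x * η (x + c)) ≡ -1ℤ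
      Σ-ηη c p∤c = begin
        Σₚ (λ x → η x * η (x + c))
          ≡⟨ Σₚ-cong (λ x → lemma (roots x) (roots (x + c))) ⟩
        Σₚ (λ x → roots x * roots (x + c) + -1ℤ * (roots x + η (x + c)))
          ≡⟨ Σₚ-+ (λ x → roots x * roots (x + c)) (λ x → -1ℤ * (roots x + η (x + c))) ⟩
        Σₚ (λ x → roots x * roots (x + c)) + Σₚ (λ x → -1ℤ * (roots x + η (x + c)))
          ≡⟨ cong₂ _+_ (Σ-roots-roots c p∤c) (Σₚ-*ˡ -1ℤ (λ x → roots x + η (x + c))) ⟩
        P - 1ℤ + -1ℤ * Σₚ (λ x → roots x + η (x + c))
          ≡⟨ cong (λ s → P - 1ℤ + -1ℤ * s) (trans (Σₚ-+ roots (λ x → η (x + c)))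
               (cong₂ _+_ Σ-roots (trans (shift η η-periodic c) Ση))) ⟩
        P - 1ℤ + -1ℤ * (P + 0ℤ)
          ≡⟨ lemma′ P ⟩
        -1ℤ ∎
        where
        open ≡-Reasoning
        lemma : ∀ a b → (a - 1ℤ) * (b - 1ℤ) ≡ a * b + -1ℤ * (a + (b - 1ℤ))
        lemma = solve-∀
        lemma′ : ∀ P → P - 1ℤ + -1ℤ * (P + 0ℤ) ≡ -1ℤ
        lemma′ = solve-∀

      η-zero : ∀ {x} → P ∣ x → η x ≡ 0ℤ
      η-zero d = cong (_- 1ℤ) (roots-zero d)

      η-sign : ∀ {x} → ¬ P ∣ x → IsSign (η x)
      η-sign {x} p∤x with classify x
      ... | zero-class d _         = ⊥-elim (p∤x d)
      ... | square-class _ _ _ eq  = inj₁ (cong (_- 1ℤ) eq)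
      ... | nonsquare _ eq         = inj₂ (cong (_- 1ℤ) eq)

      Σ-η² : Σₚ (λ x → η x * η x) ≡ P - 1ℤ
      Σ-η² = trans (Σₚ-cong pointwise) Σ-complement
        where
        pointwise : ∀ x → η x * η x ≡ 1ℤ + -1ℤ * [ x ]
        pointwise x with P ∣? x
        ... | yes d  = trans (cong₂ _*_ (η-zero d) (η-zero d)) (sym (cong (λ s → 1ℤ + -1ℤ * s) ([]-yes d)))
        ... | no p∤x = trans (IsSign-square (η-sign p∤x)) (sym (cong (λ s → 1ℤ + -1ℤ * s) ([]-no p∤x)))

      ∤-neg : ∀ {x} → ¬ P ∣ x → ¬ P ∣ - x
      ∤-neg {x} p∤x d = p∤x (multiple -1ℤ d (lemma x))
        where
        lemma : ∀ x → x ≡ -1ℤ * - x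
        lemma = solve-∀

      ∣-neg : ∀ {x} → P ∣ x → P ∣ - x
      ∣-neg {x} d = multiple -1ℤ d (lemma x)
        where
        lemma : ∀ x → - x ≡ -1ℤ * x
        lemma = solve-∀

      module _ (s : ℤ) (s²+1 : P ∣ s * s - -1ℤ) where
        rotate : ∀ {x} r → P ∣ r * r - x → P ∣ s * r * (s * r) - - x
        rotate {x} r d = combine (r * r) -1ℤ s²+1 d (lemma s r x)
          where
          lemma : ∀ s r x → s * r * (s * r) - - x ≡ r * r * (s * s - -1ℤ) + -1ℤ * (r * r - x)
          lemma = solve-∀

        rotate⁻¹ : ∀ {x} r → P ∣ r * r - - x → P ∣ s * r * (s * r) - x
        rotate⁻¹ {x} r d = combine (r * r) -1ℤ s²+1 d (lemma s r x)
          where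
          lemma : ∀ s r x → s * r * (s * r) - x ≡ r * r * (s * s - -1ℤ) + -1ℤ * (r * r - - x)
          lemma = solve-∀

        -- Multiplication by `s`, a square root of -1, carries a square root of x to one of - x and
        -- back.
        roots-even : ∀ x → Class x → Class (- x) → roots (- x) ≡ roots x
        roots-even x (zero-class _ eq)        (zero-class _ eq′)         = trans eq′ (sym eq)
        roots-even x (zero-class d _)         (square-class p∤ _ _ _)    = ⊥-elim (p∤ (∣-neg d))
        roots-even x (zero-class d _)         (nonsquare p∤ _)           = ⊥-elim (p∤ (∣-neg d))
        roots-even x (square-class p∤ _ _ _)  (zero-class d _)           = ⊥-elim (∤-neg p∤ d)
        roots-even x (nonsquare p∤ _)         (zero-class d _)           = ⊥-elim (∤-neg p∤ d)
        roots-even x (square-class _ _ _ eq)  (square-class _ _ _ eq′)   = trans eq′ (sym eq)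
        roots-even x (nonsquare _ eq)         (nonsquare _ eq′)          = trans eq′ (sym eq)
        roots-even x (square-class p∤ r d eq) (nonsquare p∤′ eq′)        = trans (roots-square (s * r) p∤′ (rotate r d)) (sym eq)
        roots-even x (nonsquare p∤ eq)        (square-class p∤′ r d eq′) = trans eq′ (sym (roots-square (s * r) p∤ (rotate⁻¹ r d)))

      -- With `r′` inverse to `r`, the quotient t / r of a root of - x by a root of x is a square
      -- root of -1.
      square-ratio : ∀ {x} r r′ t → P ∣ r * r′ - 1ℤ → P ∣ r * r - x → P ∣ t * t - - x → P ∣ t * r′ * (t * r′) - -1ℤ
      square-ratio {x} r r′ t f d e = combine (r′ * r′) 1ℤ e (combine (r′ * r′) (- (r * r′ + 1ℤ)) d f refl) (lemma r r′ t x)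
        where
        lemma : ∀ r r′ t x → t * r′ * (t * r′) - -1ℤ ≡
                r′ * r′ * (t * t - - x) + 1ℤ * (r′ * r′ * (r * r - x) + - (r * r′ + 1ℤ) * (r * r′ - 1ℤ))
        lemma = solve-∀

      -- If -1 is not a square, then at most one of x and -x is, and counting shows
      -- that exactly one is.
      module _ (p∤-1 : ¬ P ∣ -1ℤ) (no-root : roots -1ℤ ≡ 0ℤ) where
        deficit : ℤ → ℤ
        deficit x = + 2 + -1ℤ * (roots x + roots (- x))

        0≢2 : 0ℤ ≢ + 2
        0≢2 ()

        both-square : ∀ {x} r t → ∃[ r′ ] P ∣ r * r′ - 1ℤ → P ∣ r * r - x → P ∣ t * t - - x → ⊥
        both-square r t (r′ , f) d e = 0≢2 (trans (sym no-root) (roots-square (t * r′) p∤-1 (square-ratio r r′ t f d e)))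

        deficit-value : ∀ {x a b} → roots x ≡ a → roots (- x) ≡ b → 0ℤ ≤ + 2 + -1ℤ * (a + b) → 0ℤ ≤ deficit x
        deficit-value eq eq′ = subst (0ℤ ≤_) (sym (cong₂ (λ a b → + 2 + -1ℤ * (a + b)) eq eq′))

        deficit≥0 : ∀ x → Class x → Class (- x) → 0ℤ ≤ deficit x
        deficit≥0 x (zero-class _ eq)        (zero-class _ eq′)        = deficit-value eq eq′ (+≤+ ℕ.z≤n)
        deficit≥0 x (zero-class d _)         (square-class p∤ _ _ _)   = ⊥-elim (p∤ (∣-neg d))
        deficit≥0 x (zero-class d _)         (nonsquare p∤ _)          = ⊥-elim (p∤ (∣-neg d))
        deficit≥0 x (square-class p∤ _ _ _)  (zero-class d _)          = ⊥-elim (∤-neg p∤ d)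
        deficit≥0 x (nonsquare p∤ _)         (zero-class d _)          = ⊥-elim (∤-neg p∤ d)
        deficit≥0 x (square-class p∤ r d _)  (square-class _ t e _)    = ⊥-elim (both-square r t (inverse r (divides-root r p∤ d)) d e)
        deficit≥0 x (nonsquare _ eq)         (nonsquare _ eq′)         = deficit-value eq eq′ (+≤+ ℕ.z≤n)
        deficit≥0 x (square-class _ _ _ eq)  (nonsquare _ eq′)         = deficit-value eq eq′ (+≤+ ℕ.z≤n)
        deficit≥0 x (nonsquare _ eq)         (square-class _ _ _ eq′)  = deficit-value eq eq′ (+≤+ ℕ.z≤n)

        Σ-roots-neg : Σₚ (λ x → roots (- x)) ≡ P
        Σ-roots-neg = trans (Σₚ-comm (λ x y → [ y * y - - x ]))
          (trans (Σₚ-cong (λ y → trans (Σₚ-cong (λ x → cong [_] (lemma y x))) (Σ[+] (y * y)))) Σₚ-1)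
          where
          lemma : ∀ y x → y * y - - x ≡ x + y * y
          lemma = solve-∀

        Σ-deficit : Σₚ deficit ≡ 0ℤ
        Σ-deficit = trans (Σₚ-+ (λ _ → + 2) (λ x → -1ℤ * (roots x + roots (- x))))
          (trans (cong₂ _+_ (Σₚ-const (+ 2)) (trans (Σₚ-*ˡ -1ℤ (λ x → roots x + roots (- x)))
            (cong (-1ℤ *_) (trans (Σₚ-+ roots (λ x → roots (- x))) (cong₂ _+_ Σ-roots Σ-roots-neg)))))
            (lemma P))
          where
          lemma : ∀ P → P * + 2 + -1ℤ * (P + P) ≡ 0ℤ
          lemma = solve-∀

        -- Nonnegative terms with sum zero all vanish. This concerns the residues below p, and the
        -- representative of x extends it to all integers.
        deficit≡0 : ∀ x → Σ[ i ∈ Fin p ] P ∣ x - ⟨ i ⟩ → deficit x ≡ 0ℤ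
        deficit≡0 x (i , d) = trans (cong₂ (λ a b → + 2 + -1ℤ * (a + b)) (roots-periodic d)
                                      (roots-periodic (multiple -1ℤ d (lemma x ⟨ i ⟩))))
                                    (Σₚ-nonneg≡0 deficit (λ y → deficit≥0 y (classify y) (classify (- y))) Σ-deficit i)
          where
          lemma : ∀ x k → - x - - k ≡ -1ℤ * (x - k)
          lemma = solve-∀

        η-odd : ∀ x → η (- x) ≡ -1ℤ * η x
        η-odd x = trans (lemma (roots x) (roots (- x)))
          (trans (cong (λ s → -1ℤ * η x + -1ℤ * s) (deficit≡0 x (representative x))) (lemma′ (-1ℤ * η x)))
          where
          lemma : ∀ a b → b - 1ℤ ≡ -1ℤ * (a - 1ℤ) + -1ℤ * (+ 2 + -1ℤ * (a + b))
          lemma = solve-∀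
          lemma′ : ∀ a → a + -1ℤ * 0ℤ ≡ a
          lemma′ = solve-∀

      -- The sign is the Legendre symbol of -1 and decides whether the core is symmetric or skew.
      parity : Class -1ℤ → ∃[ ε ] IsSign ε × ∀ x → η (- x) ≡ ε * η x
      parity (zero-class d _)          = ⊥-elim (∤-neg p∤1 d)
      parity (square-class _ s s²+1 _) = 1ℤ , inj₁ refl ,
        λ x → trans (cong (_- 1ℤ) (roots-even s s²+1 x (classify x) (classify (- x)))) (sym (*-identityˡ (η x)))
      parity (nonsquare p∤-1 no-root)  = -1ℤ , inj₂ refl , η-odd p∤-1 no-root

      gap : ∀ (i j : Fin p) → toℕ i ℕ.< toℕ j → ¬ P ∣ ⟨ j ⟩ - ⟨ i ⟩
      gap i j i<j d = small-∤ (ℕ.m<n⇒0<n∸m i<j) (ℕ.≤-<-trans (ℕ.m∸n≤m (toℕ j) (toℕ i)) (toℕ<n j))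
        (subst (P ∣_) (trans (m-n≡m⊖n (toℕ j) (toℕ i)) (⊖-≥ (ℕ.<⇒≤ i<j))) d)

      difference-∤ : ∀ {i j : Fin p} → i ≢ j → ¬ P ∣ ⟨ i ⟩ - ⟨ j ⟩
      difference-∤ {i} {j} i≢j d with ℕ.<-cmp (toℕ i) (toℕ j)
      ... | tri< i<j _ _ = gap i j i<j (multiple -1ℤ d (lemma ⟨ i ⟩ ⟨ j ⟩))
        where
        lemma : ∀ a b → b - a ≡ -1ℤ * (a - b)
        lemma = solve-∀
      ... | tri≈ _ e _   = i≢j (toℕ-injective e)
      ... | tri> _ _ j<i = gap j i j<i d

    -- The Jacobsthal matrix. Its rows are translates of η, so inner products are autocorrelations:
    -- `Σ-η²` on the diagonal and `Σ-ηη` off it.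
    paley : Core p
    paley = record
      { T = λ i j → η (⟨ j ⟩ - ⟨ i ⟩)
      ; diagonal = λ i → η-zero (divides 0ℤ (lemma₀ ⟨ i ⟩))
      ; off = λ i≢j → η-sign (difference-∤ (i≢j ∘ sym))
      ; orthogonal = λ i j → trans (Σₚ-def (λ u → η (u - ⟨ i ⟩) * η (u - ⟨ j ⟩))) (orthogonal i j)
      ; balanced = λ i → trans (Σₚ-def (λ x → η (x - ⟨ i ⟩))) (trans (shift η η-periodic (- ⟨ i ⟩)) Ση)
      ; ε = proj₁ (parity (classify -1ℤ))
      ; ε-sign = proj₁ (proj₂ (parity (classify -1ℤ)))
      ; symmetric = λ i j → trans (cong η (lemma₁ ⟨ i ⟩ ⟨ j ⟩)) (proj₂ (proj₂ (parity (classify -1ℤ))) (⟨ j ⟩ - ⟨ i ⟩))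
      }
      where
      lemma₀ : ∀ a → a - a ≡ 0ℤ
      lemma₀ = solve-∀
      lemma₁ : ∀ a b → a - b ≡ - (b - a)
      lemma₁ = solve-∀
      cancel : ∀ u c → u + c - c ≡ u
      cancel = solve-∀
      move : ∀ u a b → u + a - b ≡ u + (a - b)
      move = solve-∀
      product-periodic : ∀ a b → Periodic (λ u → η (u - a) * η (u - b))
      product-periodic a b {x} {y} d = cong₂ _*_ (η-periodic (subst (P ∣_) (lemma x y a) d)) (η-periodic (subst (P ∣_) (lemma x y b) d))
        where
        lemma : ∀ x y a → x - y ≡ (x - a) - (y - a)
        lemma = solve-∀
      correlation : ∀ a b → Σₚ (λ u → η (u - a) * η (u - b)) ≡ Σₚ (λ u → η u * η (u + (a - b)))
      correlation a b = trans (sym (shift (λ u → η (u - a) * η (u - b)) (λ {x} {y} → product-periodic a b {x} {y}) a))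
        (Σₚ-cong (λ u → cong₂ _*_ (cong η (cancel u a)) (cong η (move u a b))))
      orthogonal : ∀ i j → Σₚ (λ u → η (u - ⟨ i ⟩) * η (u - ⟨ j ⟩)) ≡ P * δ i j - 1ℤ
      orthogonal i j with i Fin.≟ j
      ... | yes refl = trans (shift (λ u → η u * η u) (λ {x} {y} d → cong₂ _*_ (η-periodic {x} {y} d) (η-periodic {x} {y} d)) (- ⟨ i ⟩))
          (trans Σ-η² (trans (lemma P) (cong (λ s → P * s - 1ℤ) (sym (δ-refl i)))))
        where
        lemma : ∀ P → P - 1ℤ ≡ P * 1ℤ - 1ℤ
        lemma = solve-∀
      ... | no i≢j = trans (correlation ⟨ i ⟩ ⟨ j ⟩) (trans (Σ-ηη (⟨ i ⟩ - ⟨ j ⟩) (difference-∤ i≢j))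
          (trans (lemma P) (cong (λ s → P * s - 1ℤ) (sym (δ-≢ i≢j)))))
        where
        lemma : ∀ P → -1ℤ ≡ P * 0ℤ - 1ℤ
        lemma = solve-∀

-- Lower bound: sign colourings in which every pair has too many bad vertices

module Lower where

  open import Defs
  open Sums
  module C = Counting
  open Conference using (RegularConference)
  import Data.Nat as ℕ
  import Data.Nat.Properties as ℕ
  open import Data.Nat using (ℕ; zero; suc)
  open import Data.Integer hiding (sign; suc; pred; _⊔_; _⊖_; NonZero)
  open import Data.Integer.Properties using (*-identityˡ; pos-*; +-injective)
  open import Data.Integer.Tactic.RingSolver using (solve-∀)
  open import Data.Fin as Fin using (Fin; zero; suc; toℕ; fromℕ<; inject≤; remQuot) renaming (_<_ to _<ᶠ_)
  open import Data.Fin.Properties as Fin using (all?; toℕ<n; toℕ-injective; toℕ-fromℕ<; toℕ-inject≤; inject≤-injective)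
  open import Data.Product using (Σ-syntax; _×_; _,_; proj₁; proj₂)
  open import Data.Sum using (_⊎_; inj₁; inj₂)
  open import Data.Sum.Properties using (inj₂-injective)
  open import Data.Empty using (⊥; ⊥-elim)
  open import Function using (_∘_)
  open import Function.Bundles using (Inverse)
  open import Function.Definitions using (Injective)
  open import Relation.Nullary using (¬_; Dec; yes; no)
  open import Relation.Nullary.Decidable using (¬?; _×-dec_; toWitness)
  open import Relation.Binary.Definitions using (tri<; tri≈; tri>)
  open import Relation.Binary.PropositionalEquality

  module _ {m r t : ℕ} (χ : EdgeColouring (complete m) (Fin r)) where
    open EdgeColouring χ

    -- x is the vertex of the part of size 2 that comes first; the vertices before
    -- it see both vertices of this part alike.
    record Spine : Set where
      field
        x x′        : Fin m
        x≢x′        : x ≢ x′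
        leaf        : Fin t → Fin m
        leaf-inj    : Injective _≡_ _≡_ leaf
        x≢leaf      : ∀ i → x ≢ leaf i
        x′≢leaf     : ∀ i → x′ ≢ leaf i
        c           : Fin r
        alike-or-c  : ∀ i → colour x (leaf i) (x≢leaf i) ≡ colour x′ (leaf i) (x′≢leaf i) ⊎
                            colour x (leaf i) (x≢leaf i) ≡ c

    orderable⇒spine : HasOrderableCopy (completeBipartite 2 t) χ → Spine
    orderable⇒spine (f , v , c , ordered) = go (ℕ.<-cmp (toℕ (position (inj₁ zero))) (toℕ (position (inj₁ (suc zero)))))
      where
      open Copy f
      V = Fin 2 ⊎ Fin t

      position : V → Fin (2 ℕ.+ t)
      position = Inverse.from v

      at-position : ∀ y → Inverse.to v (position y) ≡ y
      at-position y = Inverse.inverseˡ v refl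

      position-injective : ∀ y z → position y ≡ position z → y ≡ z
      position-injective y z e = trans (sym (at-position y)) (trans (cong (Inverse.to v) e) (at-position z))

      -- The list of colours has t + 1 entries for t + 2 places. A vertex preceding another is not
      -- in the last place and so indexes the list.
      early : ∀ y z → position y <ᶠ position z → toℕ (position y) ℕ.< suc t
      early y z y<z = ℕ.<-≤-trans y<z (ℕ.≤-pred (toℕ<n (position z)))

      colour-at : ∀ y z (y<z : position y <ᶠ position z) (e : OppositeSides y z) →
                  colour (embed y) (embed z) (adj {y} {z} e) ≡ c (fromℕ< (early y z y<z))
      colour-at y z y<z e = ends (Inverse.to v (inject≤ i _)) (Inverse.to v (position z))
          (trans (cong (Inverse.to v) ι≡) (at-position y)) (at-position z)
          (ordered i (position z) (subst (_<ᶠ position z) (sym ι≡) y<z)) e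
        where
        i = fromℕ< (early y z y<z)
        ι≡ : inject≤ i _ ≡ position y
        ι≡ = toℕ-injective (trans (toℕ-inject≤ i _) (toℕ-fromℕ< (early y z y<z)))
        -- The proof of adjacency depends on the end points, so they are generalised before the
        -- equations are matched.
        ends : ∀ y′ z′ → y′ ≡ y → z′ ≡ z →
               ((e : OppositeSides y′ z′) → colour (embed y′) (embed z′) (adj {y′} {z′} e) ≡ c i) →
               (e : OppositeSides y z) → colour (embed y) (embed z) (adj {y} {z} e) ≡ c i
        ends _ _ refl refl h = h

      spine : ∀ (k k′ : Fin 2) → k ≢ k′ → position (inj₁ k) <ᶠ position (inj₁ k′) → Spine
      spine k k′ k≢k′ first = record
        { x = embed (inj₁ k) ; x′ = embed (inj₁ k′)
        ; x≢x′ = λ e → k≢k′ (inj₁-inj (injective e))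
        ; leaf = embed ∘ inj₂
        ; leaf-inj = inj₂-injective ∘ injective
        ; x≢leaf = λ i → adj {inj₁ k} {inj₂ i} _
        ; x′≢leaf = λ i → adj {inj₁ k′} {inj₂ i} _
        ; c = c (fromℕ< (early (inj₁ k) (inj₁ k′) first))
        ; alike-or-c = alike-or-c
        }
        where
        inj₁-inj : ∀ {a b : Fin 2} → inj₁ {B = Fin t} a ≡ inj₁ b → a ≡ b
        inj₁-inj refl = refl
        flip-colour : ∀ j (i : Fin t) → colour (embed (inj₁ j)) (embed (inj₂ i)) (adj {inj₁ j} {inj₂ i} _) ≡
                                         colour (embed (inj₂ i)) (embed (inj₁ j)) (adj {inj₂ i} {inj₁ j} _)
        flip-colour j i = colour-sym (embed (inj₁ j)) (embed (inj₂ i)) (adj {inj₁ j} {inj₂ i} _)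
        alike-or-c : ∀ i → colour (embed (inj₁ k)) (embed (inj₂ i)) (adj {inj₁ k} {inj₂ i} _) ≡
                             colour (embed (inj₁ k′)) (embed (inj₂ i)) (adj {inj₁ k′} {inj₂ i} _) ⊎
                           colour (embed (inj₁ k)) (embed (inj₂ i)) (adj {inj₁ k} {inj₂ i} _) ≡
                             c (fromℕ< (early (inj₁ k) (inj₁ k′) first))
        alike-or-c i with ℕ.<-cmp (toℕ (position (inj₁ k))) (toℕ (position (inj₂ i)))
        ... | tri< k<i _ _ = inj₂ (colour-at (inj₁ k) (inj₂ i) k<i _)
        ... | tri≈ _ e _ with position-injective (inj₁ k) (inj₂ i) (toℕ-injective e)
        ... | ()
        alike-or-c i | tri> _ _ i<k = inj₁ (trans (flip-colour k i) (trans (colour-at (inj₂ i) (inj₁ k) i<k _)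
          (trans (sym (colour-at (inj₂ i) (inj₁ k′) (ℕ.<-trans i<k first) _)) (sym (flip-colour k′ i)))))

      go : _ → Spine
      go (tri< first _ _) = spine zero (suc zero) (λ ()) first
      go (tri> _ _ first) = spine (suc zero) zero (λ ()) first
      go (tri≈ _ e _) with position-injective (inj₁ zero) (inj₁ (suc zero)) (toℕ-injective e)
      ... | ()

  module _ {N} (M : Fin N → Row N) (M-symmetric : ∀ i j → M i j ≡ M j i) where

    PlusMinus : Fin N → Fin N → Fin N → Set
    PlusMinus a b u = M a u ≡ 1ℤ × M b u ≡ -1ℤ

    plusMinus? : ∀ a b u → Dec (PlusMinus a b u)
    plusMinus? a b u = (M a u ≟ 1ℤ) ×-dec (M b u ≟ -1ℤ)

    -- The entry 0 also receives the second colour; in the matrices used below it occurs at most on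
    -- the diagonal, where there is no edge.
    colourOf : ℤ → Fin 2
    colourOf s with s ≟ 1ℤ
    ... | yes _ = zero
    ... | no _  = suc zero

    sign-colouring : ∀ {m} → (Fin m → Fin N) → EdgeColouring (complete m) (Fin 2)
    sign-colouring ι = record
      { colour     = λ x y _ → colourOf (M (ι x) (ι y))
      ; colour-sym = λ x y _ → cong colourOf (M-symmetric (ι x) (ι y))
      }

    record Avoiding (m t : ℕ) (ι : Fin m → Fin N) : Set where
      field
        a b      : Fin m
        a≢b      : a ≢ b
        leaf     : Fin t → Fin m
        leaf-inj : Injective _≡_ _≡_ leaf
        a≢leaf   : ∀ i → a ≢ leaf i
        b≢leaf   : ∀ i → b ≢ leaf i
        avoids   : ∀ i → ¬ PlusMinus (ι a) (ι b) (ι (leaf i))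

    -- A leaf is excluded when its edge to `x′` has colour `c` and its edge to `x` has the other
    -- one. If `c` is the colour of +, this is the pattern (+ , -) on `x′` , `x`; otherwise it is (+
    -- , -) on `x` , `x′`. So one pattern serves both cases, with the pair swapped.
    spine⇒avoiding : ∀ {m t} (ι : Fin m → Fin N) → Spine {t = t} (sign-colouring ι) → Avoiding m t ι
    spine⇒avoiding {m} {t} ι σ = go c refl
      where
      open Spine σ
      go : ∀ d → c ≡ d → Avoiding m t ι
      go zero c≡0 = record
        { a = x′ ; b = x ; a≢b = x≢x′ ∘ sym ; leaf = leaf ; leaf-inj = leaf-inj ; a≢leaf = x′≢leaf ; b≢leaf = x≢leaf
        ; avoids = λ i (p , m) → contra p m (alike-or-c i) c≡0 }
        where
        contra : ∀ {s s′ d} → s′ ≡ 1ℤ → s ≡ -1ℤ → colourOf s ≡ colourOf s′ ⊎ colourOf s ≡ d → d ≡ zero → ⊥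
        contra refl refl (inj₁ ()) _
        contra refl refl (inj₂ e) refl with e
        ... | ()
      go (suc zero) c≡1 = record
        { a = x ; b = x′ ; a≢b = x≢x′ ; leaf = leaf ; leaf-inj = leaf-inj ; a≢leaf = x≢leaf ; b≢leaf = x′≢leaf
        ; avoids = λ i (p , m) → contra p m (alike-or-c i) c≡1 }
        where
        contra : ∀ {s s′ d} → s ≡ 1ℤ → s′ ≡ -1ℤ → colourOf s ≡ colourOf s′ ⊎ colourOf s ≡ d → d ≡ suc zero → ⊥
        contra refl refl (inj₁ ()) _
        contra refl refl (inj₂ e) refl with e
        ... | ()

    -- Besides the leaves, two further columns `v` and `w` lack the pattern; counting them as well
    -- is what makes the bound sharp.
    avoiding⇒bound : ∀ {t} a b (u : Fin t → Fin N) → Injective _≡_ _≡_ u → (∀ i → ¬ PlusMinus a b (u i)) →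
                     ∀ v w → v ≢ w → (∀ i → v ≢ u i) → (∀ i → w ≢ u i) → ¬ PlusMinus a b v → ¬ PlusMinus a b w →
                     C.count (plusMinus? a b) ℕ.+ (2 ℕ.+ t) ℕ.≤ N
    avoiding⇒bound {t} a b u u-inj u-avoids v w v≢w v≢u w≢u v-avoids w-avoids =
      subst (C.count (plusMinus? a b) ℕ.+ (2 ℕ.+ t) ℕ.≤_) (C.count-¬ (plusMinus? a b))
        (ℕ.+-monoʳ-≤ (C.count (plusMinus? a b)) (C.injection⇒≤count (¬? ∘ plusMinus? a b) u⁺ u⁺-inj u⁺-avoids))
      where
      u⁺ : Fin (2 ℕ.+ t) → Fin N
      u⁺ zero          = v
      u⁺ (suc zero)    = w
      u⁺ (suc (suc i)) = u i
      u⁺-inj : Injective _≡_ _≡_ u⁺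
      u⁺-inj {zero}        {zero}        _ = refl
      u⁺-inj {zero}        {suc zero}    e = ⊥-elim (v≢w e)
      u⁺-inj {zero}        {suc (suc j)} e = ⊥-elim (v≢u j e)
      u⁺-inj {suc zero}    {zero}        e = ⊥-elim (v≢w (sym e))
      u⁺-inj {suc zero}    {suc zero}    _ = refl
      u⁺-inj {suc zero}    {suc (suc j)} e = ⊥-elim (w≢u j e)
      u⁺-inj {suc (suc i)} {zero}        e = ⊥-elim (v≢u i (sym e))
      u⁺-inj {suc (suc i)} {suc zero}    e = ⊥-elim (w≢u i (sym e))
      u⁺-inj {suc (suc i)} {suc (suc j)} e = cong (λ k → suc (suc k)) (u-inj e)
      u⁺-avoids : ∀ i → ¬ PlusMinus a b (u⁺ i)
      u⁺-avoids zero          = v-avoids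
      u⁺-avoids (suc zero)    = w-avoids
      u⁺-avoids (suc (suc i)) = u-avoids i

    IsTrit : ℤ → Set
    IsTrit s = s ≡ 0ℤ ⊎ IsSign s

    pos-sum : ∀ {n} (f : Fin n → ℕ) → + C.sum f ≡ ∑[ i < n ] (+ f i)
    pos-sum {zero}  f = refl
    pos-sum {suc n} f = cong (λ s → + f zero + s) (pos-sum (f ∘ suc))

    -- For f and g among 0, 1, -1, the product (f² + f) (g² - g) is 4 if f = 1 and g = -1, and 0
    -- otherwise. The four sums are its expansion.
    count-plusMinus : ∀ a b → (∀ u → IsTrit (M a u)) → (∀ u → IsTrit (M b u)) →
      + 4 * + C.count (plusMinus? a b) ≡
      (λ u → M a u * M a u) ∙ (λ u → M b u * M b u) + -1ℤ * (λ u → M a u * M a u) ∙ M b +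
      (M a ∙ (λ u → M b u * M b u) + -1ℤ * M a ∙ M b)
    count-plusMinus a b trit-a trit-b = begin
      + 4 * + C.count (plusMinus? a b)             ≡⟨ cong (+ 4 *_) (pos-sum (λ u → C.⟦ plusMinus? a b u ⟧)) ⟩
      + 4 * ∑[ u < N ] (+ C.⟦ plusMinus? a b u ⟧)  ≡⟨ sum-⊙ (+ 4) (λ u → + C.⟦ plusMinus? a b u ⟧) ⟨
      ∑[ u < N ] (+ 4 * + C.⟦ plusMinus? a b u ⟧)  ≡⟨ sum-cong-≗ (λ u → pointwise (trit-a u) (trit-b u)) ⟩
      sum ((p ⊕ -1ℤ ⊙ q) ⊕ (r ⊕ -1ℤ ⊙ s))          ≡⟨ trans (sum-+ (p ⊕ -1ℤ ⊙ q) (r ⊕ -1ℤ ⊙ s))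
                                                        (cong₂ _+_ (split p q) (split r s)) ⟩
      sum p + -1ℤ * sum q + (sum r + -1ℤ * sum s)  ∎
      where
      open ≡-Reasoning
      p q r s : Row N
      p u = (M a u * M a u) * (M b u * M b u)
      q u = (M a u * M a u) * M b u
      r u = M a u * (M b u * M b u)
      s u = M a u * M b u
      split : ∀ (f g : Row N) → sum (f ⊕ -1ℤ ⊙ g) ≡ sum f + -1ℤ * sum g
      split f g = trans (sum-+ f (-1ℤ ⊙ g)) (cong (λ s → sum f + s) (sum-⊙ -1ℤ g))
      pointwise : ∀ {f g} → IsTrit f → IsTrit g → + 4 * + C.⟦ (f ≟ 1ℤ) ×-dec (g ≟ -1ℤ) ⟧ ≡
                  (f * f) * (g * g) + -1ℤ * ((f * f) * g) + (f * (g * g) + -1ℤ * (f * g))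
      pointwise (inj₁ refl)        (inj₁ refl)        = refl
      pointwise (inj₁ refl)        (inj₂ (inj₁ refl)) = refl
      pointwise (inj₁ refl)        (inj₂ (inj₂ refl)) = refl
      pointwise (inj₂ (inj₁ refl)) (inj₁ refl)        = refl
      pointwise (inj₂ (inj₁ refl)) (inj₂ (inj₁ refl)) = refl
      pointwise (inj₂ (inj₁ refl)) (inj₂ (inj₂ refl)) = refl
      pointwise (inj₂ (inj₂ refl)) (inj₁ refl)        = refl
      pointwise (inj₂ (inj₂ refl)) (inj₂ (inj₁ refl)) = refl
      pointwise (inj₂ (inj₂ refl)) (inj₂ (inj₂ refl)) = refl

  module _ {q N} (𝓒 : RegularConference q N) where
    open RegularConference 𝓒

    trit : ∀ a u → IsTrit M symmetric (M a u)
    trit a u with a Fin.≟ u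
    ... | yes refl = inj₁ (diagonal a)
    ... | no a≢u   = inj₂ (off a≢u)

    square : ∀ a u → M a u * M a u ≡ 1ℤ + -1ℤ * δ a u
    square a u with a Fin.≟ u
    ... | yes refl = trans (cong₂ _*_ (diagonal a) (diagonal a)) (cong (λ s → 1ℤ + -1ℤ * s) (sym (δ-refl a)))
    ... | no a≢u   = trans (IsSign-square (off a≢u)) (cong (λ s → 1ℤ + -1ℤ * s) (sym (δ-≢ a≢u)))

    square-∙ : ∀ a (f : Row N) → (λ u → M a u * M a u) ∙ f ≡ sum f + -1ℤ * f a
    square-∙ a f = begin
      (λ u → M a u * M a u) ∙ f          ≡⟨ ∙-cong (square a) (λ _ → refl) ⟩
      (one ⊕ -1ℤ ⊙ δ a) ∙ f              ≡⟨ ∙-⊕ˡ one (-1ℤ ⊙ δ a) f ⟩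
      one ∙ f + (-1ℤ ⊙ δ a) ∙ f          ≡⟨ cong₂ _+_ (trans (∙-comm one f) (∙-one f)) (trans (∙-⊙ˡ -1ℤ (δ a) f) (cong (-1ℤ *_) (δ-∙ a f))) ⟩
      sum f + -1ℤ * f a                  ∎
      where open ≡-Reasoning

    -- The terms of odd degree are q - M b a and q - M a b with opposite signs; equal row sums and
    -- symmetry make them cancel. The quartic term counts the N - 2 columns other than `a` and `b`.
    conference-count : ∀ a b → a ≢ b → + 4 * + C.count (plusMinus? M symmetric a b) ≡ + N - + 2
    conference-count a b a≢b = begin
      + 4 * + C.count (plusMinus? M symmetric a b)
        ≡⟨ count-plusMinus M symmetric a b (trit a) (trit b) ⟩
      sq a ∙ sq b + -1ℤ * sq a ∙ M b + (M a ∙ sq b + -1ℤ * M a ∙ M b)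
        ≡⟨ cong₂ _+_ (cong₂ (λ s t → s + -1ℤ * t) squares (trans (square-∙ a (M b)) (cong (_+ -1ℤ * M b a) (regular b))))
             (cong₂ (λ s t → s + -1ℤ * t) (trans (∙-comm (M a) (sq b)) (trans (square-∙ b (M a)) (cong₂ (λ s t → s + -1ℤ * t) (regular a) (symmetric a b))))
               (trans (orthogonal a b) (zeroʳ-* (+ q * + q) (δ-≢ a≢b)))) ⟩
      + N - + 2 + -1ℤ * (+ q + -1ℤ * M b a) + (+ q + -1ℤ * M b a + -1ℤ * 0ℤ)
        ≡⟨ lemma (+ N - + 2) (+ q) (M b a) ⟩
      + N - + 2 ∎
      where
      open ≡-Reasoning
      sq : Fin N → Row N
      sq a u = M a u * M a u
      squares : sq a ∙ sq b ≡ + N - + 2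
      squares = begin
        sq a ∙ sq b                     ≡⟨ square-∙ a (sq b) ⟩
        sum (sq b) + -1ℤ * sq b a       ≡⟨ cong₂ (λ s t → s + -1ℤ * t) (sym (∙-one (sq b))) (IsSign-square (off (a≢b ∘ sym))) ⟩
        sq b ∙ one + -1ℤ * 1ℤ           ≡⟨ cong (_+ -1ℤ * 1ℤ) (trans (square-∙ b one) (cong (_+ -1ℤ * 1ℤ) (sum-one N))) ⟩
        + N + -1ℤ * 1ℤ + -1ℤ * 1ℤ       ≡⟨ lemma′ (+ N) ⟩
        + N - + 2                       ∎
        where
        lemma′ : ∀ n → n + -1ℤ * 1ℤ + -1ℤ * 1ℤ ≡ n - + 2
        lemma′ = solve-∀
      lemma : ∀ n q s → n + -1ℤ * (q + -1ℤ * s) + (q + -1ℤ * s + -1ℤ * 0ℤ) ≡ n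
      lemma = solve-∀

    conference-colouring : ∀ {m t} → m ℕ.≤ N → Σ[ χ ∈ EdgeColouring (complete m) (Fin 2) ]
      (HasOrderableCopy (completeBipartite 2 t) χ → N ℕ.+ 4 ℕ.* (2 ℕ.+ t) ℕ.≤ 2 ℕ.+ 4 ℕ.* N)
    conference-colouring {m} {t} m≤N = sign-colouring M symmetric ι , λ copy →
        bound (spine⇒avoiding M symmetric ι (orderable⇒spine (sign-colouring M symmetric ι) copy))
      where
      ι : Fin m → Fin N
      ι i = inject≤ i m≤N
      ι-inj : ∀ {i j} → ι i ≡ ι j → i ≡ j
      ι-inj {i} {j} = inject≤-injective m≤N m≤N i j
      bound : Avoiding M symmetric m t ι → N ℕ.+ 4 ℕ.* (2 ℕ.+ t) ℕ.≤ 2 ℕ.+ 4 ℕ.* N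
      bound α = begin
        N ℕ.+ 4 ℕ.* (2 ℕ.+ t)                 ≡⟨ cong (ℕ._+ 4 ℕ.* (2 ℕ.+ t)) N≡ ⟩
        2 ℕ.+ 4 ℕ.* K ℕ.+ 4 ℕ.* (2 ℕ.+ t)     ≡⟨ cong (2 ℕ.+_) (sym (ℕ.*-distribˡ-+ 4 K (2 ℕ.+ t))) ⟩
        2 ℕ.+ 4 ℕ.* (K ℕ.+ (2 ℕ.+ t))         ≤⟨ ℕ.+-monoʳ-≤ 2 (ℕ.*-monoʳ-≤ 4 packed) ⟩
        2 ℕ.+ 4 ℕ.* N                         ∎
        where
        open Avoiding α
        open ℕ.≤-Reasoning
        K = C.count (plusMinus? M symmetric (ι a) (ι b))
        0≢1 : 0ℤ ≢ 1ℤ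
        0≢1 ()
        0≢-1 : 0ℤ ≢ -1ℤ
        0≢-1 ()
        packed : K ℕ.+ (2 ℕ.+ t) ℕ.≤ N
        -- The columns `a` and `b` themselves are the two extra ones, since each has a zero entry on
        -- the diagonal.
        packed = avoiding⇒bound M symmetric (ι a) (ι b) (ι ∘ leaf) (leaf-inj ∘ ι-inj) avoids (ι a) (ι b) (a≢b ∘ ι-inj)
          (λ i → a≢leaf i ∘ ι-inj) (λ i → b≢leaf i ∘ ι-inj)
          (λ (p , _) → 0≢1 (trans (sym (diagonal (ι a))) p)) (λ (_ , p) → 0≢-1 (trans (sym (diagonal (ι b))) p))
        N≡ : N ≡ 2 ℕ.+ 4 ℕ.* K
        N≡ = +-injective (trans (lemma (+ N)) (cong (λ s → + 2 + s) (trans (sym (conference-count (ι a) (ι b) (a≢b ∘ ι-inj))) (sym (pos-* 4 K)))))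
          where
          lemma : ∀ n → n ≡ + 2 + (n - + 2)
          lemma = solve-∀

  record Hadamard (N : ℕ) : Set where
    field
      H          : Fin N → Row N
      symmetric  : ∀ i j → H i j ≡ H j i
      sign       : ∀ i j → IsSign (H i j)
      d          : ℤ
      diagonal   : ∀ i → H i i ≡ d
      orthogonal : ∀ i j → H i ∙ H j ≡ + N * δ i j

  hadamard-⊗ : ∀ {m n} → Hadamard m → Hadamard n → Hadamard (m ℕ.* n)
  hadamard-⊗ {m} {n} 𝓗 𝓚 = record
    { H = λ x → H.H (π₁ x) ⊗ K.H (π₂ x)
    ; symmetric = λ x y → cong₂ _*_ (H.symmetric (π₁ x) (π₁ y)) (K.symmetric (π₂ x) (π₂ y))
    ; sign = λ x y → IsSign-* (H.sign (π₁ x) (π₁ y)) (K.sign (π₂ x) (π₂ y))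
    ; d = H.d * K.d
    ; diagonal = λ x → cong₂ _*_ (H.diagonal (π₁ x)) (K.diagonal (π₂ x))
    ; orthogonal = λ x y → trans (⊗-∙-⊗ (H.H (π₁ x)) (H.H (π₁ y)) (K.H (π₂ x)) (K.H (π₂ y)))
        (trans (cong₂ _*_ (H.orthogonal (π₁ x) (π₁ y)) (K.orthogonal (π₂ x) (π₂ y)))
        (trans (lemma (+ m) (+ n) (δ (π₁ x) (π₁ y)) (δ (π₂ x) (π₂ y)))
               (cong₂ _*_ (sym (pos-* m n)) (sym (δ-⊗ {m} {n} x y)))))
    }
    where
    module H = Hadamard 𝓗
    module K = Hadamard 𝓚
    π₁ : Fin (m ℕ.* n) → Fin m
    π₁ x = proj₁ (remQuot {m} n x)
    π₂ : Fin (m ℕ.* n) → Fin n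
    π₂ x = proj₂ (remQuot {m} n x)
    lemma : ∀ m n d d′ → m * d * (n * d′) ≡ m * n * (d * d′)
    lemma = solve-∀

  hadamard-1 : Hadamard 1
  hadamard-1 = record
    { H = λ _ → one ; symmetric = λ _ _ → refl ; sign = λ _ _ → inj₁ refl ; d = 1ℤ ; diagonal = λ _ → refl
    ; orthogonal = λ { zero zero → refl } }

  -- Distinct rows of J - 2 I of order n have inner product n - 4, which singles out n = 4.
  hadamard-4 : Hadamard 4
  hadamard-4 = record
    { H = H
    ; symmetric = λ i j → cong (λ s → 1ℤ - + 2 * s) (δ-sym i j)
    ; sign = sign
    ; d = -1ℤ
    ; diagonal = λ i → cong (λ s → 1ℤ - + 2 * s) (δ-refl i)
    ; orthogonal = toWitness {a? = all? λ i → all? λ j → (H i ∙ H j) ≟ (+ 4 * δ i j)} _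
    }
    where
    H : Fin 4 → Row 4
    H i j = 1ℤ - + 2 * δ i j
    sign : ∀ i j → IsSign (H i j)
    sign i j with i Fin.≟ j
    ... | yes refl = inj₂ (cong (λ s → 1ℤ - + 2 * s) (δ-refl i))
    ... | no i≢j   = inj₁ (cong (λ s → 1ℤ - + 2 * s) (δ-≢ i≢j))

  hadamard-4^ : ∀ k → Hadamard (4 ℕ.^ k)
  hadamard-4^ zero    = hadamard-1
  hadamard-4^ (suc k) = hadamard-⊗ hadamard-4 (hadamard-4^ k)

  -- Switching with respect to row zero makes the entries of column zero constant,
  -- so that deleting vertex zero destroys no occurrence of the pattern (+ , -).
  module _ {n} (𝓗 : Hadamard (suc n)) where
    open Hadamard 𝓗
    private
      N = suc n

      w : Row N
      w x = H x zero

      w² : ∀ x → w x * w x ≡ 1ℤ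
      w² x = IsSign-square (sign x zero)

      M : Fin N → Row N
      M x y = w x * w y * H x y

      M-symmetric : ∀ x y → M x y ≡ M y x
      M-symmetric x y = cong₂ _*_ (lemma (w x) (w y)) (symmetric x y)
        where
        lemma : ∀ a b → a * b ≡ b * a
        lemma = solve-∀

      M-sign : ∀ x y → IsSign (M x y)
      M-sign x y = IsSign-* (IsSign-* (sign x zero) (sign y zero)) (sign x y)

      M-diagonal : ∀ x → M x x ≡ d
      M-diagonal x = trans (cong₂ _*_ (w² x) (diagonal x)) (*-identityˡ d)

      M-zero : ∀ x → M x zero ≡ d
      M-zero x = trans (lemma (w x) (w zero)) (trans (cong (_* w zero) (w² x)) (trans (*-identityˡ (w zero)) (diagonal zero)))
        where
        lemma : ∀ a b → a * b * a ≡ a * a * b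
        lemma = solve-∀

      -- By symmetry the switching vector is row zero of `H`, so up to sign the row sum is the inner
      -- product of two distinct rows of `H`. Switching thus also balances every row except row
      -- zero.
      sum-M : ∀ x → sum (M (suc x)) ≡ 0ℤ
      sum-M x = trans (sum-cong-≗ (λ y → trans (lemma (w (suc x)) (w y) (H (suc x) y)) (cong (λ s → w (suc x) * (H (suc x) y * s)) (symmetric y zero))))
        (trans (sum-⊙ (w (suc x)) (λ y → H (suc x) y * H zero y))
               (zeroʳ-* (w (suc x)) (trans (orthogonal (suc x) zero) (zeroʳ-* (+ N) {δ (suc x) zero} refl))))
        where
        lemma : ∀ a b c → a * b * c ≡ a * (c * b)
        lemma = solve-∀

      M∙M : ∀ x y → x ≢ y → M x ∙ M y ≡ 0ℤ
      M∙M x y x≢y = trans (sum-cong-≗ (λ u → trans (lemma (w x) (w y) (w u) (H x u) (H y u))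
          (trans (cong (λ s → w x * w y * (s * (H x u * H y u))) (w² u)) (cong (w x * w y *_) (*-identityˡ (H x u * H y u))))))
        (trans (sum-⊙ (w x * w y) (λ u → H x u * H y u))
               (zeroʳ-* (w x * w y) (trans (orthogonal x y) (zeroʳ-* (+ N) (δ-≢ x≢y)))))
        where
        lemma : ∀ a b u s t → a * u * s * (b * u * t) ≡ a * b * (u * u * (s * t))
        lemma = solve-∀

      M²∙ : ∀ a (f : Row N) → (λ u → M a u * M a u) ∙ f ≡ sum f
      M²∙ a f = sum-cong-≗ (λ u → trans (cong (_* f u) (IsSign-square (M-sign a u))) (*-identityˡ (f u)))

      -- Row zero is avoided, so both row sums and the inner product vanish and only the sum of
      -- squares N survives.
      hadamard-count : ∀ a b → a ≢ b → 4 ℕ.* C.count (plusMinus? M M-symmetric (suc a) (suc b)) ≡ N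
      hadamard-count a b a≢b = +-injective (begin
        + (4 ℕ.* C.count (plusMinus? M M-symmetric (suc a) (suc b)))
          ≡⟨ pos-* 4 (C.count (plusMinus? M M-symmetric (suc a) (suc b))) ⟩
        + 4 * + C.count (plusMinus? M M-symmetric (suc a) (suc b))
          ≡⟨ count-plusMinus M M-symmetric (suc a) (suc b) (λ u → inj₂ (M-sign (suc a) u)) (λ u → inj₂ (M-sign (suc b) u)) ⟩
        sq (suc a) ∙ sq (suc b) + -1ℤ * sq (suc a) ∙ M (suc b) + (M (suc a) ∙ sq (suc b) + -1ℤ * M (suc a) ∙ M (suc b))
          ≡⟨ cong₂ _+_
               (cong₂ (λ s t → s + -1ℤ * t) (trans (M²∙ (suc a) (sq (suc b))) (trans (sum-cong-≗ (λ u → IsSign-square (M-sign (suc b) u))) (sum-one N)))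
                 (trans (M²∙ (suc a) (M (suc b))) (sum-M b)))
               (cong₂ (λ s t → s + -1ℤ * t) (trans (∙-comm (M (suc a)) (sq (suc b))) (trans (M²∙ (suc b) (M (suc a))) (sum-M a)))
                 (M∙M (suc a) (suc b) (a≢b ∘ Fin.suc-injective))) ⟩
        + N + -1ℤ * 0ℤ + (0ℤ + -1ℤ * 0ℤ)
          ≡⟨ lemma (+ N) ⟩
        + N ∎)
        where
        open ≡-Reasoning
        sq : Fin N → Row N
        sq a u = M a u * M a u
        lemma : ∀ n → n + -1ℤ * 0ℤ + (0ℤ + -1ℤ * 0ℤ) ≡ n
        lemma = solve-∀

    hadamard-colouring : ∀ {m t} → m ℕ.≤ n → Σ[ χ ∈ EdgeColouring (complete m) (Fin 2) ]
      (HasOrderableCopy (completeBipartite 2 t) χ → N ℕ.+ 4 ℕ.* (2 ℕ.+ t) ℕ.≤ 4 ℕ.* N)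
    hadamard-colouring {m} {t} m≤n = sign-colouring M M-symmetric ι , λ copy →
        bound (spine⇒avoiding M M-symmetric ι (orderable⇒spine (sign-colouring M M-symmetric ι) copy))
      where
      ι : Fin m → Fin N
      ι i = suc (inject≤ i m≤n)
      ι-inj : ∀ {i j} → ι i ≡ ι j → i ≡ j
      ι-inj {i} {j} e = inject≤-injective m≤n m≤n i j (Fin.suc-injective e)
      1≢-1 : 1ℤ ≢ -1ℤ
      1≢-1 ()
      bound : Avoiding M M-symmetric m t ι → N ℕ.+ 4 ℕ.* (2 ℕ.+ t) ℕ.≤ 4 ℕ.* N
      bound α = begin
        N ℕ.+ 4 ℕ.* (2 ℕ.+ t)           ≡⟨ cong (ℕ._+ 4 ℕ.* (2 ℕ.+ t)) (sym 4K≡N) ⟩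
        4 ℕ.* K ℕ.+ 4 ℕ.* (2 ℕ.+ t)     ≡⟨ sym (ℕ.*-distribˡ-+ 4 K (2 ℕ.+ t)) ⟩
        4 ℕ.* (K ℕ.+ (2 ℕ.+ t))         ≤⟨ ℕ.*-monoʳ-≤ 4 packed ⟩
        4 ℕ.* N                         ∎
        where
        open Avoiding α
        open ℕ.≤-Reasoning
        K = C.count (plusMinus? M M-symmetric (ι a) (ι b))
        4K≡N : 4 ℕ.* K ≡ N
        4K≡N = hadamard-count (inject≤ a m≤n) (inject≤ b m≤n) (λ e → a≢b (inject≤-injective m≤n m≤n a b e))
        zero-avoids : ¬ PlusMinus M M-symmetric (ι a) (ι b) zero
        zero-avoids (p , m) = 1≢-1 (trans (sym p) (trans (trans (M-zero (ι a)) (sym (M-zero (ι b)))) m))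
        packed-with : ∀ v → v ≡ a ⊎ v ≡ b → ¬ PlusMinus M M-symmetric (ι a) (ι b) (ι v) → K ℕ.+ (2 ℕ.+ t) ℕ.≤ N
        packed-with v v∈ v-avoids = avoiding⇒bound M M-symmetric (ι a) (ι b) (ι ∘ leaf) (leaf-inj ∘ ι-inj) avoids
          zero (ι v) (λ ()) (λ _ ()) (λ i → v≢leaf v∈ i ∘ ι-inj) zero-avoids v-avoids
          where
          v≢leaf : v ≡ a ⊎ v ≡ b → ∀ i → v ≢ leaf i
          v≢leaf (inj₁ refl) = a≢leaf
          v≢leaf (inj₂ refl) = b≢leaf
        packed : K ℕ.+ (2 ℕ.+ t) ℕ.≤ N
        -- The first extra column is the deleted vertex. The second comes from the constant
        -- diagonal: if it is 1, row `b` has no - in column `b`; if it is -1, row `a` has no + in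
        -- column `a`.
        packed with subst IsSign (diagonal zero) (sign zero zero)
        ... | inj₁ d≡1  = packed-with b (inj₂ refl) (λ (_ , m) → 1≢-1 (trans (sym d≡1) (trans (sym (M-diagonal (ι b))) m)))
        ... | inj₂ d≡-1 = packed-with a (inj₁ refl) (λ (p , _) → 1≢-1 (trans (sym p) (trans (M-diagonal (ι a)) d≡-1)))

-- Combining the bounds, and the arithmetic of the two families

open Upper using (orderable-or-rainbow; ¬rainbow-K₃)
open Turyn using (core-power)
open Paley using (paley)
open Conference using (RegularConference; alternating; alternating-sign; sum-alternating-odd; core⇒conference)
open Lower using (Hadamard; hadamard-4^; hadamard-colouring; conference-colouring)
open import Defs
open import Data.Nat using (ℕ; _+_; _*_; _∸_; _^_; _/_; _≤_)
open import Data.Nat.Divisibility using (_∤_)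
open import Data.Product using (_×_)

open import Data.Nat using (zero; suc; _<_; s≤s; z≤n)
open import Data.Nat.Properties
open import Data.Nat.Divisibility using (divides; m∣m*n; ∣-trans)
open import Data.Nat.DivMod using (m*n/n≡m)
open import Data.Nat.Tactic.RingSolver using (solve-∀)
open import Data.Fin using (Fin)
open import Data.Product using (Σ-syntax; ∃-syntax; _,_; proj₁; proj₂)
open import Data.Sum using (_⊎_; inj₁; inj₂)
open import Data.Empty using (⊥-elim)
open import Relation.Nullary using (¬_)
open import Relation.Binary.PropositionalEquality

-- A colouring with two colours has no rainbow triangle, so the same colourings bound both minima
-- from below and the upper bound for CR specialises to r′₂. Colourings are needed for every m < n,
-- because `IsMinimum` compares n with all orders.
extremal⇒numbers : ∀ {n t} K → 2 ≤ n → n ≤ 4 * K → t + 1 + K ≤ n →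
  (∀ m → m < n → Σ[ χ ∈ EdgeColouring (complete m) (Fin 2) ] ¬ HasOrderableCopy (completeBipartite 2 t) χ) →
  (r′₂[ completeBipartite 2 t ]≔ n) × (CR[ completeBipartite 2 t , complete 3 ]≔ n)
extremal⇒numbers {n} {t} K 2≤n n≤4K t+1+K≤n extremal =
  ((λ χ → orderable χ (orderable-or-rainbow χ K t 2≤n n≤4K t+1+K≤n)) , λ m every → ≮⇒≥ λ m<n →
    let χ , none = extremal m m<n in none (every χ)) ,
  ((λ r χ → orderable-or-rainbow χ K t 2≤n n≤4K t+1+K≤n) , λ m every → ≮⇒≥ λ m<n →
    let χ , none = extremal m m<n in none (orderable χ (every 2 χ)))
  where
  orderable : ∀ {m} (χ : EdgeColouring (complete m) (Fin 2)) →
              HasOrderableCopy (completeBipartite 2 t) χ ⊎ HasRainbowCopy (complete 3) χ →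
              HasOrderableCopy (completeBipartite 2 t) χ
  orderable χ (inj₁ copy)    = copy
  orderable χ (inj₂ rainbow) = ⊥-elim (¬rainbow-K₃ χ rainbow)

hadamard-extremal : ∀ {N m t} → Hadamard N → m < N → 4 * N < N + 4 * (2 + t) →
  Σ[ χ ∈ EdgeColouring (complete m) (Fin 2) ] ¬ HasOrderableCopy (completeBipartite 2 t) χ
hadamard-extremal {_} {m} {t} 𝓗 (s≤s m≤n) large =
  proj₁ colouring , λ copy → <⇒≱ large (proj₂ colouring copy)
  where
  colouring = hadamard-colouring 𝓗 {m} {t} m≤n

-- With K = a and n = 4 a, the equation t + 1 + K = n is met exactly. On fewer vertices the matrix
-- bound would read 16 a + 4 ≤ 16 a.
powers-of-four : ∀ a {t} → 1 ≤ a → t + 1 ≡ 3 * a → Hadamard (4 * a) →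
  (r′₂[ completeBipartite 2 t ]≔ (4 * a)) × (CR[ completeBipartite 2 t , complete 3 ]≔ (4 * a))
powers-of-four a {t} 1≤a t+1≡3a 𝓗 = extremal⇒numbers a
  (≤-trans (s≤s (s≤s z≤n)) (*-monoʳ-≤ 4 1≤a)) ≤-refl (≤-reflexive (trans (cong (_+ a) t+1≡3a) (+-comm (3 * a) a)))
  λ m m<n → hadamard-extremal 𝓗 m<n (begin-strict
    4 * (4 * a)                     <⟨ m<m+n (4 * (4 * a)) {4} (s≤s z≤n) ⟩
    4 * (4 * a) + 4                 ≡⟨ lemma₁ a ⟩
    4 * a + 4 * (1 + 3 * a)         ≡⟨ cong (λ s → 4 * a + 4 * (1 + s)) t+1≡3a ⟨
    4 * a + 4 * (1 + (t + 1))       ≡⟨ lemma₂ a t ⟩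
    4 * a + 4 * (2 + t)             ∎)
  where
  open ≤-Reasoning
  lemma₁ : ∀ a → 4 * (4 * a) + 4 ≡ 4 * a + 4 * (1 + 3 * a)
  lemma₁ = solve-∀
  lemma₂ : ∀ a t → 4 * a + 4 * (1 + (t + 1)) ≡ 4 * a + 4 * (2 + t)
  lemma₂ = solve-∀

even-or-odd : ∀ n → (∃[ h ] n ≡ h + h) ⊎ (∃[ h ] n ≡ suc (h + h))
even-or-odd zero = inj₁ (0 , refl)
even-or-odd (suc n) with even-or-odd n
... | inj₁ (h , refl) = inj₂ (h , refl)
... | inj₂ (h , refl) = inj₁ (suc h , cong suc (sym (+-suc h h)))

odd : ∀ {n} → 2 ∤ n → ∃[ h ] n ≡ suc (h + h)
odd {n} 2∤n with even-or-odd n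
... | inj₁ (h , refl) = ⊥-elim (2∤n (divides h (trans (cong (h +_) (sym (+-identityʳ h))) (*-comm 2 h))))
... | inj₂ h          = h

-- The positive exponent makes p a divisor of q, so p is odd along with q, as Paley's core needs.
odd-prime-power⇒conference : ∀ {q} → PrimePower q → 2 ∤ q → RegularConference q (suc (q * q))
odd-prime-power⇒conference {q} (p , suc e , p-prime , _ , refl) 2∤q with odd 2∤q
... | h , q≡ = core⇒conference (core-power (paley p-prime (λ 2∣p → 2∤q (∣-trans 2∣p (m∣m*n (p ^ e))))) (suc e))
  (alternating q) (alternating-sign q) (sum-alternating-odd h q≡)

-- Here n = N + 1 = 4 b + 3, so K = b + 1 and t = n - 1 - K = 3 b + 1. On at most N vertices the
-- matrix bound would read 16 b + 14 ≤ 16 b + 10.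
squares : ∀ b N {t} → N ≡ 2 + 4 * b → t ≡ 3 * b + 1 → ∀ {q} → RegularConference q N →
  (r′₂[ completeBipartite 2 t ]≔ suc N) × (CR[ completeBipartite 2 t , complete 3 ]≔ suc N)
squares b N refl refl 𝓒 = extremal⇒numbers (suc b)
  (s≤s (s≤s z≤n)) (≤-trans (n≤1+n _) (≤-reflexive (lemma₁ b))) (≤-reflexive (lemma₂ b))
  λ { m (s≤s m≤N) → let χ , bound = conference-colouring 𝓒 {m} {3 * b + 1} m≤N in
      χ , λ copy → <⇒≱ (≤-trans (s≤s (m≤m+n (2 + 4 * (2 + 4 * b)) 3)) (≤-reflexive (lemma₃ b))) (bound copy) }
  where
  lemma₁ : ∀ b → suc (suc (2 + 4 * b)) ≡ 4 * suc b
  lemma₁ = solve-∀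
  lemma₂ : ∀ b → 3 * b + 1 + 1 + suc b ≡ suc (2 + 4 * b)
  lemma₂ = solve-∀
  lemma₃ : ∀ b → suc (2 + 4 * (2 + 4 * b) + 3) ≡ 2 + 4 * b + 4 * (2 + (3 * b + 1))
  lemma₃ = solve-∀

odd-squares : ∀ q → ∃[ h ] q ≡ suc (h + h) → RegularConference q (suc (q * q)) →
  (r′₂[ completeBipartite 2 ((3 * q ^ 2 + 1) / 4) ]≔ (q ^ 2 + 2))
  × (CR[ completeBipartite 2 ((3 * q ^ 2 + 1) / 4) , complete 3 ]≔ (q ^ 2 + 2))
odd-squares q (h , q≡) 𝓒 = subst (λ n → (r′₂[ completeBipartite 2 t ]≔ n) × (CR[ completeBipartite 2 t , complete 3 ]≔ n)) n≡
  (squares b (suc (q * q)) {t} N≡ t≡ {q} 𝓒)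
  where
  -- Chosen so that q = 2 h + 1 has q² = 4 b + 1; then 3 q² + 1 = 4 (3 b + 1) and the division by 4
  -- is exact.
  b = h * h + h
  t = (3 * q ^ 2 + 1) / 4
  n≡ : suc (suc (q * q)) ≡ q ^ 2 + 2
  n≡ = trans (cong (λ s → 2 + q * s) (sym (*-identityʳ q))) (+-comm 2 (q ^ 2))
  lemma₁ : ∀ h → (1 + (h + h)) * (1 + (h + h)) ≡ 1 + 4 * (h * h + h)
  lemma₁ = solve-∀
  q²≡ : q * q ≡ 1 + 4 * b
  q²≡ = trans (cong (λ s → s * s) q≡) (lemma₁ h)
  N≡ : suc (q * q) ≡ 2 + 4 * b
  N≡ = cong suc q²≡
  lemma₂ : ∀ b → 3 * (1 + 4 * b) + 1 ≡ (3 * b + 1) * 4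
  lemma₂ = solve-∀
  t≡ : t ≡ 3 * b + 1
  t≡ = trans (cong (λ s → (3 * s + 1) / 4) (trans (cong (q *_) (*-identityʳ q)) q²≡))
    (trans (cong (_/ 4) (lemma₂ b)) (m*n/n≡m (3 * b + 1) 4))

corollary1p12 : ((k : ℕ) → 1 ≤ k →
    (r′₂[ completeBipartite 2 (3 * 4 ^ (k ∸ 1) ∸ 1) ]≔ (4 ^ k))
    × (CR[ completeBipartite 2 (3 * 4 ^ (k ∸ 1) ∸ 1) , complete 3 ]≔ (4 ^ k)))
    ×
    ((q : ℕ) → PrimePower q → 2 ∤ q →
    (r′₂[ completeBipartite 2 ((3 * q ^ 2 + 1) / 4) ]≔ (q ^ 2 + 2))
    × (CR[ completeBipartite 2 ((3 * q ^ 2 + 1) / 4) , complete 3 ]≔ (q ^ 2 + 2)))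
corollary1p12 = part-i , part-ii
  where
  part-i : (k : ℕ) → 1 ≤ k →
    (r′₂[ completeBipartite 2 (3 * 4 ^ (k ∸ 1) ∸ 1) ]≔ (4 ^ k))
    × (CR[ completeBipartite 2 (3 * 4 ^ (k ∸ 1) ∸ 1) , complete 3 ]≔ (4 ^ k))
  part-i (suc j) _ = powers-of-four (4 ^ j) {3 * 4 ^ j ∸ 1} (m^n>0 4 j)
    (m∸n+n≡m (≤-trans (m^n>0 4 j) (m≤m+n (4 ^ j) _))) (hadamard-4^ (suc j))

  part-ii : (q : ℕ) → PrimePower q → 2 ∤ q →
    (r′₂[ completeBipartite 2 ((3 * q ^ 2 + 1) / 4) ]≔ (q ^ 2 + 2))
    × (CR[ completeBipartite 2 ((3 * q ^ 2 + 1) / 4) , complete 3 ]≔ (q ^ 2 + 2))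
  part-ii q pp 2∤q = odd-squares q (odd 2∤q) (odd-prime-power⇒conference pp 2∤q)
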